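{- For every $n\ge1$, $$\mathrm{SH}_n=\sum_{\substack{\lambda\vdash n\\ \text{all parts odd}}}\frac{2^{\ell}}{\ell!}\cdot\frac{\ell!}{m_1!\,m_3!\,m_5!\cdots}\cdot\prod_{j=0}^{\ell-2}(n+\ell-1-2j)\;V_\lambda,$$ where $\ell=\ell(\lambda)$ is the number of parts of $\lambda$, $m_i$ is the number of parts equal to $i$, the product $\prod_{j=0}^{\ell-2}(n+\ell-1-2j)=(n+\ell-1)(n+\ell-3)\cdots(n-\ell+3)$ is empty (equal to $1$) when $\ell=1$, and $V_\lambda=P_{\lambda_1}P_{\lambda_2}\cdots$.
   Context: Work in the ring $\Lambda_{\mathbb Q}$ of symmetric functions with rational coefficients in variables $x=(x_1,x_2,\dots)$; $p_k$ denotes the power sum. For $f\in\Lambda_{\mathbb Q}$, its shiftification $f(x/x)$ is obtained by writing $f$ as a polynomial in the power sums and substituting $p_{2i+1}\mapsto 2p_{2i+1}$ and $p_{2i}\mapsto 0$ for all $i\ge1$. A parking function of length $n$ is a sequence $(a_1,\dots,a_n)$ of positive integers whose weakly increasing rearrangement $b_1\le\cdots\le b_n$ satisfies $b_i\le i$ for all $i$. The symmetric group $S_n$ acts on the set of parking functions of length $n$ by permuting coordinates; $\mathrm{PF}_n$ denotes the Frobenius characteristic of this permutation representation ($\mathrm{PF}_0=1$). Define $\mathrm{SH}_n(x)=\mathrm{PF}_n(x/x)$. The one-row Schur $P$-functions $P_n$ are defined by $1+2\sum_{n\ge1}P_n(x)t^n=\prod_i\frac{1+x_it}{1-x_it}$.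 For any partition $\lambda$, $V_\lambda=P_{\lambda_1}P_{\lambda_2}\cdots$. (The $P_{2i+1}$, $i\ge0$, are algebraically independent and generate $\Gamma=\mathbb Q[p_1,p_3,p_5,\dots]$, so this expansion is unique.) -}

module Defs where

open import Algebra.Bundles using (CommutativeRing)
import Algebra.Properties.Semiring.Exp as Exp
import Algebra.Properties.Semiring.Sum as Sum
open import Data.Bool.Base using (if_then_else_)
open import Data.Fin.Base using (Fin; toℕ)
import Data.Fin.Base as Fin
import Data.Fin.Properties as Fin
open import Data.Fin.Permutation as Perm using (Permutation′; _⟨$⟩ʳ_; _⟨$⟩ˡ_)
open import Data.Integer.Base as ℤ using (ℤ; +_)
open import Data.List.Base as List using (List; []; _∷_; length; filter; map; upTo; allFin)
open import Data.List.Relation.Binary.Pointwise.Base using (Pointwise)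
open import Data.List.Relation.Binary.Pointwise.Properties as Pointwise using ()
open import Data.List.Relation.Unary.All as All using (All; all?)
open import Data.List.Relation.Unary.All.Properties as All using ()
open import Data.List.Relation.Unary.Linked using (Linked; linked?)
open import Data.Nat.Base as ℕ using (ℕ; zero; suc; NonZero; _≤_; _≥_; _!)
open import Data.Nat.Divisibility using (_∣_; _∣?_)
open import Data.Nat.ListAction using (product) renaming (sum to total)
open import Data.Nat.ListAction.Properties using (product≢0)
open import Data.Nat.Properties as ℕ using (_!≢0; ≤-decTotalOrder)
open import Data.List.Sort.InsertionSort ≤-decTotalOrder using (sort)
open import Data.Product.Base using (_×_; _,_; ∃)
open import Data.Rational.Base as ℚ using (ℚ; 0ℚ; 1ℚ; ½)
open import Data.Vec.Base as Vec using (Vec; []; _∷_; tabulate; lookup; toList)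
open import Data.Vec.Functional using () renaming (foldr to foldrFin)
import Data.Vec.Properties as Vec
open import Function.Base using (_∘_)
open import Level using (0ℓ)
open import Relation.Binary.PropositionalEquality using (_≡_)
open import Relation.Nullary.Decidable using (Dec; does; ¬?; _×-dec_)
open import Relation.Nullary.Negation using (¬_)

infix  4 _≈_
infixl 6 _+_
infixl 7 _*_
infix  8 -_

------------------------------------------------------------------------
-- ℚ[X], constructed as the free commutative ℚ-algebra on the set X of
-- indeterminates: terms, with the least congruence that makes them a
-- commutative ring and makes con a ring homomorphism.

data Poly (X : Set) : Set where
  con     : ℚ → Poly X
  var     : X → Poly X
  _+_ _*_ : Poly X → Poly X → Poly X
  -_      : Poly X → Poly X

data _≈_ {X : Set} : Poly X → Poly X → Set where
  ≈-refl      : ∀ {f} → f ≈ f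
  ≈-sym       : ∀ {f g} → f ≈ g → g ≈ f
  ≈-trans     : ∀ {f g h} → f ≈ g → g ≈ h → f ≈ h
  +-cong      : ∀ {f f′ g g′} → f ≈ f′ → g ≈ g′ → f + g ≈ f′ + g′
  *-cong      : ∀ {f f′ g g′} → f ≈ f′ → g ≈ g′ → f * g ≈ f′ * g′
  -‿cong      : ∀ {f f′} → f ≈ f′ → - f ≈ - f′
  +-assoc     : ∀ f g h → (f + g) + h ≈ f + (g + h)
  +-comm      : ∀ f g → f + g ≈ g + f
  +-identityˡ : ∀ f → con 0ℚ + f ≈ f
  -‿inverseˡ  : ∀ f → (- f) + f ≈ con 0ℚ
  *-assoc     : ∀ f g h → (f * g) * h ≈ f * (g * h)
  *-comm      : ∀ f g → f * g ≈ g * f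
  *-identityˡ : ∀ f → con 1ℚ * f ≈ f
  *-distribʳ  : ∀ f g h → (g + h) * f ≈ g * f + h * f
  con-+       : ∀ a b → con (a ℚ.+ b) ≈ con a + con b
  con-*       : ∀ a b → con (a ℚ.* b) ≈ con a * con b

polyRing : Set → CommutativeRing 0ℓ 0ℓ
polyRing X = record
  { Carrier = Poly X
  ; _≈_ = _≈_
  ; _+_ = _+_
  ; _*_ = _*_
  ; -_ = -_
  ; 0# = con 0ℚ
  ; 1# = con 1ℚ
  ; isCommutativeRing = record
    { isRing = record
      { +-isAbelianGroup = record
        { isGroup = record
          { isMonoid = record
            { isSemigroup = record
              { isMagma = record
                { isEquivalence = record
                  { refl = ≈-refl ; sym = ≈-sym ; trans = ≈-trans }
                ; ∙-cong = +-cong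
                }
              ; assoc = +-assoc
              }
            ; identity = +-identityˡ , λ f → ≈-trans (+-comm _ _) (+-identityˡ f)
            }
          ; inverse = -‿inverseˡ , λ f → ≈-trans (+-comm _ _) (-‿inverseˡ f)
          ; ⁻¹-cong = -‿cong
          }
        ; comm = +-comm
        }
      ; *-cong = *-cong
      ; *-assoc = *-assoc
      ; *-identity = *-identityˡ , λ f → ≈-trans (*-comm _ _) (*-identityˡ f)
      ; distrib =
          (λ f g h → ≈-trans (*-comm _ _)
             (≈-trans (*-distribʳ f g h) (+-cong (*-comm _ _) (*-comm _ _))))
          , *-distribʳ
      }
    ; *-comm = *-comm
    }
  }

module _ {X : Set} where
  open CommutativeRing (polyRing X) using (semiring)
  open Sum semiring public using (sum)
  open Exp semiring public using (_^_)

  sumOver : {A : Set} → List A → (A → Poly X) → Poly X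
  sumOver xs f = List.foldr (λ a s → f a + s) (con 0ℚ) xs

  productOver : {A : Set} → List A → (A → Poly X) → Poly X
  productOver xs f = List.foldr (λ a s → f a * s) (con 1ℚ) xs

  syntax sumOver xs (λ a → f) = ∑[ a ∈ xs ] f
  syntax productOver xs (λ a → f) = ∏[ a ∈ xs ] f

-- Substitution of polynomials for the indeterminates: the ℚ-algebra
-- homomorphism extending s.
substitute : {X Y : Set} → (X → Poly Y) → Poly X → Poly Y
substitute s (con a) = con a
substitute s (var x) = s x
substitute s (f + g) = substitute s f + substitute s g
substitute s (f * g) = substitute s f * substitute s g
substitute s (- f)   = - substitute s f

substitute-cong : {X Y : Set} (s : X → Poly Y) {f g : Poly X} →
                  f ≈ g → substitute s f ≈ substitute s g
substitute-cong s ≈-refl            = ≈-refl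
substitute-cong s (≈-sym e)         = ≈-sym (substitute-cong s e)
substitute-cong s (≈-trans e e′)    = ≈-trans (substitute-cong s e) (substitute-cong s e′)
substitute-cong s (+-cong e e′)     = +-cong (substitute-cong s e) (substitute-cong s e′)
substitute-cong s (*-cong e e′)     = *-cong (substitute-cong s e) (substitute-cong s e′)
substitute-cong s (-‿cong e)        = -‿cong (substitute-cong s e)
substitute-cong s (+-assoc _ _ _)   = +-assoc _ _ _
substitute-cong s (+-comm _ _)      = +-comm _ _
substitute-cong s (+-identityˡ _)   = +-identityˡ _
substitute-cong s (-‿inverseˡ _)    = -‿inverseˡ _
substitute-cong s (*-assoc _ _ _)   = *-assoc _ _ _
substitute-cong s (*-comm _ _)      = *-comm _ _
substitute-cong s (*-identityˡ _)   = *-identityˡ _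
substitute-cong s (*-distribʳ _ _ _) = *-distribʳ _ _ _
substitute-cong s (con-+ a b)       = con-+ a b
substitute-cong s (con-* a b)       = con-* a b

------------------------------------------------------------------------
-- Symmetric functions

-- The ring of symmetric functions over ℚ, as the polynomial ring in the
-- power sums p₁, p₂, …; the indeterminate var i is p_{i+1}.
Λ : Set
Λ = Poly ℕ

-- p 0 is a dummy value that is never used.
p : ℕ → Λ
p zero    = con 1ℚ
p (suc i) = var i

-- The symmetric polynomial f(x₁, …, x_N), with var j standing for x_{j+1}.
-- Λ embeds into the product over all N of the rings ℚ[x₁, …, x_N], so an
-- identity of symmetric functions in x = (x₁, x₂, …) is one that holds in
-- N variables for every N.
inVariables : (N : ℕ) → Λ → Poly (Fin N)
inVariables N = substitute (λ i → sum {n = N} (λ j → var j ^ suc i))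

-- f(x/x): p_k ↦ 2 p_k for k odd and p_k ↦ 0 for k even.
shiftify : Λ → Λ
shiftify = substitute λ i →
  if does (2 ∣? suc i) then con 0ℚ else con (1ℚ ℚ.+ 1ℚ) * p (suc i)

------------------------------------------------------------------------
-- Words and parking functions

-- 1, 2, …, n
[1⋯_] : ℕ → List ℕ
[1⋯ n ] = map suc (upTo n)

-- All words of length n with letters in a given list.
words : {A : Set} → List A → (n : ℕ) → List (Vec A n)
words as zero    = [] ∷ []
words as (suc n) = List.cartesianProductWith _∷_ as (words as n)

-- Pointwise compares the weakly increasing rearrangement b₁ ≤ ⋯ ≤ b_n
-- entry by entry with 1, …, n.
IsParkingFunction : ∀ {n} → Vec ℕ n → Set
IsParkingFunction {n} a =
  All (1 ≤_) (toList a) × Pointwise _≤_ (sort (toList a)) [1⋯ n ]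

isParkingFunction? : ∀ {n} (a : Vec ℕ n) → Dec (IsParkingFunction a)
isParkingFunction? {n} a =
  all? (1 ℕ.≤?_) (toList a) ×-dec Pointwise.decidable ℕ._≤?_ (sort (toList a)) [1⋯ n ]

-- The entries of a parking function of length n lie in {1, …, n}, so
-- restricting the letters loses nothing.
parkingFunctions : (n : ℕ) → List (Vec ℕ n)
parkingFunctions n = filter isParkingFunction? (words [1⋯ n ] n)

------------------------------------------------------------------------
-- The symmetric group and the Frobenius characteristic

-- Each element of S_n exactly once: a permutation of n+1 points is given
-- by the image j of the first point and a permutation of n points
-- (cf. Perm.insert-remove and Perm.remove-insert).
permutations : (n : ℕ) → List (Permutation′ n)
permutations zero    = Perm.id ∷ []
permutations (suc n) =
  List.cartesianProductWith (Perm.insert Fin.zero) (allFin (suc n)) (permutations n)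

iterate : ∀ {n} → Permutation′ n → ℕ → Fin n → Fin n
iterate w zero    i = i
iterate w (suc k) i = w ⟨$⟩ʳ iterate w k i

-- Exponents below n suffice, as cycles have length at most n.
SameCycle : ∀ {n} → Permutation′ n → Fin n → Fin n → Set
SameCycle {n} w i j = ∃ λ (k : Fin n) → iterate w (toℕ k) i ≡ j

sameCycle? : ∀ {n} (w : Permutation′ n) (i j : Fin n) → Dec (SameCycle w i j)
sameCycle? w i j = Fin.any? λ k → iterate w (toℕ k) i Fin.≟ j

cycleLength : ∀ {n} → Permutation′ n → Fin n → ℕ
cycleLength {n} w i = length (filter (sameCycle? w i) (allFin n))

-- Each cycle is represented by its least element.
IsCycleMinimum : ∀ {n} → Permutation′ n → Fin n → Set
IsCycleMinimum {n} w i = ∀ (k : Fin n) → i Fin.≤ iterate w (toℕ k) i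

isCycleMinimum? : ∀ {n} (w : Permutation′ n) (i : Fin n) → Dec (IsCycleMinimum w i)
isCycleMinimum? w i = Fin.all? λ k → i Fin.≤? iterate w (toℕ k) i

cycleType : ∀ {n} → Permutation′ n → List ℕ
cycleType {n} w = map (cycleLength w) (filter (isCycleMinimum? w) (allFin n))

-- ch χ = (1/n!) ∑_{w ∈ S_n} χ(w) p_{ρ(w)}, where ρ(w) is the cycle type of w.
frobenius : (n : ℕ) → (Permutation′ n → ℚ) → Λ
frobenius n χ =
  con ((+ 1 ℚ./ (n !)) {{n !≢0}}) *
  (∑[ w ∈ permutations n ] (con (χ w) * (∏[ k ∈ cycleType w ] p k)))

-- (w · a)_{w(i)} = a_i
permute : ∀ {A : Set} {n} → Permutation′ n → Vec A n → Vec A n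
permute w a = tabulate λ i → lookup a (w ⟨$⟩ˡ i)

-- The (b , a) entry of the matrix by which w acts on the ℚ-vector space
-- with basis the parking functions.
entry : ∀ {n} → Permutation′ n → Vec ℕ n → Vec ℕ n → ℚ
entry w b a = if does (Vec.≡-dec ℕ._≟_ b (permute w a)) then 1ℚ else 0ℚ

parkingCharacter : (n : ℕ) → Permutation′ n → ℚ
parkingCharacter n w =
  List.foldr (λ a → entry w a a ℚ.+_) 0ℚ (parkingFunctions n)

PF : ℕ → Λ
PF n = frobenius n (parkingCharacter n)

SH : ℕ → Λ
SH n = shiftify (PF n)

------------------------------------------------------------------------
-- Power series in t, given by their coefficient sequences, and the
-- one-row Schur P-functions

module _ {X : Set} where

  Series : Set
  Series = ℕ → Poly X

  infixl 7 _⋆_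

  _⋆_ : Series → Series → Series
  (f ⋆ g) n = sum {n = suc n} λ k → f (toℕ k) * g (n ℕ.∸ toℕ k)

  1ₛ : Series
  1ₛ zero    = con 1ℚ
  1ₛ (suc _) = con 0ℚ

  -- 1 + c t
  1+_t : Poly X → Series
  1+ c t = λ where
    zero          → con 1ℚ
    (suc zero)    → c
    (suc (suc _)) → con 0ℚ

  -- 1 / (1 - c t)
  1/1-_t : Poly X → Series
  (1/1- c t) n = c ^ n

  1/1-t-inverse : ∀ c n → (1+ (- c) t ⋆ 1/1- c t) n ≈ 1ₛ n
  1/1-t-inverse c zero = ≈-trans (+-identityʳ _) (*-identityˡ _)
    where open CommutativeRing (polyRing X) using (+-identityʳ)
  1/1-t-inverse c (suc n) = begin
    con 1ℚ * (c * c ^ n) + (- c * c ^ n + rest)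
      ≈⟨ +-cong (*-identityˡ _) (+-cong (≈-sym (-‿distribˡ-* _ _)) rest≈0) ⟩
    c * c ^ n + (- (c * c ^ n) + con 0ℚ)
      ≈⟨ +-cong ≈-refl (+-identityʳ _) ⟩
    c * c ^ n + - (c * c ^ n)
      ≈⟨ -‿inverseʳ _ ⟩
    con 0ℚ ∎
    where
    open CommutativeRing (polyRing X) using (+-identityʳ; -‿inverseʳ; zeroˡ; setoid; ring; semiring)
    open import Algebra.Properties.Ring ring using (-‿distribˡ-*)
    open import Relation.Binary.Reasoning.Setoid setoid
    open Sum semiring using (sum-cong-≋; sum-replicate-zero)
    term : Fin n → Poly X
    term k = con 0ℚ * c ^ (suc n ℕ.∸ suc (suc (toℕ k)))
    rest : Poly X
    rest = sum term
    rest≈0 : rest ≈ con 0ℚ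
    rest≈0 = ≈-trans (sum-cong-≋ {n} {term} {λ _ → con 0ℚ} (λ k → zeroˡ _)) (sum-replicate-zero n)

-- ∏_{i=1}^N (1 + x_i t) / (1 - x_i t)
generatingFunction : (N : ℕ) → Series {Fin N}
generatingFunction N =
  foldrFin _⋆_ 1ₛ (λ (i : Fin N) → 1+ var i t ⋆ 1/1- var i t)

-- P_n(x₁, …, x_N) for n ≥ 1, from 1 + 2 ∑_{n ≥ 1} P_n tⁿ = generatingFunction N.
-- The value at n = 0 has no meaning and is never used.
P : (N n : ℕ) → Poly (Fin N)
P N n = con ½ * generatingFunction N n

V : (N : ℕ) → List ℕ → Poly (Fin N)
V N λs = ∏[ k ∈ λs ] P N k

------------------------------------------------------------------------
-- Partitions

IsPartition : ℕ → List ℕ → Set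
IsPartition n λs = Linked _≥_ λs × All (1 ≤_) λs × total λs ≡ n

isPartition? : ∀ n λs → Dec (IsPartition n λs)
isPartition? n λs =
  linked? ℕ._≥?_ λs ×-dec all? (1 ℕ.≤?_) λs ×-dec total λs ℕ.≟ n

-- A partition of n has at most n parts, all of them in {1, …, n}.
partitions : ℕ → List (List ℕ)
partitions n = filter (isPartition? n)
  (List.concatMap (λ ℓ → map toList (words [1⋯ n ] ℓ)) (upTo (suc n)))

Odd : ℕ → Set
Odd k = ¬ (2 ∣ k)

odd? : ∀ k → Dec (Odd k)
odd? k = ¬? (2 ∣? k)

oddPartitions : ℕ → List (List ℕ)
oddPartitions n = filter (all? odd?) (partitions n)

multiplicity : ℕ → List ℕ → ℕ
multiplicity i λs = length (filter (i ℕ.≟_) λs)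

-- m₁! m₃! ⋯ m_{2n-1}!; for a partition of n all further multiplicities
-- m_{2n+1}, m_{2n+3}, … vanish.
oddMultiplicityFactorials : ℕ → List ℕ → ℕ
oddMultiplicityFactorials n λs =
  product (map (λ i → multiplicity (suc (2 ℕ.* i)) λs !) (upTo n))

oddMultiplicityFactorials≢0 : ∀ n λs → NonZero (oddMultiplicityFactorials n λs)
oddMultiplicityFactorials≢0 n λs =
  product≢0 (All.map⁺ (All.universal (λ i → multiplicity (suc (2 ℕ.* i)) λs !≢0) (upTo n)))

-- ∏_{j=0}^{ℓ-2} (n + ℓ - 1 - 2j); the product is over all j < ℓ ∸ 1.
steppedProduct : ℕ → ℕ → ℤ
steppedProduct n ℓ =
  List.foldr (λ j → (+ n ℤ.+ + ℓ ℤ.- + 1 ℤ.- + 2 ℤ.* + j) ℤ.*_) (+ 1) (upTo (ℓ ℕ.∸ 1))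

coefficient : ℕ → List ℕ → ℚ
coefficient n λs =
  (+ (2 ℕ.^ ℓ) ℚ./ (ℓ !)) {{ℓ !≢0}}
  ℚ.* (+ (ℓ !) ℚ./ oddMultiplicityFactorials n λs) {{oddMultiplicityFactorials≢0 n λs}}
  ℚ.* (steppedProduct n ℓ ℚ./ 1)
  where ℓ = length λs

-- Write m = n + 1 and G = ∏ (1 + xᵢ t) / (1 - xᵢ t) = 1 + 2 ∑ Pₖ tᵏ.
--
-- By Pollak's argument, exactly one of the m rotations of a word over ℤ/m of
-- length n is a parking function, so m times the parking character is the
-- number of words fixed by w, which is m to the number of cycles of w.  Hence
-- m PFₙ is the n-th coefficient of exp (m ∑ pₖ tᵏ / k), and shiftifying turns
-- this exponential into Gᵐ.
--
-- Since G(t) G(-t) = 1, the odd part W of G satisfies G = W + √(1 + W²), so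
-- Gᵐ = exp (m arsinh W).  The power series of exp (m arsinh w) is found from
-- (1 + w²) y″ + w y′ = m² y; its ℓ-th coefficient is m / ℓ! times
-- (n + ℓ - 1)(n + ℓ - 3) ⋯ (n - ℓ + 3).  As W = 2 ∑ P₂ᵢ₊₁ t²ⁱ⁺¹, the
-- multinomial theorem expands Wˡ over odd partitions of length ℓ.

module Submission where

open import Defs
open import Algebra.Bundles using (CommutativeRing)
import Algebra.Properties.CommutativeMonoid.Sum as CommutativeMonoidSum
import Algebra.Properties.CommutativeSemigroup as CommutativeSemigroup
import Algebra.Properties.Ring as RingProperties
import Algebra.Properties.Semiring.Exp as Exp
import Algebra.Properties.Semiring.Sum as Sum
import Algebra.Solver.Ring
open import Algebra.Solver.Ring.AlmostCommutativeRing using (_-Raw-AlmostCommutative⟶_; fromCommutativeRing)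
open import Data.Bool.Base using (Bool; true; false; if_then_else_; not; _∧_)
open import Data.Fin.Base as Fin using (Fin; toℕ; punchIn)
open import Data.Fin.Permutation as Perm using (Permutation′; _⟨$⟩ʳ_; _⟨$⟩ˡ_; _∘ₚ_)
import Data.Fin.Permutation.Components as PC
import Data.Fin.Properties as Fin
open import Data.Integer.Base as ℤ using (ℤ; +_)
import Data.Integer.Properties as ℤ
open import Data.Integer.Tactic.RingSolver using () renaming (solve-∀ to ℤ-solve-∀)
open import Data.List.Base as List using (List; []; _∷_; length; filter; map; upTo; allFin)
open import Data.List.Membership.Propositional using (_∈_)
open import Data.List.Membership.Propositional.Properties
  using (∈-filter⁺; ∈-filter⁻; ∈-map⁺; ∈-map⁻; ∈-upTo⁺; ∈-upTo⁻; ∈-cartesianProductWith⁺; ∈-cartesianProductWith⁻; ∈-∃++)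
open import Data.List.Membership.Propositional.Properties.WithK using (unique∧set⇒bag)
import Data.List.Properties as List
open import Data.List.Relation.Binary.BagAndSetEquality using (∼bag⇒↭)
open import Data.List.Relation.Binary.Permutation.Propositional using (_↭_; ↭-sym; ↭-trans; refl; prep; swap; trans)
open import Data.List.Relation.Binary.Permutation.Propositional.Properties
  using (filter-↭; ↭-length; All-resp-↭; ∈-resp-↭; drop-∷) renaming (shift to ↭-shift)
open import Data.List.Relation.Binary.Pointwise.Base using (Pointwise; []; _∷_)
open import Data.List.Relation.Unary.All as All using (All; []; _∷_; all?)
import Data.List.Relation.Unary.All.Properties as All
open import Data.List.Relation.Unary.AllPairs using (AllPairs; []; _∷_)
open import Data.List.Relation.Unary.Any using (here; there)
open import Data.List.Relation.Unary.Linked using (Linked; linked?)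
open import Data.List.Relation.Unary.Linked.Properties using (Linked⇒AllPairs)
open import Data.List.Relation.Unary.Unique.Propositional using (Unique)
import Data.List.Relation.Unary.Unique.Propositional.Properties as Unique
open import Data.List.Sort.Base using (SortingAlgorithm)
open import Data.List.Sort.InsertionSort using (insertionSort)
open import Data.Maybe.Base using (Maybe; just; nothing)
open import Data.Nat.Base as ℕ using (ℕ; zero; suc; NonZero; _≤_; _<_; _≥_; z≤n; s≤s; _!)
open import Data.Nat.Divisibility using (_∣_; _∣?_; divides; ∣m+n∣m⇒∣n; ∣-refl; ∣m∣n⇒∣m+n; ∣1⇒≡1; m∣m*n)
open import Data.Nat.ListAction using (product) renaming (sum to total)
open import Data.Nat.ListAction.Properties using (product≢0)
open import Data.Nat.Properties as ℕ using (≤-decTotalOrder; _!≢0)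
open import Data.Nat.Tactic.RingSolver using (solve-∀)
open import Data.Product.Base using (_×_; _,_; proj₁; proj₂; ∃; ∃-syntax)
open import Data.Rational.Base as ℚ using (ℚ; 0ℚ; 1ℚ; ½)
import Data.Rational.Properties as ℚ
import Data.Rational.Solver as ℚ-Solver
import Data.Rational.Unnormalised.Base as ℚᵘ
import Data.Rational.Unnormalised.Properties as ℚᵘ
open import Data.Sum.Base using (_⊎_; inj₁; inj₂)
open import Data.Vec.Base as Vec using (Vec; []; _∷_; lookup; toList)
open import Data.Vec.Functional using () renaming (foldr to foldrFin)
import Data.Vec.Properties as Vec
open import Function.Base using (_∘_; id; _on_)
open import Function.Bundles using (_⇔_; mk⇔; Equivalence; Injection)
open import Function.Properties.Inverse using (↔⇒↣)
open import Level using (0ℓ)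
open import Relation.Binary.Construct.Flip.Ord using () renaming (decTotalOrder to flip-decTotalOrder)
open import Relation.Binary.Definitions using (tri<; tri≈; tri>)
open import Relation.Binary.PropositionalEquality as ≡ using (_≡_; _≢_)
import Relation.Binary.Reasoning.Setoid as SetoidReasoning
open import Relation.Nullary.Decidable using (Dec; yes; no; does; ¬?; _×-dec_; does-⇔; dec-true; dec-false)
open import Relation.Nullary.Negation using (¬_; contradiction)
open import Relation.Unary using (Decidable)
open SortingAlgorithm (insertionSort ≤-decTotalOrder) using (sort; sort-↭; sort-↗)
private module ↘ = SortingAlgorithm (insertionSort (flip-decTotalOrder ≤-decTotalOrder))

-- ℚ-algebras

-- No exponential, logarithm or square root of a series is ever formed. A series such as exp (m ∑ pₖ
-- tᵏ / k) is known only through an equation D F = r F and its constant term, and the main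
-- identities between series in t are proved by one equation that both sides satisfy; `D-unique`
-- then compares coefficients degree by degree. In this setting G(t) G(-t) = 1 becomes evenness of
-- the logarithmic derivative r of G. It gives the even part U and the odd part W the equations D U
-- = r W and D W = r U, those of cosh and sinh of ∫ r, and U² = 1 + W² follows by differentiating.
-- The equation of the cycle index comes from growing a permutation by one point, placed alone or
-- inside a cycle of length k in one of k ways. The resulting recursion contains the derivation pₖ ↦
-- k pₖ₊₁, which a second use of uniqueness removes. The degree n and the exponent n + 1 are linked
-- only in the result: the exponent is fixed, whole series are compared, and then the n-th
-- coefficient is read off. The factor n + 1 stays on the left until the end, where it is cancelled.

record IsAlgebraMap (R : CommutativeRing 0ℓ 0ℓ) (ι : ℚ → CommutativeRing.Carrier R) : Set where
  private module R = CommutativeRing R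
  field
    ι-+ : ∀ a b → ι (a ℚ.+ b) R.≈ ι a R.+ ι b
    ι-* : ∀ a b → ι (a ℚ.* b) R.≈ ι a R.* ι b
    ι-0 : ι 0ℚ R.≈ R.0#
    ι-1 : ι 1ℚ R.≈ R.1#

-- Provides a ring solver with rational coefficients, whose equality is decidable. Polynomials and
-- power series are both presented as ℚ-algebras so that each gets one.
module RingOver (R : CommutativeRing 0ℓ 0ℓ) {ι : ℚ → CommutativeRing.Carrier R} (isAlgebraMap : IsAlgebraMap R ι) where
  private module R = CommutativeRing R
  open IsAlgebraMap isAlgebraMap public

  ι-neg : ∀ a → ι (ℚ.- a) R.≈ R.- ι a
  ι-neg a = RingProperties.+-inverseʳ-unique R.ring (ι a) (ι (ℚ.- a))
    (R.trans (R.sym (ι-+ a (ℚ.- a))) (R.trans (R.reflexive (≡.cong ι (ℚ.+-inverseʳ a))) ι-0))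

  morphism : ℚ.+-*-rawRing -Raw-AlmostCommutative⟶ fromCommutativeRing R
  morphism = record
    { ⟦_⟧ = ι ; +-homo = ι-+ ; *-homo = ι-* ; -‿homo = ι-neg ; 0-homo = ι-0 ; 1-homo = ι-1 }

  ι-≟ : ∀ a b → Maybe (ι a R.≈ ι b)
  ι-≟ a b with a ℚ.≟ b
  ... | yes a≡b = just (R.reflexive (≡.cong ι a≡b))
  ... | no  _   = nothing

  module Solver = Algebra.Solver.Ring ℚ.+-*-rawRing (fromCommutativeRing R) morphism ι-≟

con-isAlgebraMap : ∀ X → IsAlgebraMap (polyRing X) con
con-isAlgebraMap X = record { ι-+ = con-+ ; ι-* = con-* ; ι-0 = ≈-refl ; ι-1 = ≈-refl }

-- Integers inside the rationals, and reciprocals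

fromℤ : ℤ → ℚ
fromℤ i = i ℚ./ 1

fromℕ : ℕ → ℚ
fromℕ n = fromℤ (+ n)

-- Rationals are kept in lowest terms, so `fromℤ` does not compute on variables. On unnormalised
-- representatives the claim is an identity between integers.
fromℤ-+ : ∀ i j → fromℤ (i ℤ.+ j) ≡ fromℤ i ℚ.+ fromℤ j
fromℤ-+ i j = ℚ.toℚᵘ-injective (begin
  ℚ.toℚᵘ (fromℤ (i ℤ.+ j))                  ≈⟨ ℚ.toℚᵘ-fromℚᵘ ((i ℤ.+ j) ℚᵘ./ 1) ⟩
  (i ℤ.+ j) ℚᵘ./ 1                          ≈⟨ ℚᵘ.*≡* (≡.cong₂ (λ i j → (i ℤ.+ j) ℤ.* + 1) (≡.sym (ℤ.*-identityʳ i))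
      (≡.sym (ℤ.*-identityʳ j))) ⟩
  (i ℚᵘ./ 1) ℚᵘ.+ (j ℚᵘ./ 1)                ≈⟨ ℚᵘ.+-cong (ℚ.toℚᵘ-fromℚᵘ (i ℚᵘ./ 1)) (ℚ.toℚᵘ-fromℚᵘ (j ℚᵘ./ 1)) ⟨
  ℚ.toℚᵘ (fromℤ i) ℚᵘ.+ ℚ.toℚᵘ (fromℤ j)    ≈⟨ ℚ.toℚᵘ-homo-+ (fromℤ i) (fromℤ j) ⟨
  ℚ.toℚᵘ (fromℤ i ℚ.+ fromℤ j)              ∎)
  where open SetoidReasoning ℚᵘ.≃-setoid

fromℤ-* : ∀ i j → fromℤ (i ℤ.* j) ≡ fromℤ i ℚ.* fromℤ j
fromℤ-* i j = ℚ.toℚᵘ-injective (begin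
  ℚ.toℚᵘ (fromℤ (i ℤ.* j))                  ≈⟨ ℚ.toℚᵘ-fromℚᵘ ((i ℤ.* j) ℚᵘ./ 1) ⟩
  (i ℚᵘ./ 1) ℚᵘ.* (j ℚᵘ./ 1)                ≈⟨ ℚᵘ.*-cong (ℚ.toℚᵘ-fromℚᵘ (i ℚᵘ./ 1)) (ℚ.toℚᵘ-fromℚᵘ (j ℚᵘ./ 1)) ⟨
  ℚ.toℚᵘ (fromℤ i) ℚᵘ.* ℚ.toℚᵘ (fromℤ j)    ≈⟨ ℚ.toℚᵘ-homo-* (fromℤ i) (fromℤ j) ⟨
  ℚ.toℚᵘ (fromℤ i ℚ.* fromℤ j)              ∎)
  where open SetoidReasoning ℚᵘ.≃-setoid

fromℕ-+ : ∀ m n → fromℕ (m ℕ.+ n) ≡ fromℕ m ℚ.+ fromℕ n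
fromℕ-+ m n = fromℤ-+ (+ m) (+ n)

fromℕ-suc : ∀ n → fromℕ (suc n) ≡ 1ℚ ℚ.+ fromℕ n
fromℕ-suc n = fromℕ-+ 1 n

fromℕ-* : ∀ m n → fromℕ (m ℕ.* n) ≡ fromℕ m ℚ.* fromℕ n
fromℕ-* m n = ≡.trans (≡.cong fromℤ (ℤ.pos-* m n)) (fromℤ-* (+ m) (+ n))

/-fromℕ : ∀ a d .{{_ : ℕ.NonZero d}} → + a ℚ./ d ≡ fromℕ a ℚ.* (+ 1 ℚ./ d)
/-fromℕ a d@(suc _) = ℚ.toℚᵘ-injective (begin
  ℚ.toℚᵘ (+ a ℚ./ d)                        ≈⟨ ℚ.toℚᵘ-fromℚᵘ (+ a ℚᵘ./ d) ⟩
  + a ℚᵘ./ d                                ≈⟨ ℚᵘ.*≡* (≡.cong₂ ℤ._*_ (≡.sym (ℤ.*-identityʳ (+ a)))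
      (≡.cong +_ (ℕ.*-identityˡ d))) ⟩
  (+ a ℚᵘ./ 1) ℚᵘ.* (+ 1 ℚᵘ./ d)            ≈⟨ ℚᵘ.*-cong (ℚ.toℚᵘ-fromℚᵘ (+ a ℚᵘ./ 1)) (ℚ.toℚᵘ-fromℚᵘ (+ 1 ℚᵘ./ d)) ⟨
  ℚ.toℚᵘ (fromℕ a) ℚᵘ.* ℚ.toℚᵘ (+ 1 ℚ./ d)  ≈⟨ ℚ.toℚᵘ-homo-* (fromℕ a) (+ 1 ℚ./ d) ⟨
  ℚ.toℚᵘ (fromℕ a ℚ.* (+ 1 ℚ./ d))          ∎)
  where open SetoidReasoning ℚᵘ.≃-setoid

/-inverse : ∀ n .{{_ : ℕ.NonZero n}} → (+ 1 ℚ./ n) ℚ.* fromℕ n ≡ 1ℚ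
/-inverse n@(suc _) = ≡.trans (ℚ.*-comm (+ 1 ℚ./ n) (fromℕ n)) (≡.trans (≡.sym (/-fromℕ n n))
  (ℚ.toℚᵘ-injective (ℚᵘ.≃-trans (ℚ.toℚᵘ-fromℚᵘ (+ n ℚᵘ./ n)) (ℚᵘ.*≡* (ℤ.*-comm (+ n) (+ 1))))))

-- Inserting 1 = (1/r) · r and regrouping leaves (1/q) · q. This serves the recursion of 1/n! and
-- the removal of one letter from a multiset; `q` is kept apart from `c * r` so that each
-- denominator has its own proof of being nonzero.
/-cancel : ∀ (q r : ℕ) .{{_ : ℕ.NonZero q}} .{{_ : ℕ.NonZero r}} c → q ≡ c ℕ.* r → fromℕ c ℚ.* (+ 1 ℚ./ q) ≡ + 1 ℚ./ r
/-cancel q r c q≡ = begin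
  fromℕ c ℚ.* x                        ≡⟨ ℚ.*-identityʳ _ ⟨
  fromℕ c ℚ.* x ℚ.* 1ℚ                 ≡⟨ ≡.cong (fromℕ c ℚ.* x ℚ.*_) (/-inverse r) ⟨
  fromℕ c ℚ.* x ℚ.* (z ℚ.* fromℕ r)    ≡⟨ solve 4 (λ a x z b → a :* x :* (z :* b) := x :* (a :* b) :* z) ≡.refl (fromℕ c) x z
      (fromℕ r) ⟩
  x ℚ.* (fromℕ c ℚ.* fromℕ r) ℚ.* z    ≡⟨ ≡.cong (λ t → x ℚ.* t ℚ.* z) (≡.trans (≡.sym (fromℕ-* c r)) (≡.cong fromℕ (≡.sym q≡))) ⟩
  x ℚ.* fromℕ q ℚ.* z                  ≡⟨ ≡.cong (ℚ._* z) (/-inverse q) ⟩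
  1ℚ ℚ.* z                             ≡⟨ ℚ.*-identityˡ z ⟩
  z                                    ∎
  where
  open ≡.≡-Reasoning
  open ℚ-Solver.+-*-Solver using (solve; _:*_; _:=_)
  x = + 1 ℚ./ q
  z = + 1 ℚ./ r

infix 9 1/_!
1/_! : ℕ → ℚ
1/ n ! = (+ 1 ℚ./ (n !)) {{n !≢0}}

1/-!-suc : ∀ n → fromℕ (suc n) ℚ.* 1/ suc n ! ≡ 1/ n !
1/-!-suc n = /-cancel (suc n !) (n !) {{suc n !≢0}} {{n !≢0}} (suc n) ≡.refl

-- Power series

module _ {X : Set} where
  open CommutativeRing (polyRing X) public
    using (setoid; zeroˡ; zeroʳ; +-identityʳ; *-identityʳ; +-congˡ; +-congʳ; *-congˡ; *-congʳ; -‿inverseʳ; distribˡ)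
  open RingOver (polyRing X) (con-isAlgebraMap X) public using (module Solver)
  open Solver using (_:+_; _:*_; :-_; _:=_; solve)
  open Sum (CommutativeRing.semiring (polyRing X)) using (sum-cong-≋; ∑-distrib-+; *-distribˡ-sum)

  private
    module ≈ = SetoidReasoning (setoid)
    Seq = Series {X}

  infix 4 _≋_
  _≋_ : Seq → Seq → Set
  f ≋ g = ∀ n → f n ≈ g n

  tail : Seq → Seq
  tail f n = f (suc n)

  infixl 6 _⊕_
  infixr 7 _·_
  _⊕_ : Seq → Seq → Seq
  (f ⊕ g) n = f n + g n

  _·_ : Poly X → Seq → Seq
  (c · f) n = c * f n

  0ₛ : Seq
  0ₛ _ = con 0ℚ

  -- Both indices k and n ∸ k stay at or below n. This locality admits `r ⋆_` as a right-hand side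
  -- in `D-unique` and makes truncation harmless.
  ⋆-cong-≤ : ∀ {f f′ g g′ : Seq} n → (∀ k → k ≤ n → f k ≈ f′ k) → (∀ k → k ≤ n → g k ≈ g′ k) →
             (f ⋆ g) n ≈ (f′ ⋆ g′) n
  ⋆-cong-≤ n e e′ = sum-cong-≋ {suc n} λ k →
    *-cong (e (toℕ k) (ℕ.≤-pred (Fin.toℕ<n k))) (e′ (n ℕ.∸ toℕ k) (ℕ.m∸n≤m n (toℕ k)))

  ⋆-cong : ∀ {f f′ g g′ : Seq} → f ≋ f′ → g ≋ g′ → f ⋆ g ≋ f′ ⋆ g′
  ⋆-cong e e′ n = ⋆-cong-≤ n (λ k _ → e k) (λ k _ → e′ k)

  ⋆-distribʳ : ∀ h f g → (f ⊕ g) ⋆ h ≋ f ⋆ h ⊕ g ⋆ h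
  ⋆-distribʳ h f g n = ≈-trans
    (sum-cong-≋ {suc n} λ k → *-distribʳ (h (n ℕ.∸ toℕ k)) (f (toℕ k)) (g (toℕ k)))
    (∑-distrib-+ {suc n} (λ k → f (toℕ k) * h (n ℕ.∸ toℕ k)) (λ k → g (toℕ k) * h (n ℕ.∸ toℕ k)))

  ·-⋆ : ∀ c f g → (c · f) ⋆ g ≋ c · (f ⋆ g)
  ·-⋆ c f g n = ≈-trans
    (sum-cong-≋ {suc n} λ k → *-assoc c (f (toℕ k)) (g (n ℕ.∸ toℕ k)))
    (≈-sym (*-distribˡ-sum {suc n} c (λ k → f (toℕ k) * g (n ℕ.∸ toℕ k))))

  -- The product peels off `f 0` by computation; this is the mirror image, peeling off `g 0`.
  -- Commutativity is then an induction that matches the two forms.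
  ⋆-suc-comm : ∀ f g n → (f ⋆ g) (suc n) ≈ f (suc n) * g 0 + (f ⋆ tail g) n
  ⋆-suc-comm f g zero = solve 4 (λ a b c d → a :* b :+ (c :* d :+ Solver.con 0ℚ) := c :* d :+ (a :* b :+ Solver.con 0ℚ)) ≈-refl
    (f 0) (g 1) (f 1) (g 0)
  ⋆-suc-comm f g (suc n) = ≈-trans (+-congˡ (⋆-suc-comm (tail f) g n))
    (solve 3 (λ a b c → a :+ (b :+ c) := b :+ (a :+ c)) ≈-refl
      (f 0 * g (suc (suc n))) (f (suc (suc n)) * g 0) ((tail f ⋆ tail g) n))

  ⋆-comm : ∀ f g → f ⋆ g ≋ g ⋆ f
  ⋆-comm f g zero    = +-congʳ (*-comm (f 0) (g 0))
  ⋆-comm f g (suc n) = ≈-trans (+-cong (*-comm (f 0) (g (suc n))) (⋆-comm (tail f) g n)) (≈-sym (⋆-suc-comm g f n))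

  -- `tail (f ⋆ g)` unfolds to `(f 0 · tail g) ⊕ (tail f ⋆ g)`, so induction on the degree with
  -- distributivity replaces the reindexing of a double sum.
  ⋆-assoc : ∀ f g h → (f ⋆ g) ⋆ h ≋ f ⋆ (g ⋆ h)
  ⋆-assoc f g h zero = solve 3 (λ a b c → (a :* b :+ Solver.con 0ℚ) :* c :+ Solver.con 0ℚ := a :* (b :* c :+ Solver.con 0ℚ) :+
      Solver.con 0ℚ) ≈-refl
    (f 0) (g 0) (h 0)
  ⋆-assoc f g h (suc n) = begin
    (f 0 * g 0 + con 0ℚ) * h (suc n) + (((f 0 · tail g) ⊕ (tail f ⋆ g)) ⋆ h) n
      ≈⟨ +-congˡ (⋆-distribʳ h (f 0 · tail g) (tail f ⋆ g) n) ⟩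
    (f 0 * g 0 + con 0ℚ) * h (suc n) + (((f 0 · tail g) ⋆ h) n + ((tail f ⋆ g) ⋆ h) n)
      ≈⟨ +-congˡ (+-cong (·-⋆ (f 0) (tail g) h n) (⋆-assoc (tail f) g h n)) ⟩
    (f 0 * g 0 + con 0ℚ) * h (suc n) + (f 0 * (tail g ⋆ h) n + (tail f ⋆ (g ⋆ h)) n)
      ≈⟨ solve 5 (λ a b c d e → (a :* b :+ Solver.con 0ℚ) :* c :+ (a :* d :+ e) := a :* (b :* c :+ d) :+ e) ≈-refl
           (f 0) (g 0) (h (suc n)) ((tail g ⋆ h) n) ((tail f ⋆ (g ⋆ h)) n) ⟩
    f 0 * (g 0 * h (suc n) + (tail g ⋆ h) n) + (tail f ⋆ (g ⋆ h)) n ∎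
    where open ≈

  0ₛ-⋆ : ∀ f → 0ₛ ⋆ f ≋ 0ₛ
  0ₛ-⋆ f zero    = ≈-trans (+-identityʳ _) (zeroˡ (f 0))
  0ₛ-⋆ f (suc n) = ≈-trans (+-cong (zeroˡ _) (0ₛ-⋆ f n)) (+-identityʳ _)

  1ₛ-⋆ : ∀ f → 1ₛ ⋆ f ≋ f
  1ₛ-⋆ f zero    = ≈-trans (+-identityʳ _) (*-identityˡ (f 0))
  1ₛ-⋆ f (suc n) = ≈-trans (+-cong (*-identityˡ _) (0ₛ-⋆ f n)) (+-identityʳ _)

  seriesRing : CommutativeRing 0ℓ 0ℓ
  seriesRing = record
    { Carrier = Seq
    ; _≈_ = _≋_
    ; _+_ = _⊕_
    ; _*_ = _⋆_
    ; -_ = λ f n → - f n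
    ; 0# = 0ₛ
    ; 1# = 1ₛ
    ; isCommutativeRing = record
      { isRing = record
        { +-isAbelianGroup = record
          { isGroup = record
            { isMonoid = record
              { isSemigroup = record
                { isMagma = record
                  { isEquivalence = record
                    { refl = λ _ → ≈-refl ; sym = λ e n → ≈-sym (e n) ; trans = λ e e′ n → ≈-trans (e n) (e′ n) }
                  ; ∙-cong = λ e e′ n → +-cong (e n) (e′ n)
                  }
                ; assoc = λ f g h n → +-assoc (f n) (g n) (h n)
                }
              ; identity = (λ f n → +-identityˡ (f n)) , λ f n → +-identityʳ (f n)
              }
            ; inverse = (λ f n → -‿inverseˡ (f n)) , λ f n → -‿inverseʳ (f n)
            ; ⁻¹-cong = λ e n → -‿cong (e n)
            }
          ; comm = λ f g n → +-comm (f n) (g n)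
          }
        ; *-cong = ⋆-cong
        ; *-assoc = ⋆-assoc
        ; *-identity = 1ₛ-⋆ , λ f n → ≈-trans (⋆-comm f 1ₛ n) (1ₛ-⋆ f n)
        ; distrib =
            (λ f g h n → ≈-trans (⋆-comm f (g ⊕ h) n) (≈-trans (⋆-distribʳ f g h n) (+-cong (⋆-comm g f n) (⋆-comm h f n))))
            , ⋆-distribʳ
        }
      ; *-comm = ⋆-comm
      }
    }

  conₛ : ℚ → Seq
  conₛ a = con a · 1ₛ

  conₛ-⋆ : ∀ a f → conₛ a ⋆ f ≋ con a · f
  conₛ-⋆ a f n = ≈-trans (·-⋆ (con a) 1ₛ f n) (*-congˡ (1ₛ-⋆ f n))

  conₛ-isAlgebraMap : IsAlgebraMap seriesRing conₛ
  conₛ-isAlgebraMap = record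
    { ι-+ = λ a b n → ≈-trans (*-congʳ (con-+ a b)) (*-distribʳ (1ₛ n) (con a) (con b))
    ; ι-* = λ a b n → ≈-trans (*-congʳ (con-* a b)) (≈-trans (*-assoc (con a) (con b) (1ₛ n)) (≈-sym (conₛ-⋆ a (conₛ b) n)))
    ; ι-0 = λ n → zeroˡ (1ₛ n)
    ; ι-1 = λ n → *-identityˡ (1ₛ n)
    }

  module SeriesOver = RingOver seriesRing conₛ-isAlgebraMap
  open Exp (CommutativeRing.semiring seriesRing) public using () renaming (_^_ to _^ₛ_)

  D : Seq → Seq
  D f n = con (fromℕ (suc n)) * f (suc n)

  private
    -- The Euler operator t d/dt. It preserves degrees, so its product rule is the termwise identity
    -- n = k + (n - k); the rule for `D` is the same identity read in degree n + 1.
    θ : Seq → Seq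
    θ f n = con (fromℕ n) * f n

    θ-⋆ : ∀ f g n → con (fromℕ n) * (f ⋆ g) n ≈ (θ f ⋆ g) n + (f ⋆ θ g) n
    θ-⋆ f g n = begin
      con (fromℕ n) * (f ⋆ g) n
        ≈⟨ *-distribˡ-sum {suc n} (con (fromℕ n)) (λ k → f (toℕ k) * g (n ℕ.∸ toℕ k)) ⟩
      sum {n = suc n} (λ k → con (fromℕ n) * (f (toℕ k) * g (n ℕ.∸ toℕ k)))
        ≈⟨ sum-cong-≋ {suc n} (λ k → split (toℕ k) (ℕ.≤-pred (Fin.toℕ<n k))) ⟩
      sum {n = suc n} (λ k → con (fromℕ (toℕ k)) * f (toℕ k) * g (n ℕ.∸ toℕ k) + f (toℕ k) *
          (con (fromℕ (n ℕ.∸ toℕ k)) * g (n ℕ.∸ toℕ k)))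
        ≈⟨ ∑-distrib-+ {suc n} (λ k → θ f (toℕ k) * g (n ℕ.∸ toℕ k)) (λ k → f (toℕ k) * θ g (n ℕ.∸ toℕ k)) ⟩
      (θ f ⋆ g) n + (f ⋆ θ g) n ∎
      where
      open ≈
      split : ∀ k → k ≤ n → con (fromℕ n) * (f k * g (n ℕ.∸ k)) ≈ con (fromℕ k) * f k * g (n ℕ.∸ k) + f k *
          (con (fromℕ (n ℕ.∸ k)) * g (n ℕ.∸ k))
      split k k≤n = ≈-trans
        (*-congʳ (≈-trans (CommutativeRing.reflexive (polyRing X)
          (≡.cong con (≡.trans (≡.cong fromℕ (≡.sym (ℕ.m+[n∸m]≡n k≤n))) (fromℕ-+ k (n ℕ.∸ k)))))
              (con-+ (fromℕ k) (fromℕ (n ℕ.∸ k)))))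
        (solve 4 (λ a b x y → (a :+ b) :* (x :* y) := a :* x :* y :+ x :* (b :* y)) ≈-refl
          (con (fromℕ k)) (con (fromℕ (n ℕ.∸ k))) (f k) (g (n ℕ.∸ k)))

  D-⋆ : ∀ f g → D (f ⋆ g) ≋ D f ⋆ g ⊕ f ⋆ D g
  D-⋆ f g n = begin
    con (fromℕ (suc n)) * (f ⋆ g) (suc n)                ≈⟨ θ-⋆ f g (suc n) ⟩
    (θ f ⋆ g) (suc n) + (f ⋆ θ g) (suc n)          ≈⟨ +-congˡ (⋆-suc-comm f (θ g) n) ⟩
    con 0ℚ * f 0 * g (suc n) + (D f ⋆ g) n + (f (suc n) * (con 0ℚ * g 0) + (f ⋆ D g) n)
      ≈⟨ solve 6 (λ a b c d x y → Solver.con 0ℚ :* a :* b :+ x :+ (c :* (Solver.con 0ℚ :* d) :+ y) := x :+ y) ≈-refl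
           (f 0) (g (suc n)) (f (suc n)) (g 0) ((D f ⋆ g) n) ((f ⋆ D g) n) ⟩
    (D f ⋆ g) n + (f ⋆ D g) n ∎
    where open ≈

  D-cong : ∀ {f g} → f ≋ g → D f ≋ D g
  D-cong e n = *-congˡ (e (suc n))

  D-⊕ : ∀ f g → D (f ⊕ g) ≋ D f ⊕ D g
  D-⊕ f g n = distribˡ (con (fromℕ (suc n))) (f (suc n)) (g (suc n))

  D-· : ∀ c f → D (c · f) ≋ c · D f
  D-· c f n = solve 3 (λ a b x → a :* (b :* x) := b :* (a :* x)) ≈-refl (con (fromℕ (suc n))) c (f (suc n))

  con-suc-cancel : ∀ n {f g : Poly X} → con (fromℕ (suc n)) * f ≈ con (fromℕ (suc n)) * g → f ≈ g
  con-suc-cancel n {f} {g} e = ≈-trans (≈-sym (inv f)) (≈-trans (*-congˡ e) (inv g))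
    where
    inv : ∀ h → con (+ 1 ℚ./ suc n) * (con (fromℕ (suc n)) * h) ≈ h
    inv h = ≈-trans (≈-sym (*-assoc _ _ h)) (≈-trans (*-congʳ (≈-trans (≈-sym (con-* _ _))
      (CommutativeRing.reflexive (polyRing X) (≡.cong con (/-inverse (suc n)))))) (*-identityˡ h))

  -- Coefficient n + 1 of a solution is `T f n` divided by n + 1, and `T f n` sees only coefficients
  -- up to n. `T` is an arbitrary local operator rather than multiplication by a series because the
  -- equation of the cycle index also differentiates coefficients.
  D-unique : (T : Seq → Seq) →
             (∀ f g n → (∀ k → k ≤ n → f k ≈ g k) → T f n ≈ T g n) →
             ∀ {f g} → D f ≋ T f → D g ≋ T g → f 0 ≈ g 0 → f ≋ g
  D-unique T local {f} {g} Df Dg f₀≈g₀ n = upto n n ℕ.≤-refl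
    where
    upto : ∀ n k → k ≤ n → f k ≈ g k
    upto zero    .zero z≤n = f₀≈g₀
    upto (suc n) k k≤1+n with k ℕ.≤? n
    ... | yes k≤n = upto n k k≤n
    ... | no  k≰n = ≡.subst (λ k → f k ≈ g k) (ℕ.≤-antisym (ℕ.≰⇒> k≰n) k≤1+n)
      (con-suc-cancel n (≈-trans (Df n) (≈-trans (local f g n (upto n)) (≈-sym (Dg n)))))

  D-unique-⋆ : ∀ r {f g} → D f ≋ r ⋆ f → D g ≋ r ⋆ g → f 0 ≈ g 0 → f ≋ g
  D-unique-⋆ r = D-unique (r ⋆_) λ f g n e → ⋆-cong-≤ {r} {r} n (λ _ _ → ≈-refl) e

shift : {X : Set} → Series {X} → Series {X}
shift f zero    = con 0ℚ
shift f (suc n) = f n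

D-1ₛ : {X : Set} (c : Poly X) → D (c · 1ₛ) ≋ 0ₛ
D-1ₛ c n = ≈-trans (*-congˡ (zeroʳ c)) (zeroʳ _)

-- ∑ aₗ Wˡ by Horner's scheme; as W has no constant term, truncating after
-- n + 1 steps does not change the n-th coefficient.
module Composition {X : Set} (W : Series {X}) (W₀≈0 : W 0 ≈ con 0ℚ) where
  private
    module S = CommutativeRing (seriesRing {X})
    module ≋ = SetoidReasoning S.setoid
    module SS = SeriesOver.Solver {X}
    open SS using (_:+_; _:*_; _:=_)

  W⋆-zero : ∀ f → (W ⋆ f) 0 ≈ con 0ℚ
  W⋆-zero f = ≈-trans (+-identityʳ _) (≈-trans (*-congʳ W₀≈0) (zeroˡ (f 0)))

  -- As `W 0` vanishes, the term containing `f n` drops out and only coefficients strictly below n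
  -- remain. The strict inequality drives `horner-stable` and `step-unique`.
  W⋆-local : ∀ {f g} n → (∀ k → k < n → f k ≈ g k) → (W ⋆ f) n ≈ (W ⋆ g) n
  W⋆-local {f} {g} zero    e = ≈-trans (W⋆-zero f) (≈-sym (W⋆-zero g))
  W⋆-local {f} {g} (suc n) e = +-cong
    (≈-trans (≈-trans (*-congʳ W₀≈0) (zeroˡ _)) (≈-sym (≈-trans (*-congʳ W₀≈0) (zeroˡ _))))
    (⋆-cong-≤ {f = tail W} {tail W} n (λ _ _ → ≈-refl) (λ k k≤n → e k (s≤s k≤n)))

  horner : ℕ → Series {X} → Series {X}
  horner zero    a = 0ₛ
  horner (suc L) a = a 0 · 1ₛ ⊕ W ⋆ horner L (tail a)

  horner-stable : ∀ L L′ a n → n < L → n < L′ → horner L a n ≈ horner L′ a n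
  horner-stable (suc L) (suc L′) a n (s≤s n≤L) (s≤s n≤L′) = +-congˡ
    (W⋆-local n λ k k<n → horner-stable L L′ (tail a) k (ℕ.<-≤-trans k<n n≤L) (ℕ.<-≤-trans k<n n≤L′))

  horner-cong : ∀ L {a b} → a ≋ b → horner L a ≋ horner L b
  horner-cong zero    e n = ≈-refl
  horner-cong (suc L) e n = +-cong (*-congʳ (e 0)) (⋆-cong {f = W} (λ _ → ≈-refl) (horner-cong L (e ∘ suc)) n)

  compose : Series {X} → Series {X}
  compose a n = horner (suc n) a n

  compose-cong : ∀ {a b} → a ≋ b → compose a ≋ compose b
  compose-cong e n = horner-cong (suc n) e n

  compose-step : ∀ a → compose a ≋ a 0 · 1ₛ ⊕ W ⋆ compose (tail a)
  compose-step a n = +-congˡ (W⋆-local n λ k k<n → horner-stable n (suc k) (tail a) k k<n ℕ.≤-refl)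

  -- Multiplication by `W` raises the degree, so the fixed-point equation determines the whole
  -- family degree by degree. The index runs over coefficient sequences and `τ` is typically `tail`:
  -- identities for `compose` are thus proved for all sequences at once, from `compose-step` alone.
  step-unique : {I : Set} (τ : I → I) (c : I → Series {X}) {f g : I → Series {X}} →
                (∀ i → f i ≋ c i ⊕ W ⋆ f (τ i)) → (∀ i → g i ≋ c i ⊕ W ⋆ g (τ i)) →
                ∀ i → f i ≋ g i
  step-unique τ c {f} {g} ef eg i n = below (suc n) n ℕ.≤-refl i
    where
    below : ∀ m n → n < m → ∀ i → f i n ≈ g i n
    below (suc m) n (s≤s n≤m) i = ≈-trans (ef i n) (≈-trans
      (+-congˡ (W⋆-local n λ k k<n → below m k (ℕ.<-≤-trans k<n n≤m) (τ i))) (≈-sym (eg i n)))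

  compose-⊕ : ∀ a b → compose (a ⊕ b) ≋ compose a ⊕ compose b
  compose-⊕ a b = step-unique {Series {X} × Series {X}}
    (λ (a , b) → tail a , tail b) (λ (a , b) → (a 0 + b 0) · 1ₛ)
    {λ (a , b) → compose (a ⊕ b)} {λ (a , b) → compose a ⊕ compose b}
    (λ (a , b) → compose-step (a ⊕ b))
    (λ (a , b) n → ≈-trans (+-cong (compose-step a n) (compose-step b n)) (≈-trans
      (solve 5 (λ x y u p q → (x :*' u :+' p) :+' (y :*' u :+' q) :=' (x :+' y) :*' u :+' (p :+' q)) ≈-refl
        (a 0) (b 0) (1ₛ n) ((W ⋆ compose (tail a)) n) ((W ⋆ compose (tail b)) n))
      (+-congˡ (≈-sym (S.distribˡ W (compose (tail a)) (compose (tail b)) n)))))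
    (a , b)
    where open Solver {X} using (solve) renaming (_:+_ to _:+'_; _:*_ to _:*'_; _:=_ to _:='_)

  compose-· : ∀ c a → compose (c · a) ≋ c · compose a
  compose-· c a = step-unique tail (λ a → (c * a 0) · 1ₛ)
    {λ a → compose (c · a)} {λ a → c · compose a}
    (λ a → compose-step (c · a))
    (λ a n → ≈-trans (*-congˡ (compose-step a n)) (≈-trans (distribˡ c _ _)
      (+-cong (≈-sym (*-assoc c (a 0) (1ₛ n))) (≈-trans (≈-sym (·-⋆ c W (compose (tail a)) n)) (≈-trans
        (⋆-comm (c · W) (compose (tail a)) n) (W⋆c (compose (tail a)) n))))))
    a
    where
    W⋆c : ∀ f → f ⋆ (c · W) ≋ W ⋆ (c · f)
    W⋆c f n = ≈-trans (⋆-comm f (c · W) n) (≈-trans (·-⋆ c W f n)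
      (≈-trans (*-congˡ (⋆-comm W f n)) (≈-trans (≈-sym (·-⋆ c f W n)) (⋆-comm (c · f) W n))))

  compose-shift : ∀ a → compose (shift a) ≋ W ⋆ compose a
  compose-shift a n = ≈-trans (compose-step (shift a) n) (≈-trans (+-congʳ (zeroˡ _)) (+-identityˡ _))

  D-tail : ∀ a → D a ≋ tail a ⊕ shift (D (tail a))
  D-tail a zero    = ≈-trans (*-identityˡ _) (≈-sym (+-identityʳ _))
  D-tail a (suc n) = ≈-trans (*-congʳ (≈-trans (CommutativeRing.reflexive (polyRing X) (≡.cong con (fromℕ-suc (suc n))))
      (con-+ 1ℚ (fromℕ (suc n)))))
    (≈-trans (*-distribʳ _ _ _) (+-congʳ (*-identityˡ _)))

  -- As functions of `a`, both sides equal `D W ⋆ compose (tail a)` plus `W` times themselves at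
  -- `tail a`. On the left this is the product rule; on the right it is `D-tail`, which says (a₀ + w
  -- b)′ = b + w b′.
  chain-rule : ∀ a → D (compose a) ≋ D W ⋆ compose (D a)
  chain-rule = step-unique tail (λ a → D W ⋆ compose (tail a))
    (λ a → begin
      D (compose a)                                        ≈⟨ D-cong (compose-step a) ⟩
      D (a 0 · 1ₛ ⊕ W ⋆ compose (tail a))                  ≈⟨ D-⊕ (a 0 · 1ₛ) (W ⋆ compose (tail a)) ⟩
      D (a 0 · 1ₛ) ⊕ D (W ⋆ compose (tail a))              ≈⟨ S.+-cong (D-1ₛ (a 0)) (D-⋆ W (compose (tail a))) ⟩
      0ₛ ⊕ (D W ⋆ compose (tail a) ⊕ W ⋆ D (compose (tail a))) ≈⟨ S.+-identityˡ _ ⟩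
      D W ⋆ compose (tail a) ⊕ W ⋆ D (compose (tail a))    ∎)
    (λ a → begin
      D W ⋆ compose (D a)
        ≈⟨ S.*-congˡ {D W} (S.trans (compose-cong (D-tail a))
            (S.trans (compose-⊕ (tail a) (shift (D (tail a)))) (S.+-congˡ (compose-shift (D (tail a)))))) ⟩
      D W ⋆ (compose (tail a) ⊕ W ⋆ compose (D (tail a)))
        ≈⟨ SS.solve 4 (λ d w x y → d :* (x :+ w :* y) := d :* x :+ w :* (d :* y)) S.refl (D W) W (compose (tail a))
            (compose (D (tail a))) ⟩
      D W ⋆ compose (tail a) ⊕ W ⋆ (D W ⋆ compose (D (tail a))) ∎)
    where open ≋

  horner-power : ∀ L a n → horner L a n ≈ sum {n = L} (λ ℓ → a (toℕ ℓ) * (W ^ₛ toℕ ℓ) n)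
  horner-power zero    a n = ≈-refl
  horner-power (suc L) a n = +-congˡ (begin
    (W ⋆ horner L (tail a)) n ≈⟨ ⋆-cong {f = W} (λ _ → ≈-refl) (horner-power L (tail a)) n ⟩
    (W ⋆ (λ n → sum {n = L} (λ ℓ → a (suc (toℕ ℓ)) * (W ^ₛ toℕ ℓ) n))) n ≈⟨ ⋆-sum L (λ ℓ → a (suc ℓ)) (W ^ₛ_) n ⟩
    sum {n = L} (λ ℓ → a (suc (toℕ ℓ)) * (W ⋆ W ^ₛ toℕ ℓ) n) ∎)
    where
    open SetoidReasoning (setoid {X})
    ⋆-sum : ∀ L (b : ℕ → Poly X) (f : ℕ → Series {X}) n →
            (W ⋆ (λ n → sum {n = L} (λ ℓ → b (toℕ ℓ) * f (toℕ ℓ) n))) n ≈ sum {n = L} (λ ℓ → b (toℕ ℓ) * (W ⋆ f (toℕ ℓ)) n)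
    ⋆-sum zero    b f n = S.zeroʳ W n
    ⋆-sum (suc L) b f n = ≈-trans (S.distribˡ W (b 0 · f 0) (λ n → sum {n = L} (λ ℓ → b (suc (toℕ ℓ)) * f (suc (toℕ ℓ)) n)) n)
      (+-cong (≈-trans (⋆-comm W (b 0 · f 0) n) (≈-trans (·-⋆ (b 0) (f 0) W n) (*-congˡ (⋆-comm (f 0) W n))))
          (⋆-sum L (b ∘ suc) (f ∘ suc) n))

  -- With U = cosh and W = sinh of ∫ r, this is the equation
  -- (1 + w²) y″ + w y′ = m² y satisfied by y(w) = exp(m arsinh w).
  module _ {r U : Series {X}} (DU : D U ≋ r ⋆ W) (DW : D W ≋ r ⋆ U)
           (U² : U ⋆ U ≋ 1ₛ ⊕ W ⋆ W) (U₀≈1 : U 0 ≈ con 1ℚ) where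

    -- With y = `compose a` and v = U y′(W), differentiation in t gives D y = r v. In D v the square
    -- of U appears as 1 + W², which is just what the equation for `a` needs to yield D v = r M² y.
    -- So the second-order equation in w becomes a linear first-order system in t.
    compose-ode : ∀ m a → a 0 ≈ con 1ℚ → a 1 ≈ con (fromℕ (suc m)) →
                  shift (D a) ⊕ (D (D a) ⊕ shift (shift (D (D a)))) ≋ con (fromℕ (suc m)) · (con (fromℕ (suc m)) · a) →
                  ∀ {F} → D F ≋ (conₛ (fromℕ (suc m)) ⋆ r) ⋆ F → F 0 ≈ con 1ℚ → compose a ≋ F
    compose-ode m a a₀ a₁ ode {F} DF F₀ = y≋F
      where
      open ≋
      q = fromℕ (suc m)
      M = conₛ q
      y = compose a
      v = U ⋆ compose (D a)

      DM⋆ : ∀ f → D (M ⋆ f) ≋ M ⋆ D f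
      DM⋆ f = begin
        D (M ⋆ f)    ≈⟨ D-cong (conₛ-⋆ q f) ⟩
        D (con q · f) ≈⟨ D-· (con q) f ⟩
        con q · D f   ≈⟨ conₛ-⋆ q (D f) ⟨
        M ⋆ D f       ∎

      Dy : D y ≋ r ⋆ v
      Dy = S.trans (chain-rule a) (S.trans (S.*-congʳ DW) (S.*-assoc r U _))

      c₁ = compose (D a)
      c₂ = compose (D (D a))

      ode-y : W ⋆ c₁ ⊕ (c₂ ⊕ W ⋆ (W ⋆ c₂)) ≋ M ⋆ (M ⋆ y)
      ode-y = begin
        W ⋆ c₁ ⊕ (c₂ ⊕ W ⋆ (W ⋆ c₂))
          ≈⟨ S.+-cong (compose-shift (D a))
              (S.+-congˡ {c₂} (S.trans (compose-shift (shift (D (D a)))) (S.*-congˡ {W} (compose-shift (D (D a)))))) ⟨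
        compose (shift (D a)) ⊕ (c₂ ⊕ compose (shift (shift (D (D a)))))
          ≈⟨ S.trans (compose-⊕ (shift (D a)) (D (D a) ⊕ shift (shift (D (D a)))))
              (S.+-congˡ {compose (shift (D a))} (compose-⊕ (D (D a)) (shift (shift (D (D a)))))) ⟨
        compose (shift (D a) ⊕ (D (D a) ⊕ shift (shift (D (D a)))))
          ≈⟨ compose-cong ode ⟩
        compose (con q · (con q · a))
          ≈⟨ S.trans (compose-· (con q) (con q · a)) (λ n → *-congˡ (compose-· (con q) a n)) ⟩
        con q · (con q · y)
          ≈⟨ S.trans (S.*-congˡ {M} (conₛ-⋆ q y)) (conₛ-⋆ q (con q · y)) ⟨
        M ⋆ (M ⋆ y) ∎

      Dv : D v ≋ r ⋆ (M ⋆ (M ⋆ y))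
      Dv = begin
        D v                                        ≈⟨ D-⋆ U c₁ ⟩
        D U ⋆ c₁ ⊕ U ⋆ D c₁                        ≈⟨ S.+-cong (S.*-congʳ DU)
            (S.*-congˡ {U} (S.trans (chain-rule (D a)) (S.*-congʳ DW))) ⟩
        (r ⋆ W) ⋆ c₁ ⊕ U ⋆ ((r ⋆ U) ⋆ c₂)
          ≈⟨ SS.solve 5 (λ r w u x y → (r :* w) :* x :+ u :* ((r :* u) :* y) := r :* (w :* x :+ (u :* u) :* y)) S.refl r W U c₁
              c₂ ⟩
        r ⋆ (W ⋆ c₁ ⊕ (U ⋆ U) ⋆ c₂)                ≈⟨ S.*-congˡ {r} (S.+-congˡ {W ⋆ c₁} (S.*-congʳ U²)) ⟩
        r ⋆ (W ⋆ c₁ ⊕ (1ₛ ⊕ W ⋆ W) ⋆ c₂)           ≈⟨ S.*-congˡ {r}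
            (S.+-congˡ {W ⋆ c₁} (S.trans (S.distribʳ c₂ 1ₛ (W ⋆ W)) (S.+-cong (1ₛ-⋆ c₂) (⋆-assoc W W c₂)))) ⟩
        r ⋆ (W ⋆ c₁ ⊕ (c₂ ⊕ W ⋆ (W ⋆ c₂)))         ≈⟨ S.*-congˡ {r} ode-y ⟩
        r ⋆ (M ⋆ (M ⋆ y))                          ∎

      -- M y + v and M y - v satisfy first-order equations with opposite rates.
      s = M ⋆ y ⊕ v
      d = M ⋆ y ⊕ S.- v

      D-neg : ∀ f → D (S.- f) ≋ S.- D f
      D-neg f n = solve 2 (λ a x → a :*' (:- x) :=' :- (a :*' x)) ≈-refl (con (fromℕ (suc n))) (f (suc n))
        where open Solver {X} using (solve; :-_) renaming (_:*_ to _:*'_; _:=_ to _:='_)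

      DMy : D (M ⋆ y) ≋ M ⋆ (r ⋆ v)
      DMy = S.trans (DM⋆ y) (S.*-congˡ {M} Dy)

      Ds : D s ≋ (M ⋆ r) ⋆ s
      Ds = begin
        D s                                 ≈⟨ D-⊕ (M ⋆ y) v ⟩
        D (M ⋆ y) ⊕ D v                     ≈⟨ S.+-cong DMy Dv ⟩
        M ⋆ (r ⋆ v) ⊕ r ⋆ (M ⋆ (M ⋆ y))
          ≈⟨ SS.solve 4 (λ m r y v → m :* (r :* v) :+ r :* (m :* (m :* y)) := (m :* r) :* (m :* y :+ v)) S.refl M r y v ⟩
        (M ⋆ r) ⋆ s ∎

      Dd : D d ≋ (S.- (M ⋆ r)) ⋆ d
      Dd = begin
        D d                                 ≈⟨ D-⊕ (M ⋆ y) (S.- v) ⟩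
        D (M ⋆ y) ⊕ D (S.- v)               ≈⟨ S.+-cong DMy (S.trans (D-neg v) (S.-‿cong Dv)) ⟩
        M ⋆ (r ⋆ v) ⊕ S.- (r ⋆ (M ⋆ (M ⋆ y)))
          ≈⟨ SS.solve 4 (λ m r y v → m :* (r :* v) :+ SS.:- (r :* (m :* (m :* y))) := (SS.:- (m :* r)) :* (m :* y :+ SS.:- v))
              S.refl M r y v ⟩
        (S.- (M ⋆ r)) ⋆ d ∎

      y₀ : y 0 ≈ con 1ℚ
      y₀ = ≈-trans (compose-step a 0) (≈-trans (+-cong (≈-trans (*-identityʳ _) a₀) (W⋆-zero (compose (tail a)))) (+-identityʳ _))

      v₀ : v 0 ≈ con q
      v₀ = ≈-trans (+-identityʳ _) (≈-trans
          (*-cong U₀≈1 (≈-trans (compose-step (D a) 0) (+-cong (*-identityʳ _) (W⋆-zero (compose (tail (D a)))))))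
        (≈-trans (*-identityˡ _) (≈-trans (+-identityʳ _) (≈-trans (*-identityˡ _) a₁))))

      My₀ : (M ⋆ y) 0 ≈ con q
      My₀ = ≈-trans (conₛ-⋆ q y 0) (≈-trans (*-congˡ y₀) (*-identityʳ _))

      -- By the values of `a 0` and `a 1`, both `M ⋆ y` and `v` start at q. The component of rate -M
      -- r therefore starts at zero and vanishes, which leaves the solution growing like F.
      d≋0 : d ≋ 0ₛ
      d≋0 = D-unique-⋆ (S.- (M ⋆ r)) Dd
        (λ n → ≈-trans (zeroʳ _) (≈-sym (S.zeroʳ (S.- (M ⋆ r)) n)))
        (≈-trans (+-cong My₀ (-‿cong v₀)) (-‿inverseʳ _))

      2MF = M ⋆ (F ⊕ F)

      s≋2MF : s ≋ 2MF
      s≋2MF = D-unique-⋆ (M ⋆ r) Ds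
        (begin
          D 2MF                           ≈⟨ S.trans (DM⋆ (F ⊕ F)) (S.*-congˡ {M} (S.trans (D-⊕ F F) (S.+-cong DF DF))) ⟩
          M ⋆ ((M ⋆ r) ⋆ F ⊕ (M ⋆ r) ⋆ F) ≈⟨ SS.solve 3 (λ m r f → m :* ((m :* r) :* f :+ (m :* r) :* f) := (m :* r) :*
              (m :* (f :+ f))) S.refl M r F ⟩
          (M ⋆ r) ⋆ 2MF                   ∎)
        (≈-trans (+-cong My₀ v₀) (≈-sym (≈-trans (conₛ-⋆ q (F ⊕ F) 0)
          (≈-trans (distribˡ _ _ _) (+-cong (≈-trans (*-congˡ F₀) (*-identityʳ _)) (≈-trans (*-congˡ F₀) (*-identityʳ _)))))))

      y≋F : y ≋ F
      y≋F n = con-suc-cancel m (≈-trans (≈-sym (conₛ-⋆ q y n)) (≈-trans (My≋MF n) (conₛ-⋆ q F n)))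
        where
        My≋MF : M ⋆ y ≋ M ⋆ F
        My≋MF = begin
          M ⋆ y             ≈⟨ SS.solve 2 (λ m v → m := SS.con ½ :* ((m :+ v) :+ (m :+ SS.:- v))) S.refl (M ⋆ y) v ⟩
          conₛ ½ ⋆ (s ⊕ d)   ≈⟨ S.*-congˡ {conₛ ½} (S.+-cong s≋2MF d≋0) ⟩
          conₛ ½ ⋆ (2MF ⊕ 0ₛ) ≈⟨ S.*-congˡ {conₛ ½} (S.+-identityʳ 2MF) ⟩
          conₛ ½ ⋆ 2MF      ≈⟨ SS.solve 2 (λ m f → SS.con ½ :* (m :* (f :+ f)) := m :* f) S.refl M F ⟩
          M ⋆ F             ∎

-- Logarithmic derivatives, and the odd and even parts of a series

module _ {X : Set} where
  private
    module S = CommutativeRing (seriesRing {X})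
    module ≋ = SetoidReasoning S.setoid
    module ≈ = SetoidReasoning (setoid {X})
    module SS = SeriesOver.Solver {X}
    module PS = Solver {X}

  D-power : ∀ {r G : Series {X}} → D G ≋ r ⋆ G → ∀ m → D (G ^ₛ m) ≋ (conₛ (fromℕ m) ⋆ r) ⋆ (G ^ₛ m)
  D-power {r} {G} DG zero = begin
    D 1ₛ                        ≈⟨ (λ n → zeroʳ _) ⟩
    0ₛ                          ≈⟨ S.trans (S.*-congʳ {1ₛ} {conₛ (fromℕ 0) ⋆ r} {0ₛ} (S.trans (conₛ-⋆ 0ℚ r) λ n → zeroˡ (r n)))
        (S.zeroˡ 1ₛ) ⟨
    (conₛ (fromℕ 0) ⋆ r) ⋆ 1ₛ   ∎
    where open ≋
  D-power {r} {G} DG (suc m) = begin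
    D (G ⋆ G ^ₛ m)                                  ≈⟨ D-⋆ G (G ^ₛ m) ⟩
    D G ⋆ G ^ₛ m ⊕ G ⋆ D (G ^ₛ m)                   ≈⟨ S.+-cong (S.*-congʳ {G ^ₛ m} DG) (S.*-congˡ {G} (D-power {r} {G} DG m)) ⟩
    (r ⋆ G) ⋆ G ^ₛ m ⊕ G ⋆ ((conₛ (fromℕ m) ⋆ r) ⋆ G ^ₛ m)
      ≈⟨ SS.solve 4 (λ r g h m → (r SS.:* g) SS.:* h SS.:+ g SS.:* ((m SS.:* r) SS.:* h) SS.:= ((SS.con 1ℚ SS.:+ m) SS.:* r)
          SS.:* (g SS.:* h)) S.refl r G (G ^ₛ m) (conₛ (fromℕ m)) ⟩
    ((conₛ 1ℚ ⊕ conₛ (fromℕ m)) ⋆ r) ⋆ (G ⋆ G ^ₛ m)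
      ≈⟨ S.*-congʳ {G ⋆ G ^ₛ m} (S.*-congʳ {r} (S.trans (S.reflexive (≡.cong conₛ (fromℕ-suc m)))
          (IsAlgebraMap.ι-+ conₛ-isAlgebraMap 1ℚ (fromℕ m)))) ⟨
    (conₛ (fromℕ (suc m)) ⋆ r) ⋆ (G ⋆ G ^ₛ m) ∎
    where open ≋

  -- c ∑ (cⁿ + (-c)ⁿ) tⁿ is the logarithmic derivative of (1 + c t) / (1 - c t).
  rate : Poly X → Series {X}
  rate c n = c * c ^ n + c * (- c) ^ n

  D-linear : ∀ (c : Poly X) → D (1+ c t) ≋ c · 1ₛ
  D-linear c zero    = ≈-trans (*-identityˡ c) (≈-sym (*-identityʳ c))
  D-linear c (suc n) = ≈-trans (zeroʳ _) (≈-sym (zeroʳ c))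

  1+t-cong : ∀ {c d : Poly X} → c ≈ d → 1+ c t ≋ 1+ d t
  1+t-cong e zero          = ≈-refl
  1+t-cong e (suc zero)    = e
  1+t-cong e (suc (suc n)) = ≈-refl

  -‿involutive : (c : Poly X) → - - c ≈ c
  -‿involutive = RingProperties.-‿involutive (CommutativeRing.ring (polyRing X))

  -- The logarithmic derivative is c / (1 - c t) + c / (1 + c t). To obtain it without division, the
  -- derivative c of the numerator is written as c (1 + c t) times the inverse of 1 + c t.
  D-factor : ∀ (c : Poly X) → D (1+ c t ⋆ 1/1- c t) ≋ rate c ⋆ (1+ c t ⋆ 1/1- c t)
  D-factor c = begin
    D (e ⋆ a)                          ≈⟨ D-⋆ e a ⟩
    D e ⋆ a ⊕ e ⋆ D a                  ≈⟨ S.+-cong (S.*-congʳ {a} De) (S.*-congˡ {e} Da) ⟩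
    (C ⋆ (e ⋆ ē)) ⋆ a ⊕ e ⋆ (C ⋆ (a ⋆ a))
      ≈⟨ SS.solve 4 (λ c e f a → (c SS.:* (e SS.:* f)) SS.:* a SS.:+ e SS.:* (c SS.:* (a SS.:* a)) SS.:=
          (c SS.:* a SS.:+ c SS.:* f) SS.:* (e SS.:* a)) S.refl C e ē a ⟩
    (C ⋆ a ⊕ C ⋆ ē) ⋆ (e ⋆ a)          ≈⟨ S.*-congʳ {e ⋆ a} (S.+-cong (C⋆ a) (C⋆ ē)) ⟩
    rate c ⋆ (e ⋆ a)                   ∎
    where
    open ≋
    C = c · 1ₛ
    e = 1+ c t
    a = 1/1- c t
    ē = 1/1- (- c) t
    b = 1+ (- c) t
    C⋆ : ∀ f → C ⋆ f ≋ c · f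
    C⋆ f n = ≈-trans (·-⋆ c 1ₛ f n) (*-congˡ (1ₛ-⋆ f n))
    e⋆ē : e ⋆ ē ≋ 1ₛ
    e⋆ē = S.trans (S.*-congʳ (1+t-cong (≈-sym (-‿involutive c)))) (1/1-t-inverse (- c))
    De : D e ≋ C ⋆ (e ⋆ ē)
    De = S.trans (D-linear c) (S.trans (S.sym (S.*-identityʳ C)) (S.*-congˡ {C} (S.sym e⋆ē)))
    Db : D b ≋ S.- C
    Db n = ≈-trans (D-linear (- c) n) (PS.solve 2 (λ c u → (PS.:- c) PS.:* u PS.:= PS.:- (c PS.:* u)) ≈-refl c (1ₛ n))
    -- Since `b` is inverse to `a`, the derivative of `a` is found by differentiating `b ⋆ a ≋ 1ₛ`
    -- and multiplying by `a`; the solver step inserts this vanishing derivative.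
    Da : D a ≋ C ⋆ (a ⋆ a)
    Da = begin
      D a                              ≈⟨ 1ₛ-⋆ (D a) ⟨
      1ₛ ⋆ D a                         ≈⟨ S.*-congʳ {D a} {b ⋆ a} {1ₛ} (1/1-t-inverse c) ⟨
      (b ⋆ a) ⋆ D a                    ≈⟨ SS.solve 4 (λ b a d d′ → (b SS.:* a) SS.:* d SS.:= a SS.:* (d′ SS.:* a SS.:+ b SS.:* d)
          SS.:+ SS.:- (a SS.:* (d′ SS.:* a))) S.refl b a (D a) (D b) ⟩
      a ⋆ (D b ⋆ a ⊕ b ⋆ D a) ⊕ S.- (a ⋆ (D b ⋆ a))
        ≈⟨ S.+-cong (S.*-congˡ {a} (S.trans (S.sym (D-⋆ b a)) (S.trans (D-cong (1/1-t-inverse c)) λ n → zeroʳ _)))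
            (S.-‿cong (S.*-congˡ {a} (S.*-congʳ {a} Db))) ⟩
      a ⋆ 0ₛ ⊕ S.- (a ⋆ (S.- C ⋆ a))
        ≈⟨ S.+-congʳ (S.zeroʳ a) ⟩
      0ₛ ⊕ S.- (a ⋆ (S.- C ⋆ a))
        ≈⟨ S.+-identityˡ _ ⟩
      S.- (a ⋆ (S.- C ⋆ a))
        ≈⟨ SS.solve 2 (λ a c → SS.:- (a SS.:* ((SS.:- c) SS.:* a)) SS.:= c SS.:* (a SS.:* a)) S.refl a C ⟩
      C ⋆ (a ⋆ a) ∎

  factorProduct : ∀ {N} → (Fin N → Poly X) → Series {X}
  factorProduct x = foldrFin _⋆_ 1ₛ (λ i → 1+ x i t ⋆ 1/1- x i t)

  totalRate : ∀ {N} → (Fin N → Poly X) → Series {X}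
  totalRate {N} x n = sum {n = N} (λ i → rate (x i) n)

  D-factorProduct : ∀ {N} (x : Fin N → Poly X) → D (factorProduct x) ≋ totalRate x ⋆ factorProduct x
  D-factorProduct {zero}  x = S.trans (λ n → zeroʳ _) (S.sym (S.zeroˡ 1ₛ))
  D-factorProduct {suc N} x = begin
    D (f ⋆ g)                ≈⟨ D-⋆ f g ⟩
    D f ⋆ g ⊕ f ⋆ D g        ≈⟨ S.+-cong (S.*-congʳ (D-factor (x Fin.zero))) (S.*-congˡ {f} (D-factorProduct (x ∘ Fin.suc))) ⟩
    (ρ ⋆ f) ⋆ g ⊕ f ⋆ (R ⋆ g)
      ≈⟨ SS.solve 4 (λ f g r s → (r SS.:* f) SS.:* g SS.:+ f SS.:* (s SS.:* g) SS.:= (r SS.:+ s) SS.:* (f SS.:* g)) S.refl f g ρ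
          R ⟩
    (ρ ⊕ R) ⋆ (f ⋆ g) ∎
    where
    open ≋
    f = 1+ x Fin.zero t ⋆ 1/1- x Fin.zero t
    g = factorProduct (x ∘ Fin.suc)
    ρ = rate (x Fin.zero)
    R = totalRate (x ∘ Fin.suc)

  factorProduct-zero : ∀ {N} (x : Fin N → Poly X) → factorProduct x 0 ≈ con 1ℚ
  factorProduct-zero {zero}  x = ≈-refl
  factorProduct-zero {suc N} x = ≈-trans (+-congʳ (*-congˡ (factorProduct-zero (x ∘ Fin.suc))))
    (PS.solve 0 ((PS.con 1ℚ PS.:* PS.con 1ℚ PS.:+ PS.con 0ℚ) PS.:* PS.con 1ℚ PS.:+ PS.con 0ℚ PS.:= PS.con 1ℚ) ≈-refl) 

  alternating : ℕ → Poly X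
  alternating zero    = con 1ℚ
  alternating (suc n) = - alternating n

  -- The substitution t ↦ -t; its fixed points are the even series.
  σ : Series {X} → Series {X}
  σ f n = alternating n * f n

  σ-⋆ : ∀ f g → σ (f ⋆ g) ≋ σ f ⋆ σ g
  σ-⋆ f g zero    = PS.solve 2 (λ a b → PS.con 1ℚ PS.:* (a PS.:* b PS.:+ PS.con 0ℚ) PS.:= (PS.con 1ℚ PS.:* a) PS.:*
      (PS.con 1ℚ PS.:* b) PS.:+ PS.con 0ℚ) ≈-refl (f 0) (g 0)
  σ-⋆ f g (suc n) = begin
    - alternating n * (f 0 * g (suc n) + (tail f ⋆ g) n)
      ≈⟨ PS.solve 4 (λ e a b c → (PS.:- e) PS.:* (a PS.:* b PS.:+ c) PS.:= (PS.con 1ℚ PS.:* a) PS.:* ((PS.:- e) PS.:* b) PS.:+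
          PS.:- (e PS.:* c)) ≈-refl
           (alternating n) (f 0) (g (suc n)) ((tail f ⋆ g) n) ⟩
    σ f 0 * σ g (suc n) + - σ (tail f ⋆ g) n
      ≈⟨ +-congˡ (-‿cong (σ-⋆ (tail f) g n)) ⟩
    σ f 0 * σ g (suc n) + - (σ (tail f) ⋆ σ g) n
      ≈⟨ +-congˡ (SS.solve 2 (λ a b → SS.:- (a SS.:* b) SS.:= (SS.:- a) SS.:* b) S.refl (σ (tail f)) (σ g) n) ⟩
    σ f 0 * σ g (suc n) + ((S.- σ (tail f)) ⋆ σ g) n
      ≈⟨ +-congˡ (S.*-congʳ {σ g} (λ k → PS.solve 2 (λ a b → PS.:- (a PS.:* b) PS.:= (PS.:- a) PS.:* b) ≈-refl (alternating k)
          (f (suc k))) n) ⟩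
    σ f 0 * σ g (suc n) + (tail (σ f) ⋆ σ g) n ∎
    where open ≈

  D-σ : ∀ f → D (σ f) ≋ S.- σ (D f)
  D-σ f n = PS.solve 3 (λ c e x → c PS.:* ((PS.:- e) PS.:* x) PS.:= PS.:- (e PS.:* (c PS.:* x))) ≈-refl (con (fromℕ (suc n)))
      (alternating n) (f (suc n))

  alternating-square : ∀ n → alternating n * alternating n ≈ con 1ℚ
  alternating-square zero    = *-identityˡ _
  alternating-square (suc n) = ≈-trans (PS.solve 1 (λ a → (PS.:- a) PS.:* (PS.:- a) PS.:= a PS.:* a) ≈-refl (alternating n))
      (alternating-square n)

  ^-neg : ∀ c n → (- c) ^ n ≈ alternating n * c ^ n
  ^-neg c zero    = ≈-sym (*-identityˡ _)
  ^-neg c (suc n) = ≈-trans (*-congˡ (^-neg c n))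
    (PS.solve 3 (λ c e x → (PS.:- c) PS.:* (e PS.:* x) PS.:= (PS.:- e) PS.:* (c PS.:* x)) ≈-refl c (alternating n) (c ^ n))

  σ-rate : ∀ c → σ (rate c) ≋ rate c
  σ-rate c n = begin
    e * (c * x + c * (- c) ^ n)       ≈⟨ *-congˡ (+-congˡ (*-congˡ (^-neg c n))) ⟩
    e * (c * x + c * (e * x))         ≈⟨ PS.solve 3 (λ e c x → e PS.:* (c PS.:* x PS.:+ c PS.:* (e PS.:* x)) PS.:= (e PS.:* e)
        PS.:* (c PS.:* x) PS.:+ c PS.:* (e PS.:* x)) ≈-refl e c x ⟩
    (e * e) * (c * x) + c * (e * x)   ≈⟨ +-cong (≈-trans (*-congʳ (alternating-square n)) (*-identityˡ _))
        (*-congˡ (≈-sym (^-neg c n))) ⟩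
    c * x + c * (- c) ^ n             ∎
    where
    open ≈
    e = alternating n
    x = c ^ n

  -- Evenness of the rate takes the place of G(t) G(-t) = 1: it yields D (σ G) = -r σ G, from which
  -- the equations of the odd and even parts follow.
  σ-totalRate : ∀ {N} (x : Fin N → Poly X) → σ (totalRate x) ≋ totalRate x
  σ-totalRate {zero}  x n = zeroʳ _
  σ-totalRate {suc N} x n = ≈-trans (distribˡ _ _ _) (+-cong (σ-rate (x Fin.zero) n) (σ-totalRate (x ∘ Fin.suc) n))

  parity : ∀ n → (2 ∣ n × alternating n ≈ con 1ℚ) ⊎ (¬ 2 ∣ n × alternating n ≈ - con 1ℚ)
  parity zero = inj₁ (divides 0 ≡.refl , ≈-refl)
  parity (suc zero) = inj₂ ((λ 2∣1 → 2≢1 (∣1⇒≡1 2∣1)) , ≈-refl)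
    where
    2≢1 : ¬ 2 ≡ 1
    2≢1 ()
  parity (suc (suc n)) with parity n
  ... | inj₁ (e , q) = inj₁ (∣m∣n⇒∣m+n {2} {2} ∣-refl e , ≈-trans (-‿involutive _) q)
  ... | inj₂ (o , q) = inj₂ ((λ 2∣ → o (∣m+n∣m⇒∣n 2∣ ∣-refl)) , ≈-trans (-‿involutive _) q)

  oddPart evenPart : Series {X} → Series {X}
  oddPart  G = con ½ · (G ⊕ S.- σ G)
  evenPart G = con ½ · (G ⊕ σ G)

  oddPart-odd : ∀ G {n} → ¬ 2 ∣ n → oddPart G n ≈ G n
  oddPart-odd G {n} odd with parity n
  ... | inj₁ (e , _) with () ← odd e
  ... | inj₂ (_ , q) = ≈-trans (*-congˡ (+-congˡ (-‿cong (*-congʳ q))))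
    (PS.solve 1 (λ g → PS.con ½ PS.:* (g PS.:+ PS.:- ((PS.:- PS.con 1ℚ) PS.:* g)) PS.:= g) ≈-refl (G n))

  oddPart-even : ∀ G {n} → 2 ∣ n → oddPart G n ≈ con 0ℚ
  oddPart-even G {n} even with parity n
  ... | inj₂ (o , _) with () ← o even
  ... | inj₁ (_ , q) = ≈-trans (*-congˡ (+-congˡ (-‿cong (*-congʳ q))))
    (PS.solve 1 (λ g → PS.con ½ PS.:* (g PS.:+ PS.:- (PS.con 1ℚ PS.:* g)) PS.:= PS.con 0ℚ) ≈-refl (G n))

  module _ {r G : Series {X}} (DG : D G ≋ r ⋆ G) (G₀≈1 : G 0 ≈ con 1ℚ) (σr : σ r ≋ r) where
    private
      W = oddPart G
      U = evenPart G

      W₀ : W 0 ≈ con 0ℚ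
      W₀ = oddPart-even G (divides 0 ≡.refl)

      U₀ : U 0 ≈ con 1ℚ
      U₀ = ≈-trans (*-congˡ (+-cong G₀≈1 (*-congˡ G₀≈1)))
        (PS.solve 0 (PS.con ½ PS.:* (PS.con 1ℚ PS.:+ PS.con 1ℚ PS.:* PS.con 1ℚ) PS.:= PS.con 1ℚ) ≈-refl)

      DσG : D (σ G) ≋ S.- (r ⋆ σ G)
      DσG = S.trans (D-σ G) (S.-‿cong (S.trans (λ n → *-congˡ (DG n)) (S.trans (σ-⋆ r G) (S.*-congʳ {σ G} σr))))

      DW : D W ≋ r ⋆ U
      DW n = begin
        D W n                                 ≈⟨ D-· (con ½) (G ⊕ S.- σ G) n ⟩
        con ½ * D (G ⊕ S.- σ G) n             ≈⟨ *-congˡ (PS.solve 3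
            (λ c g h → c PS.:* (g PS.:+ PS.:- h) PS.:= c PS.:* g PS.:+ PS.:- (c PS.:* h)) ≈-refl (con (fromℕ (suc n)))
            (G (suc n)) (σ G (suc n))) ⟩
        con ½ * (D G n + - D (σ G) n)         ≈⟨ *-congˡ (+-cong (DG n) (≈-trans (-‿cong (DσG n)) (-‿involutive _))) ⟩
        con ½ * ((r ⋆ G) n + (r ⋆ σ G) n)     ≈⟨ *-congˡ (S.distribˡ r G (σ G) n) ⟨
        con ½ * (r ⋆ (G ⊕ σ G)) n             ≈⟨ ⋆-· n ⟩
        (r ⋆ U) n ∎
        where
        open ≈
        ⋆-· : con ½ · (r ⋆ (G ⊕ σ G)) ≋ r ⋆ (con ½ · (G ⊕ σ G))
        ⋆-· = S.trans (λ n → *-congˡ (⋆-comm r (G ⊕ σ G) n))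
            (S.trans (S.sym (·-⋆ (con ½) (G ⊕ σ G) r)) (⋆-comm (con ½ · (G ⊕ σ G)) r))

      DU : D U ≋ r ⋆ W
      DU n = begin
        D U n                                 ≈⟨ D-· (con ½) (G ⊕ σ G) n ⟩
        con ½ * D (G ⊕ σ G) n                 ≈⟨ *-congˡ (D-⊕ G (σ G) n) ⟩
        con ½ * (D G n + D (σ G) n)           ≈⟨ *-congˡ (+-cong (DG n) (DσG n)) ⟩
        con ½ * ((r ⋆ G) n + - (r ⋆ σ G) n)   ≈⟨ *-congˡ (SS.solve 3
            (λ r g h → r SS.:* g SS.:+ SS.:- (r SS.:* h) SS.:= r SS.:* (g SS.:+ SS.:- h)) S.refl r G (σ G) n) ⟩
        con ½ * (r ⋆ (G ⊕ S.- σ G)) n         ≈⟨ ⋆-· n ⟩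
        (r ⋆ W) n ∎
        where
        open ≈
        ⋆-· : con ½ · (r ⋆ (G ⊕ S.- σ G)) ≋ r ⋆ (con ½ · (G ⊕ S.- σ G))
        ⋆-· = S.trans (λ n → *-congˡ (⋆-comm r (G ⊕ S.- σ G) n))
            (S.trans (S.sym (·-⋆ (con ½) (G ⊕ S.- σ G) r)) (⋆-comm (con ½ · (G ⊕ S.- σ G)) r))

      -- Both sides have derivative 2 r W U and constant term 1, so `D-unique` applies with an
      -- operator that ignores its argument.
      U² : U ⋆ U ≋ 1ₛ ⊕ W ⋆ W
      U² = D-unique (λ _ → r ⋆ W ⋆ U ⊕ r ⋆ W ⋆ U) (λ _ _ _ _ → ≈-refl)
        (S.trans (D-⋆ U U) (S.trans (S.+-cong (S.*-congʳ DU) (S.*-congˡ {U} DU))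
          (S.+-congˡ {r ⋆ W ⋆ U} (S.*-comm U (r ⋆ W)))))
        (begin
          D (1ₛ ⊕ W ⋆ W)           ≈⟨ S.trans (D-⊕ 1ₛ (W ⋆ W)) (S.+-cong (λ n → zeroʳ _) (D-⋆ W W)) ⟩
          0ₛ ⊕ (D W ⋆ W ⊕ W ⋆ D W)  ≈⟨ S.+-identityˡ _ ⟩
          D W ⋆ W ⊕ W ⋆ D W        ≈⟨ S.+-cong (S.*-congʳ DW) (S.*-congˡ {W} DW) ⟩
          r ⋆ U ⋆ W ⊕ W ⋆ (r ⋆ U)  ≈⟨ SS.solve 3 (λ r u w → r SS.:* u SS.:* w SS.:+ w SS.:* (r SS.:* u) SS.:= r SS.:* w SS.:* u
              SS.:+ r SS.:* w SS.:* u) S.refl r U W ⟩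
          r ⋆ W ⋆ U ⊕ r ⋆ W ⋆ U    ∎)
        (≈-trans (+-congʳ (*-cong U₀ U₀)) (≈-trans
          (PS.solve 0 (PS.con 1ℚ PS.:* PS.con 1ℚ PS.:+ PS.con 0ℚ PS.:= PS.con 1ℚ PS.:+
              (PS.con 0ℚ PS.:* PS.con 0ℚ PS.:+ PS.con 0ℚ)) ≈-refl)
          (+-congˡ (+-congʳ (*-cong (≈-sym W₀) (≈-sym W₀))))))
        where open ≋

    power-zero : ∀ m → (G ^ₛ m) 0 ≈ con 1ℚ
    power-zero zero    = ≈-refl
    power-zero (suc m) = ≈-trans (+-identityʳ _) (≈-trans (*-cong G₀≈1 (power-zero m)) (*-identityˡ _))

    power-expansion : ∀ m a → a 0 ≈ con 1ℚ → a 1 ≈ con (fromℕ (suc m)) →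
                      shift (D a) ⊕ (D (D a) ⊕ shift (shift (D (D a)))) ≋ con (fromℕ (suc m)) · (con (fromℕ (suc m)) · a) →
                      ∀ n → (G ^ₛ suc m) n ≈ sum {n = suc n} (λ ℓ → a (toℕ ℓ) * (oddPart G ^ₛ toℕ ℓ) n)
    power-expansion m a a₀ a₁ ode n = ≈-trans
      (≈-sym (compose-ode {r} {U} DU DW U² U₀ m a a₀ a₁ ode {G ^ₛ suc m} (D-power {r} {G} DG (suc m)) (power-zero (suc m)) n))
      (horner-power (suc n) a n)
      where open Composition W W₀

-- Finite sums and products

module _ {X : Set} where
  private
    R = polyRing X
    module R = CommutativeRing R
    module ≈ = SetoidReasoning (setoid {X})
    module PS = Solver {X}
  open Sum R.semiring using (sum-cong-≋; ∑-distrib-+; sum-replicate-zero)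
  open CommutativeMonoidSum R.*-commutativeMonoid public using ()
    renaming (sum to prod; sum-cong-≋ to prod-cong)

  𝟙 : Bool → Poly X
  𝟙 b = if b then con 1ℚ else con 0ℚ

  sum-cong : ∀ {n} {f g : Fin n → Poly X} → (∀ i → f i ≈ g i) → sum f ≈ sum g
  sum-cong = sum-cong-≋

  ∑-cong : ∀ {A : Set} (xs : List A) {f g : A → Poly X} → (∀ a → f a ≈ g a) → ∑[ a ∈ xs ] f a ≈ ∑[ a ∈ xs ] g a
  ∑-cong []       e = ≈-refl
  ∑-cong (x ∷ xs) e = +-cong (e x) (∑-cong xs e)

  ∑-++ : ∀ {A : Set} (xs ys : List A) (f : A → Poly X) →
         ∑[ a ∈ xs List.++ ys ] f a ≈ ∑[ a ∈ xs ] f a + ∑[ a ∈ ys ] f a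
  ∑-++ []       ys f = ≈-sym (+-identityˡ _)
  ∑-++ (x ∷ xs) ys f = ≈-trans (+-congˡ (∑-++ xs ys f)) (≈-sym (+-assoc _ _ _))

  ∑-map : ∀ {A B : Set} (g : A → B) (xs : List A) (f : B → Poly X) → ∑[ b ∈ map g xs ] f b ≡ ∑[ a ∈ xs ] f (g a)
  ∑-map g []       f = ≡.refl
  ∑-map g (x ∷ xs) f = ≡.cong₂ _+_ ≡.refl (∑-map g xs f)

  ∑-cartesianProductWith : ∀ {A B C : Set} (h : A → B → C) (xs : List A) (ys : List B) (f : C → Poly X) →
    ∑[ c ∈ List.cartesianProductWith h xs ys ] f c ≈ ∑[ a ∈ xs ] (∑[ b ∈ ys ] f (h a b))
  ∑-cartesianProductWith h []       ys f = ≈-refl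
  ∑-cartesianProductWith h (x ∷ xs) ys f = ≈-trans (∑-++ (map (h x) ys) _ f)
    (+-cong (R.reflexive (∑-map (h x) ys f)) (∑-cartesianProductWith h xs ys f))

  ∑-tabulate : ∀ {A : Set} {n} (g : Fin n → A) (f : A → Poly X) → ∑[ a ∈ List.tabulate g ] f a ≡ sum (f ∘ g)
  ∑-tabulate {n = zero}  g f = ≡.refl
  ∑-tabulate {n = suc n} g f = ≡.cong₂ _+_ ≡.refl (∑-tabulate (g ∘ Fin.suc) f)

  ∑-allFin : ∀ {n} (f : Fin n → Poly X) → ∑[ i ∈ allFin n ] f i ≡ sum f
  ∑-allFin = ∑-tabulate id

  ∑-distribˡ : ∀ {A : Set} c (xs : List A) (f : A → Poly X) → c * (∑[ a ∈ xs ] f a) ≈ ∑[ a ∈ xs ] (c * f a)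
  ∑-distribˡ c []       f = zeroʳ c
  ∑-distribˡ c (x ∷ xs) f = ≈-trans (distribˡ _ _ _) (+-congˡ (∑-distribˡ c xs f))

  ∑-+ : ∀ {A : Set} (xs : List A) (f g : A → Poly X) → ∑[ a ∈ xs ] (f a + g a) ≈ ∑[ a ∈ xs ] f a + ∑[ a ∈ xs ] g a
  ∑-+ []       f g = ≈-sym (+-identityˡ _)
  ∑-+ (x ∷ xs) f g = ≈-trans (+-congˡ (∑-+ xs f g))
    (PS.solve 4 (λ a b c d → (a PS.:+ b) PS.:+ (c PS.:+ d) PS.:= (a PS.:+ c) PS.:+ (b PS.:+ d)) ≈-refl (f x) (g x) _ _)

  ∑-zero : ∀ {A : Set} (xs : List A) → ∑[ a ∈ xs ] con 0ℚ ≈ con {X} 0ℚ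
  ∑-zero []       = ≈-refl
  ∑-zero (x ∷ xs) = ≈-trans (+-identityˡ _) (∑-zero xs)

  ∑-comm : ∀ {A B : Set} (xs : List A) (ys : List B) (f : A → B → Poly X) →
           ∑[ a ∈ xs ] (∑[ b ∈ ys ] f a b) ≈ ∑[ b ∈ ys ] (∑[ a ∈ xs ] f a b)
  ∑-comm []       ys f = ≈-sym (∑-zero ys)
  ∑-comm (x ∷ xs) ys f = ≈-trans (+-congˡ (∑-comm xs ys f)) (≈-sym (∑-+ ys (f x) _))

  sum-∑-comm : ∀ {n} {A : Set} (xs : List A) (f : Fin n → A → Poly X) →
               sum (λ i → ∑[ a ∈ xs ] f i a) ≈ ∑[ a ∈ xs ] (sum λ i → f i a)
  sum-∑-comm {n} []       f = sum-replicate-zero n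
  sum-∑-comm     (x ∷ xs) f = ≈-trans (∑-distrib-+ (λ i → f i x) (λ i → ∑[ a ∈ xs ] f i a)) (+-congˡ (sum-∑-comm xs f))

  sum-unique : ∀ {n} (b : Fin n → Bool) i c → b i ≡ true → (∀ k → b k ≡ true → k ≡ i) →
               sum (λ k → if b k then c else con {X} 0ℚ) ≈ c
  sum-unique {suc n} b i c bᵢ uniq = begin
    sum (λ k → if b k then c else con 0ℚ)                ≈⟨ sum-remove {i = i} (λ k → if b k then c else con 0ℚ) ⟩
    (if b i then c else con 0ℚ) + sum (λ k → if b (punchIn i k) then c else con 0ℚ)
      ≈⟨ +-cong (R.reflexive (≡.cong (if_then c else con 0ℚ) bᵢ)) (≈-trans (sum-cong {n} others) (sum-replicate-zero n)) ⟩
    c + con 0ℚ                                           ≈⟨ +-identityʳ c ⟩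
    c                                                    ∎
    where
    open ≈
    open Sum R.semiring using (sum-remove)
    others : ∀ k → (if b (punchIn i k) then c else con 0ℚ) ≈ con 0ℚ
    others k with b (punchIn i k) in eq
    ... | true  = contradiction (uniq (punchIn i k) eq) (Fin.punchInᵢ≢i i k)
    ... | false = ≈-refl

  -- The factor is replaced by 1 rather than deleted. The index set stays `Fin n`, so the product
  -- can be compared pointwise with that of `awayFrom`.
  omit : ∀ {n} → Fin n → (Fin n → Poly X) → Fin n → Poly X
  omit i f k = if does (i Fin.≟ k) then con 1ℚ else f k

  prod-omit : ∀ {n} i (f : Fin n → Poly X) → prod f ≈ f i * prod (omit i f)
  prod-omit Fin.zero    f = *-congˡ (≈-sym (*-identityˡ _))
  prod-omit (Fin.suc i) f = ≈-trans (*-congˡ (prod-omit i (f ∘ Fin.suc)))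
    (PS.solve 3 (λ a b c → a PS.:* (b PS.:* c) PS.:= b PS.:* (a PS.:* c)) ≈-refl (f Fin.zero) (f (Fin.suc i))
        (prod (omit i (f ∘ Fin.suc))))

-- Derivations

derive : {X : Set} → (X → Poly X) → Poly X → Poly X
derive δ (con a) = con 0ℚ
derive δ (var x) = δ x
derive δ (f + g) = derive δ f + derive δ g
derive δ (f * g) = derive δ f * g + f * derive δ g
derive δ (- f)   = - derive δ f

module _ {X : Set} (δ : X → Poly X) where
  private
    module ≈ = SetoidReasoning (setoid {X})
    module PS = Solver {X}
    ∂ = derive δ

  derive-cong : ∀ {f g} → f ≈ g → ∂ f ≈ ∂ g
  derive-cong ≈-refl            = ≈-refl
  derive-cong (≈-sym e)         = ≈-sym (derive-cong e)
  derive-cong (≈-trans e e′)    = ≈-trans (derive-cong e) (derive-cong e′)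
  derive-cong (+-cong e e′)     = +-cong (derive-cong e) (derive-cong e′)
  derive-cong (*-cong e e′)     = +-cong (*-cong (derive-cong e) e′) (*-cong e (derive-cong e′))
  derive-cong (-‿cong e)        = -‿cong (derive-cong e)
  derive-cong (+-assoc _ _ _)   = +-assoc _ _ _
  derive-cong (+-comm _ _)      = +-comm _ _
  derive-cong (+-identityˡ _)   = +-identityˡ _
  derive-cong (-‿inverseˡ _)    = -‿inverseˡ _
  derive-cong (*-assoc f g h)   = PS.solve 6 (λ f g h f′ g′ h′ → (f′ PS.:* g PS.:+ f PS.:* g′) PS.:* h PS.:+ f PS.:* g PS.:* h′
      PS.:= f′ PS.:* (g PS.:* h) PS.:+ f PS.:* (g′ PS.:* h PS.:+ g PS.:* h′)) ≈-refl
    f g h (∂ f) (∂ g) (∂ h)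
  derive-cong (*-comm f g)      = PS.solve 4 (λ f g f′ g′ → f′ PS.:* g PS.:+ f PS.:* g′ PS.:= g′ PS.:* f PS.:+ g PS.:* f′) ≈-refl
      f g (∂ f) (∂ g)
  derive-cong (*-identityˡ f)   = PS.solve 2 (λ f f′ → PS.con 0ℚ PS.:* f PS.:+ PS.con 1ℚ PS.:* f′ PS.:= f′) ≈-refl f (∂ f)
  derive-cong (*-distribʳ f g h) = PS.solve 6 (λ f g h f′ g′ h′ → (g′ PS.:+ h′) PS.:* f PS.:+ (g PS.:+ h) PS.:* f′ PS.:=
      (g′ PS.:* f PS.:+ g PS.:* f′) PS.:+ (h′ PS.:* f PS.:+ h PS.:* f′)) ≈-refl
    f g h (∂ f) (∂ g) (∂ h)
  derive-cong (con-+ a b)       = ≈-sym (+-identityˡ _)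
  derive-cong (con-* a b)       = PS.solve 2 (λ a b → PS.con 0ℚ PS.:= PS.con 0ℚ PS.:* b PS.:+ a PS.:* PS.con 0ℚ) ≈-refl (con a)
      (con b)

  derive-con* : ∀ a f → ∂ (con a * f) ≈ con a * ∂ f
  derive-con* a f = ≈-trans (+-congʳ (zeroˡ f)) (+-identityˡ _)

  derive-∑ : ∀ {A : Set} (xs : List A) (f : A → Poly X) → ∂ (∑[ a ∈ xs ] f a) ≡ ∑[ a ∈ xs ] ∂ (f a)
  derive-∑ []       f = ≡.refl
  derive-∑ (x ∷ xs) f = ≡.cong₂ _+_ ≡.refl (derive-∑ xs f)

  derive-prod : ∀ {n} (f : Fin n → Poly X) → ∂ (prod f) ≈ sum (λ i → ∂ (f i) * prod (omit i f))
  derive-prod {zero}  f = ≈-refl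
  derive-prod {suc n} f = begin
    ∂ (f Fin.zero) * prod (f ∘ Fin.suc) + f Fin.zero * ∂ (prod (f ∘ Fin.suc))
      ≈⟨ +-cong (*-congˡ (≈-sym (*-identityˡ _))) (*-congˡ (derive-prod (f ∘ Fin.suc))) ⟩
    ∂ (f Fin.zero) * prod (omit Fin.zero f) + f Fin.zero * sum (λ i → ∂ (f (Fin.suc i)) * prod (omit i (f ∘ Fin.suc)))
      ≈⟨ +-congˡ (*-distribˡ-sum (f Fin.zero) (λ i → ∂ (f (Fin.suc i)) * prod (omit i (f ∘ Fin.suc)))) ⟩
    ∂ (f Fin.zero) * prod (omit Fin.zero f) + sum (λ i → f Fin.zero * (∂ (f (Fin.suc i)) * prod (omit i (f ∘ Fin.suc))))
      ≈⟨ +-congˡ (sum-cong {f = λ i → f Fin.zero * (∂ (f (Fin.suc i)) * prod (omit i (f ∘ Fin.suc)))} λ i →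
           PS.solve 3 (λ a b c → a PS.:* (b PS.:* c) PS.:= b PS.:* (a PS.:* c)) ≈-refl (f Fin.zero) (∂ (f (Fin.suc i)))
               (prod (omit i (f ∘ Fin.suc)))) ⟩
    sum (λ i → ∂ (f i) * prod (omit i f)) ∎
    where
    open ≈
    open Sum (CommutativeRing.semiring (polyRing X)) using (*-distribˡ-sum)

-- Sums over permutations

module _ {X : Set} where
  private
    module R = CommutativeRing (polyRing X)
    module ≈ = SetoidReasoning (setoid {X})
  open Sum R.semiring using (∑-permute)

  -- Permutations carry inverses and proofs, so agreeing values do not give equal records. Summands
  -- are required to depend on the values only.
  Respects : ∀ {n} → (Permutation′ n → Poly X) → Set
  Respects f = ∀ {π ρ} → π Perm.≈ ρ → f π ≈ f ρ

  ∑-permutations-suc : ∀ {n} (f : Permutation′ (suc n) → Poly X) →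
    ∑[ w ∈ permutations (suc n) ] f w ≈ sum (λ j → ∑[ π ∈ permutations n ] f (Perm.insert Fin.zero j π))
  ∑-permutations-suc {n} f = ≈-trans (∑-cartesianProductWith (Perm.insert Fin.zero) (allFin (suc n)) (permutations n) f)
    (R.reflexive (∑-allFin (λ j → ∑[ π ∈ permutations n ] f (Perm.insert Fin.zero j π))))

  insert-∘ₚ : ∀ {n} j (π : Permutation′ n) (σ : Permutation′ (suc n)) →
              Perm.insert Fin.zero j π ∘ₚ σ Perm.≈ Perm.insert Fin.zero (σ ⟨$⟩ʳ j) (π ∘ₚ Perm.remove j σ)
  insert-∘ₚ j π σ Fin.zero    = ≡.refl
  insert-∘ₚ j π σ (Fin.suc k) = Perm.punchIn-permute σ j (π ⟨$⟩ʳ k)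

  -- Composing with `σ` sends the image j of 0 to σ j and composes the remaining permutation with
  -- one that depends only on j. The inner sums are then invariant by induction, and the outer sum
  -- is merely permuted by `σ`.
  ∑-permutations-∘ₚ : ∀ {n} (f : Permutation′ n → Poly X) → Respects f → ∀ σ →
                      ∑[ π ∈ permutations n ] f (π ∘ₚ σ) ≈ ∑[ π ∈ permutations n ] f π
  ∑-permutations-∘ₚ {zero}  f resp σ = +-congʳ (resp {Perm.id ∘ₚ σ} {Perm.id} λ ())
  ∑-permutations-∘ₚ {suc n} f resp σ = begin
    ∑[ w ∈ permutations (suc n) ] f (w ∘ₚ σ)
      ≈⟨ ∑-permutations-suc (λ w → f (w ∘ₚ σ)) ⟩
    sum (λ j → ∑[ π ∈ permutations n ] f (Perm.insert Fin.zero j π ∘ₚ σ))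
      ≈⟨ sum-cong (λ j → ≈-trans
           (∑-cong (permutations n) λ π → resp {Perm.insert Fin.zero j π ∘ₚ σ}
               {Perm.insert Fin.zero (σ ⟨$⟩ʳ j) (π ∘ₚ Perm.remove j σ)} (insert-∘ₚ j π σ))
           (∑-permutations-∘ₚ (g (σ ⟨$⟩ʳ j)) (λ {π} {ρ} → resp-insert (σ ⟨$⟩ʳ j) {π} {ρ}) (Perm.remove j σ))) ⟩
    sum (λ j → ∑[ π ∈ permutations n ] g (σ ⟨$⟩ʳ j) π)
      ≈⟨ ∑-permute (λ j → ∑[ π ∈ permutations n ] g j π) σ ⟨
    sum (λ j → ∑[ π ∈ permutations n ] g j π)
      ≈⟨ ∑-permutations-suc f ⟨
    ∑[ w ∈ permutations (suc n) ] f w ∎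
    where
    open ≈
    g : Fin (suc n) → Permutation′ n → Poly X
    g j π = f (Perm.insert Fin.zero j π)
    resp-insert : ∀ j → Respects (g j)
    resp-insert j {π} {ρ} e = resp {Perm.insert Fin.zero j π} {Perm.insert Fin.zero j ρ}
      λ { Fin.zero → ≡.refl ; (Fin.suc k) → ≡.cong (punchIn j) (e k) }

-- For j = suc j′ this splices 0 into the cycle of j′, in front of j′;
-- for j = 0 it adds the fixed point 0.
splice : ∀ {n} → Fin (suc n) → Permutation′ n → Permutation′ (suc n)
splice j π = Perm.lift₀ π ∘ₚ Perm.transpose Fin.zero j

-- Insertion relabels points by `punchIn` and so hides the cycle structure, which splicing displays.
-- For fixed j the two differ by composing the smaller permutation with one depending on j alone,
-- and this leaves the sum unchanged.
∑-permutations-splice : ∀ {X : Set} {n} (f : Permutation′ (suc n) → Poly X) → Respects f →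
  ∑[ w ∈ permutations (suc n) ] f w ≈ sum (λ j → ∑[ π ∈ permutations n ] f (splice j π))
∑-permutations-splice {X} {n} f resp = ≈-trans (∑-permutations-suc f) (sum-cong λ j → ≈-trans
  (≈-sym (∑-permutations-∘ₚ (λ π → f (Perm.insert Fin.zero j π))
    (λ {π} {ρ} e → resp {Perm.insert Fin.zero j π} {Perm.insert Fin.zero j ρ}
        λ { Fin.zero → ≡.refl ; (Fin.suc k) → ≡.cong (punchIn j) (e k) })
    (Perm.remove Fin.zero (Perm.transpose Fin.zero j))))
  (∑-cong (permutations n) λ π → resp {Perm.insert Fin.zero j (π ∘ₚ Perm.remove Fin.zero (Perm.transpose Fin.zero j))}
      {splice j π}
    λ { Fin.zero → ≡.refl
      ; (Fin.suc k) → ≡.sym (Perm.punchIn-permute (Perm.transpose Fin.zero j) Fin.zero (π ⟨$⟩ʳ k)) }))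

-- Cycles

module _ {n} (w : Permutation′ n) where

  iterate-+ : ∀ k l i → iterate w (k ℕ.+ l) i ≡ iterate w k (iterate w l i)
  iterate-+ zero    l i = ≡.refl
  iterate-+ (suc k) l i = ≡.cong (w ⟨$⟩ʳ_) (iterate-+ k l i)

  iterate-cancel : ∀ k i j → iterate w k i ≡ iterate w k j → i ≡ j
  iterate-cancel zero    i j e = e
  iterate-cancel (suc k) i j e = iterate-cancel k i j (Injection.injective (↔⇒↣ w) e)

  -- Two of the n + 1 iterates with exponents 0, ..., n coincide, and injectivity cancels the
  -- smaller exponent. The bound d ≤ n is what allows exponents to be reduced below n.
  iterate-period : ∀ i → ∃[ d ] 0 < d × d ≤ n × iterate w d i ≡ i
  iterate-period i with k , l , k<l , e ← Fin.pigeonhole (ℕ.n<1+n n) (λ (k : Fin (suc n)) → iterate w (toℕ k) i) =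
    toℕ l ℕ.∸ toℕ k , ℕ.m<n⇒0<n∸m k<l , ℕ.≤-trans (ℕ.m∸n≤m (toℕ l) (toℕ k)) (ℕ.≤-pred (Fin.toℕ<n l)) ,
    ≡.sym (iterate-cancel (toℕ k) _ _ (≡.trans e
      (≡.trans (≡.cong (λ m → iterate w m i) (≡.sym (ℕ.m+[n∸m]≡n (ℕ.<⇒≤ k<l)))) (iterate-+ (toℕ k) (toℕ l ℕ.∸ toℕ k) i))))

  sameCycle-< : ∀ {i} k → k < n → SameCycle w i (iterate w k i)
  sameCycle-< {i} k k<n = Fin.fromℕ< k<n , ≡.cong (λ m → iterate w m i) (Fin.toℕ-fromℕ< k<n)

  sameCycle-refl : ∀ {i} → SameCycle w i i
  sameCycle-refl {i} = sameCycle-< 0 (ℕ.≤-<-trans z≤n (Fin.toℕ<n i))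

  -- `SameCycle` admits only exponents below n. The induction raises the exponent by one; should it
  -- reach n, it is replaced by n - d for a period d.
  sameCycle-iterate : ∀ {i} k → SameCycle w i (iterate w k i)
  sameCycle-iterate         zero    = sameCycle-refl
  sameCycle-iterate {i} (suc k) with l , e ← sameCycle-iterate {i} k with suc (toℕ l) ℕ.<? n
  ... | yes l<n = ≡.subst (SameCycle w i) (≡.cong (w ⟨$⟩ʳ_) e) (sameCycle-< (suc (toℕ l)) l<n)
  ... | no  l≮n with d , 0<d , d≤n , period ← iterate-period i =
    ≡.subst (SameCycle w i)
      (≡.trans (≡.trans (≡.cong (iterate w (n ℕ.∸ d)) (≡.sym period)) (≡.sym (iterate-+ (n ℕ.∸ d) d i)))
        (≡.trans (≡.cong (λ m → iterate w m i) (≡.trans (ℕ.m∸n+n≡m d≤n) (ℕ.≤-antisym (ℕ.≮⇒≥ l≮n) (Fin.toℕ<n l))))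
            (≡.cong (w ⟨$⟩ʳ_) e)))
      (sameCycle-< (n ℕ.∸ d) (ℕ.∸-monoʳ-< 0<d d≤n))

  sameCycle-trans : ∀ {i j k} → SameCycle w i j → SameCycle w j k → SameCycle w i k
  sameCycle-trans {i} (k , ≡.refl) (l , ≡.refl) =
    ≡.subst (SameCycle w i) (iterate-+ (toℕ l) (toℕ k) i) (sameCycle-iterate (toℕ l ℕ.+ toℕ k))

  sameCycle-step : ∀ i → SameCycle w i (w ⟨$⟩ʳ i)
  sameCycle-step i = sameCycle-iterate 1

  -- Carries a property of single steps along a cycle without tracking exponents. It is used in both
  -- directions between a permutation and its splice.
  sameCycle-fold : (T : Fin n → Fin n → Set) → (∀ {i} → T i i) → (∀ {i j k} → T i j → T j k → T i k) →
                   (∀ i → T i (w ⟨$⟩ʳ i)) → ∀ {i j} → SameCycle w i j → T i j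
  sameCycle-fold T T-refl T-trans step {i} (k , ≡.refl) = go (toℕ k)
    where
    go : ∀ k → T i (iterate w k i)
    go zero    = T-refl
    go (suc k) = T-trans (go k) (step _)

  sameCycle-sym : ∀ {i j} → SameCycle w i j → SameCycle w j i
  sameCycle-sym = sameCycle-fold (λ i j → SameCycle w j i) sameCycle-refl (λ p q → sameCycle-trans q p) back
    where
    back : ∀ i → SameCycle w (w ⟨$⟩ʳ i) i
    back i with suc d , _ , _ , period ← iterate-period i =
      ≡.subst (SameCycle w (w ⟨$⟩ʳ i)) (≡.trans (≡.sym (iterate-+ d 1 i))
          (≡.trans (≡.cong (λ m → iterate w m i) (ℕ.+-comm d 1)) period)) (sameCycle-iterate d)

  minimum-≤ : ∀ {i} → IsCycleMinimum w i → ∀ {j} → SameCycle w i j → i Fin.≤ j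
  minimum-≤ min (k , ≡.refl) = min k

  ≤-minimum : ∀ {i} → (∀ j → SameCycle w i j → i Fin.≤ j) → IsCycleMinimum w i
  ≤-minimum h k = h _ (k , ≡.refl)

least : ∀ {n} {A : Fin n → Set} → Decidable A → ∃ A → ∃ λ i → A i × (∀ j → A j → i Fin.≤ j)
least {suc n} A? (i , a) with A? Fin.zero
... | yes a₀ = Fin.zero , a₀ , λ _ _ → z≤n
least A? (Fin.zero , a)  | no ¬a₀ = contradiction a ¬a₀
least A? (Fin.suc i , a) | no ¬a₀ with k , aₖ , k≤ ← least (A? ∘ Fin.suc) (i , a) =
  Fin.suc k , aₖ , λ { Fin.zero a₀ → contradiction a₀ ¬a₀ ; (Fin.suc j) aⱼ → s≤s (k≤ j aⱼ) }

cycleMinimum : ∀ {n} (w : Permutation′ n) j → ∃ λ i → IsCycleMinimum w i × SameCycle w i j ×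
               (∀ k → IsCycleMinimum w k → SameCycle w k j → k ≡ i)
cycleMinimum w j with i , j∼i , i≤ ← least (sameCycle? w j) (j , sameCycle-refl w) =
  i , i-min , sameCycle-sym w j∼i , λ k k-min k∼j → Fin.≤-antisym
    (minimum-≤ w k-min (sameCycle-trans w k∼j j∼i))
    (minimum-≤ w i-min (sameCycle-sym w (sameCycle-trans w k∼j j∼i)))
  where
  i-min : IsCycleMinimum w i
  i-min = ≤-minimum w λ k i∼k → i≤ k (sameCycle-trans w j∼i i∼k)

count : ∀ {n} → (Fin n → Bool) → ℕ
count {zero}  b = 0
count {suc n} b = (if b Fin.zero then 1 else 0) ℕ.+ count (b ∘ Fin.suc)

count-cong : ∀ {n} {b c : Fin n → Bool} → (∀ i → b i ≡ c i) → count b ≡ count c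
count-cong {zero}  e = ≡.refl
count-cong {suc n} e = ≡.cong₂ (λ b m → (if b then 1 else 0) ℕ.+ m) (e Fin.zero) (count-cong (e ∘ Fin.suc))

length-filter : ∀ {n} {A : Set} {Q : A → Set} (Q? : Decidable Q) (f : Fin n → A) →
                length (filter Q? (List.tabulate f)) ≡ count (does ∘ Q? ∘ f)
length-filter {zero}  Q? f = ≡.refl
length-filter {suc n} Q? f with does (Q? (f Fin.zero))
... | true  = ≡.cong suc (length-filter Q? (f ∘ Fin.suc))
... | false = length-filter Q? (f ∘ Fin.suc)

∏-filter : ∀ {X : Set} {n} {A : Set} {Q : A → Set} (Q? : Decidable Q) (f : Fin n → A) (g : A → ℕ) (y : ℕ → Poly X) →
           ∏[ k ∈ map g (filter Q? (List.tabulate f)) ] y k ≈ prod (λ i → if does (Q? (f i)) then y (g (f i)) else con 1ℚ)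
∏-filter {n = zero}  Q? f g y = ≈-refl
∏-filter {n = suc n} Q? f g y with does (Q? (f Fin.zero))
... | true  = *-congˡ (∏-filter Q? (f ∘ Fin.suc) g y)
... | false = ≈-trans (∏-filter Q? (f ∘ Fin.suc) g y) (≈-sym (*-identityˡ _))

cycleLength-count : ∀ {n} (w : Permutation′ n) i → cycleLength w i ≡ count (λ j → does (sameCycle? w i j))
cycleLength-count w i = length-filter (sameCycle? w i) id

cycleLength-≡ : ∀ {n} (w : Permutation′ n) {i j} → SameCycle w i j → cycleLength w i ≡ cycleLength w j
cycleLength-≡ w {i} {j} i∼j = ≡.trans (cycleLength-count w i) (≡.trans
  (count-cong λ k → does-⇔ (mk⇔ (sameCycle-trans w (sameCycle-sym w i∼j)) (sameCycle-trans w i∼j)) (sameCycle? w i k)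
      (sameCycle? w j k))
  (≡.sym (cycleLength-count w j)))

module _ {X : Set} (y : ℕ → Poly X) where

  cycleWeight : ∀ {n} → Permutation′ n → Poly X
  cycleWeight w = ∏[ k ∈ cycleType w ] y k

  minimumWeight : ∀ {n} → Permutation′ n → Fin n → Poly X
  minimumWeight w i = if does (isCycleMinimum? w i) then y (cycleLength w i) else con 1ℚ

  -- The product of these factors is the weight of the cycles that miss `j`, which splicing in front
  -- of `j` does not touch.
  awayFrom : ∀ {n} → Permutation′ n → Fin n → Fin n → Poly X
  awayFrom w j i = if does (isCycleMinimum? w i) ∧ not (does (sameCycle? w i j)) then y (cycleLength w i) else con 1ℚ

  cycleWeight-prod : ∀ {n} (w : Permutation′ n) → cycleWeight w ≈ prod (minimumWeight w)
  cycleWeight-prod w = ∏-filter (isCycleMinimum? w) id (cycleLength w) y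

  cycleWeight-resp : ∀ {n} → Respects (cycleWeight {n})
  cycleWeight-resp {π = π} {ρ} e = ≈-trans (cycleWeight-prod π) (≈-trans
    (prod-cong λ i → CommutativeRing.reflexive (polyRing X) (≡.cong₂ (λ b k → if b then y k else con 1ℚ)
      (does-⇔ (mk⇔ (λ m k → ≡.subst (i Fin.≤_) (iter (toℕ k) i) (m k))
          (λ m k → ≡.subst (i Fin.≤_) (≡.sym (iter (toℕ k) i)) (m k)))
        (isCycleMinimum? π i) (isCycleMinimum? ρ i))
      (≡.trans (cycleLength-count π i) (≡.trans (count-cong λ j → does-⇔
        (mk⇔ (λ (k , p) → k , ≡.trans (≡.sym (iter (toℕ k) i)) p) (λ (k , p) → k , ≡.trans (iter (toℕ k) i) p))
            (sameCycle? π i j) (sameCycle? ρ i j))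
        (≡.sym (cycleLength-count ρ i))))))
    (≈-sym (cycleWeight-prod ρ)))
    where
    iter : ∀ k i → iterate π k i ≡ iterate ρ k i
    iter zero    i = ≡.refl
    iter (suc k) i = ≡.trans (e (iterate π k i)) (≡.cong (ρ ⟨$⟩ʳ_) (iter k i))

  omit-minimum : ∀ {n} (w : Permutation′ n) {i j} → IsCycleMinimum w i → SameCycle w i j →
                 prod (omit i (minimumWeight w)) ≈ prod (awayFrom w j)
  omit-minimum w {i} {j} i-min i∼j = prod-cong λ k → pointwise k (i Fin.≟ k) (isCycleMinimum? w k) (sameCycle? w k j)
    where
    pointwise : ∀ k (i≟k : Dec (i ≡ k)) (min? : Dec (IsCycleMinimum w k)) (k∼j? : Dec (SameCycle w k j)) →
                (if does i≟k then con 1ℚ else if does min? then y (cycleLength w k) else con 1ℚ) ≈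
                (if does min? ∧ not (does k∼j?) then y (cycleLength w k) else con 1ℚ)
    pointwise k (yes ≡.refl) (no ¬min) _        = contradiction i-min ¬min
    pointwise k (yes ≡.refl) (yes _)   (no ¬k∼j) = contradiction i∼j ¬k∼j
    pointwise k (yes ≡.refl) (yes _)   (yes _)  = ≈-refl
    pointwise k (no _)       (no _)    _        = ≈-refl
    pointwise k (no _)       (yes _)   (no _)   = ≈-refl
    pointwise k (no i≢k)     (yes min) (yes k∼j) with i₀ , _ , _ , uniq ← cycleMinimum w j =
      contradiction (≡.trans (uniq i i-min i∼j) (≡.sym (uniq k min k∼j))) i≢k

  cycleWeight-split : ∀ {n} (w : Permutation′ n) j → cycleWeight w ≈ y (cycleLength w j) * prod (awayFrom w j)
  cycleWeight-split w j with i , i-min , i∼j , _ ← cycleMinimum w j = ≈-trans (cycleWeight-prod w) (≈-trans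
    (prod-omit i (minimumWeight w))
    (*-cong (CommutativeRing.reflexive (polyRing X) (≡.trans
      (≡.cong (if_then y (cycleLength w i) else con 1ℚ) (dec-true (isCycleMinimum? w i) i-min))
      (≡.cong y (cycleLength-≡ w i∼j)))) (omit-minimum w i-min i∼j)))

-- Cycles of a spliced permutation

module _ {n} (π : Permutation′ n) where

  module _ (j : Fin n) where
    private W = splice (Fin.suc j) π

    -- Identifies the new point 0 with j, the point it was spliced in front of. Under this map the
    -- cycles before and after splicing correspond.
    collapse : Fin (suc n) → Fin n
    collapse Fin.zero    = j
    collapse (Fin.suc i) = i

    collapse-step : ∀ i → SameCycle π (collapse i) (collapse (W ⟨$⟩ʳ i))
    collapse-step Fin.zero    = sameCycle-refl π
    collapse-step (Fin.suc i) with (π ⟨$⟩ʳ i) Fin.≟ j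
    ... | yes e = ≡.subst (SameCycle π i) e (sameCycle-step π i)
    ... | no  _ = sameCycle-step π i

    -- If π i = j, the spliced permutation makes the same move in two steps, through 0.
    lift-step : ∀ i → SameCycle W (Fin.suc i) (Fin.suc (π ⟨$⟩ʳ i))
    lift-step i = go (sameCycle-step W (Fin.suc i))
      where
      go : SameCycle W (Fin.suc i) (W ⟨$⟩ʳ Fin.suc i) → SameCycle W (Fin.suc i) (Fin.suc (π ⟨$⟩ʳ i))
      go s with (π ⟨$⟩ʳ i) Fin.≟ j
      ... | yes e = sameCycle-trans W s (≡.subst (λ k → SameCycle W Fin.zero (Fin.suc k)) (≡.sym e) (sameCycle-step W Fin.zero))
      ... | no  _ = s

    sameCycle-lift : ∀ {i k} → SameCycle π i k → SameCycle W (Fin.suc i) (Fin.suc k)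
    sameCycle-lift = sameCycle-fold π (SameCycle W on Fin.suc) (sameCycle-refl W) (sameCycle-trans W) lift-step

    sameCycle-collapse : ∀ i → SameCycle W i (Fin.suc (collapse i))
    sameCycle-collapse Fin.zero    = sameCycle-step W Fin.zero
    sameCycle-collapse (Fin.suc i) = sameCycle-refl W

    sameCycle-splice : ∀ i k → SameCycle W i k ⇔ SameCycle π (collapse i) (collapse k)
    sameCycle-splice i k = mk⇔
      (sameCycle-fold W (SameCycle π on collapse) (sameCycle-refl π) (sameCycle-trans π) collapse-step)
      (λ s → sameCycle-trans W (sameCycle-collapse i) (sameCycle-trans W (sameCycle-lift s)
          (sameCycle-sym W (sameCycle-collapse k))))

    sameCycle?-splice : ∀ i k → does (sameCycle? W i k) ≡ does (sameCycle? π (collapse i) (collapse k))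
    sameCycle?-splice i k = does-⇔ (sameCycle-splice i k) (sameCycle? W i k) (sameCycle? π (collapse i) (collapse k))

    cycleLength-splice : ∀ i → cycleLength W i ≡ (if does (sameCycle? π (collapse i) j) then 1 else 0) ℕ.+ cycleLength π
        (collapse i)
    cycleLength-splice i = ≡.trans (cycleLength-count W i) (≡.trans (count-cong (sameCycle?-splice i))
      (≡.cong ((if does (sameCycle? π (collapse i) j) then 1 else 0) ℕ.+_) (≡.sym (cycleLength-count π (collapse i)))))

    -- The new point 0 is smaller than every other point, so it takes over as the minimum of the
    -- cycle of j; the minima of the other cycles survive.
    isCycleMinimum?-splice : ∀ i → does (isCycleMinimum? W (Fin.suc i)) ≡ does (isCycleMinimum? π i) ∧ not
        (does (sameCycle? π i j))
    isCycleMinimum?-splice i = does-⇔ (mk⇔ to from) (isCycleMinimum? W (Fin.suc i))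
        (isCycleMinimum? π i ×-dec ¬? (sameCycle? π i j))
      where
      to : IsCycleMinimum W (Fin.suc i) → IsCycleMinimum π i × ¬ SameCycle π i j
      to m = ≤-minimum π (λ k s → ℕ.≤-pred (minimum-≤ W m (Equivalence.from (sameCycle-splice (Fin.suc i) (Fin.suc k)) s)))
           , (λ s → ℕ.1+n≰n (ℕ.≤-trans (s≤s z≤n) (minimum-≤ W m (Equivalence.from (sameCycle-splice (Fin.suc i) Fin.zero) s))))
      from : IsCycleMinimum π i × ¬ SameCycle π i j → IsCycleMinimum W (Fin.suc i)
      from (m , i≁j) = ≤-minimum W λ where
        Fin.zero    s → contradiction (Equivalence.to (sameCycle-splice (Fin.suc i) Fin.zero) s) i≁j
        (Fin.suc k) s → s≤s (minimum-≤ π m (Equivalence.to (sameCycle-splice (Fin.suc i) (Fin.suc k)) s))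

    cycleWeight-splice-suc : ∀ {X : Set} (y : ℕ → Poly X) → cycleWeight y W ≈ y (suc (cycleLength π j)) * prod (awayFrom y π j)
    cycleWeight-splice-suc {X} y = ≈-trans (cycleWeight-prod y W) (*-cong
      (reflexive (≡.trans
        (≡.cong (if_then y (cycleLength W Fin.zero) else con 1ℚ) (dec-true (isCycleMinimum? W Fin.zero) (λ _ → z≤n)))
        (≡.cong y (≡.trans (cycleLength-splice Fin.zero)
          (≡.cong (λ b → (if b then 1 else 0) ℕ.+ cycleLength π j) (dec-true (sameCycle? π j j) (sameCycle-refl π)))))))
      (prod-cong λ i → reflexive (≡.trans
        (≡.cong (if_then y (cycleLength W (Fin.suc i)) else con 1ℚ) (isCycleMinimum?-splice i))
        (away i (isCycleMinimum? π i) (sameCycle? π i j) (cycleLength-splice (Fin.suc i))))))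
      where
      reflexive = CommutativeRing.reflexive (polyRing X)
      away : ∀ i (m? : Dec (IsCycleMinimum π i)) (s? : Dec (SameCycle π i j)) {l} →
             l ≡ (if does s? then 1 else 0) ℕ.+ cycleLength π i →
             (if does m? ∧ not (does s?) then y l else con 1ℚ) ≡ (if does m? ∧ not (does s?) then y (cycleLength π i) else con 1ℚ)
      away i (yes _) (no _)  e = ≡.cong y e
      away i (yes _) (yes _) e = ≡.refl
      away i (no _)  _       e = ≡.refl

  private W₀ = splice Fin.zero π

  iterate-lift : ∀ k i → iterate W₀ k (Fin.suc i) ≡ Fin.suc (iterate π k i)
  iterate-lift zero    i = ≡.refl
  iterate-lift (suc k) i = ≡.cong (W₀ ⟨$⟩ʳ_) (iterate-lift k i)

  iterate-fixed : ∀ k → iterate W₀ k Fin.zero ≡ Fin.zero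
  iterate-fixed zero    = ≡.refl
  iterate-fixed (suc k) = ≡.cong (W₀ ⟨$⟩ʳ_) (iterate-fixed k)

  private
    fixed-apart : ∀ {i} → ¬ SameCycle W₀ Fin.zero (Fin.suc i)
    fixed-apart (k , e) with () ← ≡.trans (≡.sym (iterate-fixed (toℕ k))) e

    lift-sameCycle : ∀ i k → SameCycle W₀ (Fin.suc i) (Fin.suc k) ⇔ SameCycle π i k
    lift-sameCycle i k = mk⇔
      (λ (l , e) → ≡.subst (SameCycle π i) (Fin.suc-injective (≡.trans (≡.sym (iterate-lift (toℕ l) i)) e))
          (sameCycle-iterate π (toℕ l)))
      (λ (l , e) → ≡.subst (SameCycle W₀ (Fin.suc i)) (≡.trans (iterate-lift (toℕ l) i) (≡.cong Fin.suc e))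
          (sameCycle-iterate W₀ (toℕ l)))

    cycleLength-fixed : cycleLength W₀ Fin.zero ≡ 1
    cycleLength-fixed = ≡.trans (cycleLength-count W₀ Fin.zero) (≡.cong₂ (λ b m → (if b then 1 else 0) ℕ.+ m)
      (dec-true (sameCycle? W₀ Fin.zero Fin.zero) (sameCycle-refl W₀))
      (≡.trans (count-cong λ i → dec-false (sameCycle? W₀ Fin.zero (Fin.suc i)) fixed-apart) (count-false n)))
      where
      count-false : ∀ n → count {n} (λ _ → false) ≡ 0
      count-false zero    = ≡.refl
      count-false (suc n) = count-false n

    cycleLength-lift : ∀ i → cycleLength W₀ (Fin.suc i) ≡ cycleLength π i
    cycleLength-lift i = ≡.trans (cycleLength-count W₀ (Fin.suc i)) (≡.trans (≡.cong₂ (λ b m → (if b then 1 else 0) ℕ.+ m)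
      (dec-false (sameCycle? W₀ (Fin.suc i) Fin.zero) (fixed-apart ∘ sameCycle-sym W₀))
      (count-cong λ k → does-⇔ (lift-sameCycle i k) (sameCycle? W₀ (Fin.suc i) (Fin.suc k)) (sameCycle? π i k)))
      (≡.sym (cycleLength-count π i)))

    isCycleMinimum?-lift : ∀ i → does (isCycleMinimum? W₀ (Fin.suc i)) ≡ does (isCycleMinimum? π i)
    isCycleMinimum?-lift i = does-⇔ (mk⇔
      (λ m → ≤-minimum π λ k s → ℕ.≤-pred (minimum-≤ W₀ m (Equivalence.from (lift-sameCycle i k) s)))
      (λ m → ≤-minimum W₀ λ where
        Fin.zero    s → contradiction (sameCycle-sym W₀ s) fixed-apart
        (Fin.suc k) s → s≤s (minimum-≤ π m (Equivalence.to (lift-sameCycle i k) s))))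
      (isCycleMinimum? W₀ (Fin.suc i)) (isCycleMinimum? π i)

  cycleWeight-splice-zero : ∀ {X : Set} (y : ℕ → Poly X) → cycleWeight y W₀ ≈ y 1 * cycleWeight y π
  cycleWeight-splice-zero {X} y = ≈-trans (cycleWeight-prod y W₀) (*-cong
    (reflexive (≡.trans
      (≡.cong (if_then y (cycleLength W₀ Fin.zero) else con 1ℚ) (dec-true (isCycleMinimum? W₀ Fin.zero) (λ _ → z≤n)))
      (≡.cong y cycleLength-fixed)))
    (≈-trans (prod-cong λ i → reflexive (≡.cong₂ (λ b l → if b then y l else con 1ℚ) (isCycleMinimum?-lift i)
        (cycleLength-lift i)))
      (≈-sym (cycleWeight-prod y π))))
    where reflexive = CommutativeRing.reflexive (polyRing X)

-- The cycle index

private module RX {X : Set} = CommutativeRing (polyRing X)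

con-suc : ∀ {X : Set} n → con {X} (fromℕ (suc n)) ≈ con 1ℚ + con (fromℕ n)
con-suc n = ≈-trans (RX.reflexive (≡.cong con (fromℕ-suc n))) (con-+ 1ℚ (fromℕ n))

con-count : ∀ {X : Set} {n} (b : Fin n → Bool) → con {X} (fromℕ (count b)) ≈ sum (𝟙 ∘ b)
con-count {n = zero}  b = ≈-refl
con-count {n = suc n} b with b Fin.zero
... | true  = ≈-trans (con-suc (count (b ∘ Fin.suc))) (+-congˡ (con-count (b ∘ Fin.suc)))
... | false = ≈-trans (con-count (b ∘ Fin.suc)) (≈-sym (+-identityˡ _))

sum-constant : ∀ {X : Set} k (c : Poly X) → sum {n = k} (λ _ → c) ≈ con (fromℕ k) * c
sum-constant zero    c = ≈-sym (zeroˡ c)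
sum-constant (suc k) c = ≈-trans (+-cong (≈-sym (*-identityˡ c)) (sum-constant k c))
  (≈-trans (≈-sym (*-distribʳ c (con 1ℚ) (con (fromℕ k)))) (*-congʳ (≈-sym (con-suc k))))

substitute-sum : ∀ {X Y : Set} (s : X → Poly Y) {n} (f : Fin n → Poly X) → substitute s (sum f) ≡ sum (substitute s ∘ f)
substitute-sum s {zero}  f = ≡.refl
substitute-sum s {suc n} f = ≡.cong₂ _+_ ≡.refl (substitute-sum s (f ∘ Fin.suc))

derive-sum : ∀ {X : Set} (δ : X → Poly X) {n} (f : Fin n → Poly X) → derive δ (sum f) ≡ sum (derive δ ∘ f)
derive-sum δ {zero}  f = ≡.refl
derive-sum δ {suc n} f = ≡.cong₂ _+_ ≡.refl (derive-sum δ (f ∘ Fin.suc))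

-- In the variables x this is ∑ xᵢ² ∂/∂xᵢ.
raiseVar : ℕ → Λ
raiseVar i = con (fromℕ (suc i)) * var (suc i)

raise : Λ → Λ
raise = derive raiseVar

module CycleIndex (c : ℚ) where
  private
    module ≈ = SetoidReasoning (setoid {ℕ})
    module PS = Solver {ℕ}
    module S = CommutativeRing (seriesRing {ℕ})
    y : ℕ → Λ
    y k = con c * p k
  open Sum (CommutativeRing.semiring (polyRing ℕ)) using (sum-replicate-zero; *-distribʳ-sum; ∑-distrib-+) renaming
      (∑-comm to sum-comm)

  raise-y : ∀ k → raise (y k) ≈ con (fromℕ k) * y (suc k)
  raise-y zero    = PS.solve 3 (λ c o v → PS.con 0ℚ PS.:* o PS.:+ c PS.:* PS.con 0ℚ PS.:= PS.con 0ℚ PS.:* (c PS.:* v)) ≈-refl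
      (con c) (con 1ℚ) (var 0)
  raise-y (suc k) = PS.solve 4 (λ c v q v′ → PS.con 0ℚ PS.:* v PS.:+ c PS.:* (q PS.:* v′) PS.:= q PS.:* (c PS.:* v′)) ≈-refl
      (con c) (var k) (con (fromℕ (suc k))) (var (suc k))

  -- By the Leibniz rule the derivation acts on one cycle at a time and turns `y L` into L
  -- `y (suc L)`. The factor L counts the points j of that cycle in front of which 0 can be spliced.
  -- The double sum over a minimum i and a point j of its cycle reduces to a sum over j, as every j
  -- has exactly one such i.
  raise-cycleWeight : ∀ {n} (π : Permutation′ n) → raise (cycleWeight y π) ≈ sum (λ j → cycleWeight y (splice (Fin.suc j) π))
  raise-cycleWeight {n} π = begin
    raise (cycleWeight y π)                        ≈⟨ derive-cong raiseVar (cycleWeight-prod y π) ⟩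
    raise (prod F)                                 ≈⟨ derive-prod raiseVar F ⟩
    sum (λ i → raise (F i) * prod (omit i F))      ≈⟨ sum-cong (λ i → expand i (isCycleMinimum? π i)) ⟩
    sum (λ i → sum (λ j → if b i j then G j else con 0ℚ)) ≈⟨ sum-comm (λ i j → if b i j then G j else con 0ℚ) ⟩
    sum (λ j → sum (λ i → if b i j then G j else con 0ℚ)) ≈⟨ sum-cong (λ j → collect j) ⟩
    sum G                                          ≈⟨ sum-cong (λ j → cycleWeight-splice-suc π j y) ⟨
    sum (λ j → cycleWeight y (splice (Fin.suc j) π)) ∎
    where
    open ≈
    F = minimumWeight y π
    G : Fin n → Λ
    G j = y (suc (cycleLength π j)) * prod (awayFrom y π j)
    b : Fin n → Fin n → Bool
    b i j = does (isCycleMinimum? π i) ∧ does (sameCycle? π i j)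
    expand : ∀ i (m? : Dec (IsCycleMinimum π i)) →
             raise (if does m? then y (cycleLength π i) else con 1ℚ) * prod (omit i F) ≈
             sum (λ j → if does m? ∧ does (sameCycle? π i j) then G j else con 0ℚ)
    expand i (no _)    = ≈-trans (zeroˡ _) (≈-sym (sum-replicate-zero n))
    expand i (yes min) = begin
      raise (y L) * O                                   ≈⟨ *-congʳ (raise-y L) ⟩
      con (fromℕ L) * y (suc L) * O                     ≈⟨ *-assoc _ _ _ ⟩
      con (fromℕ L) * (y (suc L) * O)                   ≈⟨ *-congʳ
          (≈-trans (RX.reflexive (≡.cong (con ∘ fromℕ) (cycleLength-count π i))) (con-count (λ j → does (sameCycle? π i j)))) ⟩
      sum (λ j → 𝟙 (does (sameCycle? π i j))) * (y (suc L) * O)  ≈⟨ *-distribʳ-sum (y (suc L) * O)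
          (λ j → 𝟙 (does (sameCycle? π i j))) ⟩
      sum (λ j → 𝟙 (does (sameCycle? π i j)) * (y (suc L) * O))  ≈⟨ sum-cong (λ j → member j (sameCycle? π i j)) ⟩
      sum (λ j → if does (sameCycle? π i j) then G j else con 0ℚ) ∎
      where
      L = cycleLength π i
      O = prod (omit i F)
      member : ∀ j (s? : Dec (SameCycle π i j)) → 𝟙 (does s?) * (y (suc L) * O) ≈ (if does s? then G j else con 0ℚ)
      member j (no _)  = zeroˡ _
      member j (yes s) = ≈-trans (*-identityˡ _) (*-cong (RX.reflexive (≡.cong (y ∘ suc) (cycleLength-≡ π s)))
          (omit-minimum y π min s))
    collect : ∀ j → sum (λ i → if b i j then G j else con 0ℚ) ≈ G j
    collect j with i , i-min , i∼j , uniq ← cycleMinimum π j = sum-unique (λ i → b i j) i (G j)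
      (≡.cong₂ _∧_ (dec-true (isCycleMinimum? π i) i-min) (dec-true (sameCycle? π i j) i∼j))
      (λ k → both k (isCycleMinimum? π k) (sameCycle? π k j))
      where
      both : ∀ k (m? : Dec (IsCycleMinimum π k)) (s? : Dec (SameCycle π k j)) → does m? ∧ does s? ≡ true → k ≡ i
      both k (yes m) (yes s) _ = uniq k m s

  totalWeight : ℕ → Λ
  totalWeight n = ∑[ w ∈ permutations n ] cycleWeight y w

  totalWeight-suc : ∀ n → totalWeight (suc n) ≈ y 1 * totalWeight n + raise (totalWeight n)
  totalWeight-suc n = begin
    totalWeight (suc n)
      ≈⟨ ∑-permutations-splice {n = n} (cycleWeight y) (λ {π} {ρ} → cycleWeight-resp y {π = π} {ρ}) ⟩
    (∑[ π ∈ permutations n ] cycleWeight y (splice Fin.zero π)) + sum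
        (λ j → ∑[ π ∈ permutations n ] cycleWeight y (splice (Fin.suc j) π))
      ≈⟨ +-cong (∑-cong (permutations n) λ π → cycleWeight-splice-zero π y)
          (sum-∑-comm (permutations n) (λ j π → cycleWeight y (splice (Fin.suc j) π))) ⟩
    (∑[ π ∈ permutations n ] (y 1 * cycleWeight y π)) + (∑[ π ∈ permutations n ] (sum λ j → cycleWeight y (splice (Fin.suc j) π)))
      ≈⟨ +-cong (≈-sym (∑-distribˡ (y 1) (permutations n) (cycleWeight y)))
          (≈-trans (∑-cong (permutations n) λ π → ≈-sym (raise-cycleWeight π))
          (RX.reflexive (≡.sym (derive-∑ raiseVar (permutations n) (cycleWeight y))))) ⟩
    y 1 * totalWeight n + raise (totalWeight n) ∎
    where open ≈

  cycleIndex : Series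
  cycleIndex n = con (1/ n !) * totalWeight n

  cycleIndex-zero : cycleIndex 0 ≈ con 1ℚ
  cycleIndex-zero = ≈-trans (*-identityˡ _) (RX.+-identityʳ _)

  private
    T : Series → Series
    T f n = y 1 * f n + raise (f n)

    Y : Series
    Y n = y (suc n)

    D-cycleIndex-T : D cycleIndex ≋ T cycleIndex
    D-cycleIndex-T n = begin
      con (fromℕ (suc n)) * (con (1/ suc n !) * totalWeight (suc n)) ≈⟨ *-assoc _ _ _ ⟨
      con (fromℕ (suc n)) * con (1/ suc n !) * totalWeight (suc n)
        ≈⟨ *-cong (≈-trans (≈-sym (con-* (fromℕ (suc n)) (1/ suc n !))) (RX.reflexive (≡.cong con (1/-!-suc n))))
            (totalWeight-suc n) ⟩
      con (1/ n !) * (y 1 * totalWeight n + raise (totalWeight n))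
        ≈⟨ PS.solve 4 (λ a b z r → a PS.:* (b PS.:* z PS.:+ r) PS.:= b PS.:* (a PS.:* z) PS.:+ a PS.:* r) ≈-refl (con (1/ n !))
            (y 1) (totalWeight n) (raise (totalWeight n)) ⟩
      y 1 * cycleIndex n + con (1/ n !) * raise (totalWeight n)
        ≈⟨ +-congˡ (derive-con* raiseVar (1/ n !) (totalWeight n)) ⟨
      T cycleIndex n ∎
      where open ≈

    T-local : ∀ f g n → (∀ k → k ≤ n → f k ≈ g k) → T f n ≈ T g n
    T-local f g n e = +-cong (*-congˡ (e n ℕ.≤-refl)) (derive-cong raiseVar (e n ℕ.≤-refl))

    raise-⋆ : ∀ f g → raise ∘ (f ⋆ g) ≋ (raise ∘ f) ⋆ g ⊕ f ⋆ (raise ∘ g)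
    raise-⋆ f g n = ≈-trans (RX.reflexive (derive-sum raiseVar {suc n} (λ k → f (toℕ k) * g (n ℕ.∸ toℕ k))))
      (∑-distrib-+ {suc n} (λ k → raise (f (toℕ k)) * g (n ℕ.∸ toℕ k)) (λ k → f (toℕ k) * raise (g (n ℕ.∸ toℕ k))))

  -- Growing permutations gives D E = y₁ E + raise E, which still contains `raise`. The series D E
  -- and Y ⋆ E both satisfy this same equation: `raise` is a derivation commuting with `D`, and on Y
  -- it agrees with `D`. Their constant terms agree, so they coincide, and this is the equation of
  -- exp (∑ yₖ tᵏ / k).
  D-cycleIndex : D cycleIndex ≋ Y ⋆ cycleIndex
  D-cycleIndex = D-unique T T-local {D E} {Y ⋆ E} DDE DYE
    (≈-trans (D-cycleIndex-T 0) (+-congˡ (derive-cong raiseVar cycleIndex-zero)))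
    where
    E = cycleIndex
    open ≈
    DDE : D (D E) ≋ T (D E)
    DDE n = begin
      con q * D E (suc n)                                    ≈⟨ *-congˡ (D-cycleIndex-T (suc n)) ⟩
      con q * (y 1 * E (suc n) + raise (E (suc n)))          ≈⟨ PS.solve 4
          (λ q b z r → q PS.:* (b PS.:* z PS.:+ r) PS.:= b PS.:* (q PS.:* z) PS.:+ q PS.:* r) ≈-refl (con q) (y 1) (E (suc n))
          (raise (E (suc n))) ⟩
      y 1 * D E n + con q * raise (E (suc n))                ≈⟨ +-congˡ (derive-con* raiseVar q (E (suc n))) ⟨
      T (D E) n ∎
      where q = fromℕ (suc n)
    DYE : D (Y ⋆ E) ≋ T (Y ⋆ E)
    DYE n = begin
      D (Y ⋆ E) n                                            ≈⟨ D-⋆ Y E n ⟩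
      (D Y ⋆ E) n + (Y ⋆ D E) n                              ≈⟨ +-cong
          (⋆-cong {g = E} (λ k → ≈-sym (raise-y (suc k))) (λ _ → ≈-refl) n) (⋆-cong {f = Y} (λ _ → ≈-refl) D-cycleIndex-T n) ⟩
      ((raise ∘ Y) ⋆ E) n + (Y ⋆ (y 1 · E ⊕ raise ∘ E)) n    ≈⟨ +-congˡ (S.distribˡ Y (y 1 · E) (raise ∘ E) n) ⟩
      ((raise ∘ Y) ⋆ E) n + ((Y ⋆ (y 1 · E)) n + (Y ⋆ (raise ∘ E)) n)
        ≈⟨ +-congˡ (+-congʳ (≈-trans (⋆-comm Y (y 1 · E) n) (≈-trans (·-⋆ (y 1) E Y n) (*-congˡ (⋆-comm E Y n))))) ⟩
      ((raise ∘ Y) ⋆ E) n + (y 1 * (Y ⋆ E) n + (Y ⋆ (raise ∘ E)) n)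
        ≈⟨ PS.solve 3 (λ a b c → a PS.:+ (b PS.:+ c) PS.:= b PS.:+ (a PS.:+ c)) ≈-refl (((raise ∘ Y) ⋆ E) n) (y 1 * (Y ⋆ E) n)
            ((Y ⋆ (raise ∘ E)) n) ⟩
      y 1 * (Y ⋆ E) n + (((raise ∘ Y) ⋆ E) n + (Y ⋆ (raise ∘ E)) n) ≈⟨ +-congˡ (raise-⋆ Y E n) ⟨
      T (Y ⋆ E) n ∎

-- Words fixed by a permutation

module _ {n m : ℕ} where
  Fixed : Permutation′ n → Vec (Fin m) n → Set
  Fixed w a = ∀ i → lookup a (w ⟨$⟩ʳ i) ≡ lookup a i

  fixed? : ∀ w a → Dec (Fixed w a)
  fixed? w a = Fin.all? λ i → lookup a (w ⟨$⟩ʳ i) Fin.≟ lookup a i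

-- After the transposition of 0 and its image, 0 is a fixed point and can be removed. Every
-- permutation is thereby a splice, which permits induction along splicing.
unsplice : ∀ {n} → Permutation′ (suc n) → Permutation′ n
unsplice w = Perm.remove Fin.zero (w ∘ₚ Perm.transpose (w ⟨$⟩ʳ Fin.zero) Fin.zero)

splice-unsplice : ∀ {n} (w : Permutation′ (suc n)) → splice (w ⟨$⟩ʳ Fin.zero) (unsplice w) Perm.≈ w
splice-unsplice w i = ≡.trans
  (≡.cong (PC.transpose Fin.zero j) (Perm.lift₀-remove (w ∘ₚ Perm.transpose j Fin.zero) fixes i))
  (PC.transpose-inverse Fin.zero j)
  where
  j = w ⟨$⟩ʳ Fin.zero
  fixes : PC.transpose j Fin.zero j ≡ Fin.zero
  fixes rewrite dec-true (j Fin.≟ j) ≡.refl = ≡.refl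

module _ (m : ℕ) {X : Set} where
  private
    module ≈ = SetoidReasoning (setoid {X})
    letters = allFin m
    y : ℕ → Poly X
    y _ = con (fromℕ m)

  fixedWords : ∀ {n} → Permutation′ n → Poly X
  fixedWords {n} w = ∑[ a ∈ words letters n ] 𝟙 (does (fixed? w a))

  fixedWords-resp : ∀ {n} → Respects (fixedWords {n})
  fixedWords-resp {n} {π} {ρ} e = ∑-cong (words letters n) λ a → RX.reflexive (≡.cong 𝟙 (does-⇔ (mk⇔
    (λ f i → ≡.trans (≡.cong (lookup a) (≡.sym (e i))) (f i))
    (λ f i → ≡.trans (≡.cong (lookup a) (e i)) (f i))) (fixed? π a) (fixed? ρ a)))

  fixedWords-suc : ∀ {n} (w : Permutation′ (suc n)) →
                   fixedWords w ≈ ∑[ a ∈ words letters n ] (sum λ x → 𝟙 (does (fixed? w (x ∷ a))))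
  fixedWords-suc {n} w = ≈-trans (∑-cartesianProductWith _∷_ letters (words letters n) (λ a → 𝟙 (does (fixed? w a))))
    (≈-trans (RX.reflexive (∑-allFin (λ x → ∑[ a ∈ words letters n ] 𝟙 (does (fixed? w (x ∷ a))))))
      (sum-∑-comm (words letters n) (λ x a → 𝟙 (does (fixed? w (x ∷ a))))))

  fixedWords-splice-zero : ∀ {n} (π : Permutation′ n) → fixedWords (splice Fin.zero π) ≈ con (fromℕ m) * fixedWords π
  fixedWords-splice-zero {n} π = ≈-trans (fixedWords-suc (splice Fin.zero π)) (≈-trans
    (∑-cong (words letters n) λ a → ≈-trans
      (sum-cong λ x → RX.reflexive (≡.cong 𝟙
          (does-⇔ (mk⇔ (λ f i → f (Fin.suc i)) (λ { f Fin.zero → ≡.refl ; f (Fin.suc i) → f i }))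
        (fixed? (splice Fin.zero π) (x ∷ a)) (fixed? π a))))
      (sum-constant m (𝟙 (does (fixed? π a)))))
    (≈-sym (∑-distribˡ (con (fromℕ m)) (words letters n) (λ a → 𝟙 (does (fixed? π a))))))

  fixed-splice-suc : ∀ {n} (π : Permutation′ n) j x (a : Vec (Fin m) n) →
                     Fixed (splice (Fin.suc j) π) (x ∷ a) ⇔ (Fixed π a × x ≡ lookup a j)
  fixed-splice-suc π j x a = mk⇔ (λ f → to f , ≡.sym (f Fin.zero)) from
    where
    to : Fixed (splice (Fin.suc j) π) (x ∷ a) → Fixed π a
    to f i = go (f (Fin.suc i))
      where
      go : lookup (x ∷ a) (splice (Fin.suc j) π ⟨$⟩ʳ Fin.suc i) ≡ lookup a i → lookup a (π ⟨$⟩ʳ i) ≡ lookup a i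
      go q with (π ⟨$⟩ʳ i) Fin.≟ j
      ... | yes e = ≡.trans (≡.cong (lookup a) e) (≡.trans (f Fin.zero) q)
      ... | no  _ = q
    from : Fixed π a × x ≡ lookup a j → Fixed (splice (Fin.suc j) π) (x ∷ a)
    from (f , e) Fin.zero    = ≡.sym e
    from (f , e) (Fin.suc i) with (π ⟨$⟩ʳ i) Fin.≟ j
    ... | yes e′ = ≡.trans e (≡.trans (≡.cong (lookup a) (≡.sym e′)) (f i))
    ... | no  _  = f i

  fixedWords-splice-suc : ∀ {n} (π : Permutation′ n) j → fixedWords (splice (Fin.suc j) π) ≈ fixedWords π
  fixedWords-splice-suc {n} π j = ≈-trans (fixedWords-suc (splice (Fin.suc j) π)) (∑-cong (words letters n) λ a → ≈-trans
    (sum-cong λ x → RX.reflexive (≡.cong 𝟙 (does-⇔ (fixed-splice-suc π j x a)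
      (fixed? (splice (Fin.suc j) π) (x ∷ a)) (fixed? π a ×-dec (x Fin.≟ lookup a j)))))
    (choose a (fixed? π a)))
    where
    open Sum (CommutativeRing.semiring (polyRing X)) using (sum-replicate-zero)
    choose : ∀ a (f? : Dec (Fixed π a)) → sum {X} (λ x → 𝟙 (does f? ∧ does (x Fin.≟ lookup a j))) ≈ 𝟙 (does f?)
    choose a (no _)  = sum-replicate-zero m
    choose a (yes _) = sum-unique (λ x → does (x Fin.≟ lookup a j)) (lookup a j) (con 1ℚ)
      (dec-true (lookup a j Fin.≟ lookup a j) ≡.refl) (λ x → equal (x Fin.≟ lookup a j))
      where
      equal : ∀ {x} (x≟ : Dec (x ≡ lookup a j)) → does x≟ ≡ true → x ≡ lookup a j
      equal (yes e) _ = e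

  -- Splicing in a new fixed point adds a free letter, hence a factor m. A point spliced in front of
  -- j must carry the letter of j, which changes neither the number of fixed words nor the number of
  -- cycles.
  fixedWords-cycleWeight : ∀ {n} (w : Permutation′ n) → fixedWords w ≈ cycleWeight y w
  fixedWords-cycleWeight {zero}  w = ≈-trans (RX.+-identityʳ _)
    (RX.reflexive (≡.cong 𝟙 (dec-true (fixed? {m = m} w []) λ ())))
  fixedWords-cycleWeight {suc n} w = ≈-trans
    (fixedWords-resp {π = w} {splice j π} (λ i → ≡.sym (splice-unsplice w i)))
    (≈-trans (step j) (cycleWeight-resp y {π = splice j π} {w} (splice-unsplice w)))
    where
    j = w ⟨$⟩ʳ Fin.zero
    π = unsplice w
    step : ∀ j → fixedWords (splice j π) ≈ cycleWeight y (splice j π)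
    step Fin.zero    = ≈-trans (fixedWords-splice-zero π) (≈-trans (*-congˡ (fixedWords-cycleWeight π))
        (≈-sym (cycleWeight-splice-zero π y)))
    step (Fin.suc j) = ≈-trans (fixedWords-splice-suc π j) (≈-trans (fixedWords-cycleWeight π)
      (≈-trans (cycleWeight-split y π j) (≈-sym (cycleWeight-splice-suc π j y))))

∏-* : ∀ {X A : Set} (xs : List A) (f g : A → Poly X) → ∏[ a ∈ xs ] (f a * g a) ≈ (∏[ a ∈ xs ] f a) * (∏[ a ∈ xs ] g a)
∏-* []       f g = ≈-sym (*-identityˡ _)
∏-* {X} (x ∷ xs) f g = ≈-trans (*-congˡ (∏-* xs f g))
  (PS.solve 4 (λ a b c d → (a PS.:* b) PS.:* (c PS.:* d) PS.:= (a PS.:* c) PS.:* (b PS.:* d)) ≈-refl (f x) (g x)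
      (productOver xs f) (productOver xs g))
  where module PS = Solver {X}

-- Parking functions

#≤ : List ℕ → ℕ → ℕ
#≤ s i = length (filter (ℕ._≤? i) s)

#≤-∷ : ∀ x s i → #≤ (x ∷ s) i ≡ (if does (x ℕ.≤? i) then 1 else 0) ℕ.+ #≤ s i
#≤-∷ x s i with does (x ℕ.≤? i)
... | true  = ≡.refl
... | false = ≡.refl

#≤-∷-yes : ∀ {x i} s → x ≤ i → #≤ (x ∷ s) i ≡ suc (#≤ s i)
#≤-∷-yes {x} {i} s x≤i = ≡.trans (#≤-∷ x s i) (≡.cong (λ b → (if b then 1 else 0) ℕ.+ #≤ s i) (dec-true (x ℕ.≤? i) x≤i))

#≤-none : ∀ {s i} → All (i <_) s → #≤ s i ≡ 0
#≤-none []                     = ≡.refl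
#≤-none {x ∷ s} {i} (i<x ∷ a) = ≡.trans (#≤-∷ x s i)
  (≡.cong₂ (λ b k → (if b then 1 else 0) ℕ.+ k) (dec-false (x ℕ.≤? i) (ℕ.<⇒≱ i<x)) (#≤-none a))

range : ℕ → ℕ → List ℕ
range k zero    = []
range k (suc n) = suc k ∷ range (suc k) n

applyUpTo-range : ∀ n k (f : ℕ → ℕ) → (∀ i → f i ≡ suc (k ℕ.+ i)) → List.applyUpTo f n ≡ range k n
applyUpTo-range zero    k f e = ≡.refl
applyUpTo-range (suc n) k f e = ≡.cong₂ _∷_ (≡.trans (e 0) (≡.cong suc (ℕ.+-identityʳ k)))
  (applyUpTo-range n (suc k) (f ∘ suc) λ i → ≡.trans (e (suc i)) (≡.cong suc (ℕ.+-suc k i)))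

[1⋯]-range : ∀ n → [1⋯ n ] ≡ range 0 n
[1⋯]-range n = ≡.trans (List.map-upTo suc n) (applyUpTo-range n 0 suc λ _ → ≡.refl)

-- In sorted order, bᵢ ≤ i says that at least i entries are at most i. The second form ignores the
-- order and adds up over letters, as rotations require. The offset `k` supports the induction: once
-- the least entry is dropped, the bounds start one higher and the counts lose one.
pointwise-count : ∀ {s} → AllPairs _≤_ s → ∀ k → Pointwise _≤_ s (range k (length s)) ⇔ (∀ i → i ≤ length s → i ≤ #≤ s (k ℕ.+ i))
pointwise-count {[]}    []        k = mk⇔ (λ { _ .zero z≤n → z≤n }) λ _ → []
pointwise-count {x ∷ s} (x≤s ∷ sorted) k = mk⇔ forward backward
  where
  open Equivalence
  forward : Pointwise _≤_ (x ∷ s) (range k (suc (length s))) → ∀ i → i ≤ suc (length s) → i ≤ #≤ (x ∷ s) (k ℕ.+ i)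
  forward (x≤ ∷ pw) zero    _       = z≤n
  forward (x≤ ∷ pw) (suc i) (s≤s i≤) = ≡.subst (suc i ≤_) (≡.sym
      (#≤-∷-yes s (ℕ.≤-trans x≤ (≡.subst (suc k ≤_) (≡.sym (ℕ.+-suc k i)) (s≤s (ℕ.m≤m+n k i))))))
    (s≤s (≡.subst (λ j → i ≤ #≤ s j) (≡.sym (ℕ.+-suc k i)) (to (pointwise-count sorted (suc k)) pw i i≤)))
  backward : (∀ i → i ≤ suc (length s) → i ≤ #≤ (x ∷ s) (k ℕ.+ i)) → Pointwise _≤_ (x ∷ s) (range k (suc (length s)))
  backward h = x≤1+k ∷ from (pointwise-count sorted (suc k)) λ i i≤ → ℕ.≤-pred
    (≡.subst (suc i ≤_) (≡.trans (≡.cong (#≤ (x ∷ s)) (ℕ.+-suc k i)) (#≤-∷-yes s (ℕ.≤-trans x≤1+k (s≤s (ℕ.m≤m+n k i)))))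
        (h (suc i) (s≤s i≤)))
    where
    x≤1+k : x ≤ suc k
    x≤1+k with x ℕ.≤? suc k
    ... | yes x≤ = x≤
    ... | no  x≰ = contradiction
      (≡.subst (1 ≤_) (≡.trans (≡.cong (#≤ (x ∷ s)) (ℕ.+-comm k 1))
          (#≤-none {x ∷ s} (ℕ.≰⇒> x≰ ∷ All.map (ℕ.<-≤-trans (ℕ.≰⇒> x≰)) x≤s))) (h 1 (s≤s z≤n)))
      λ ()

-- Letters are shifted by one: toℕ i stands for the entry toℕ i + 1.
entries : ∀ {m n} → Vec (Fin m) n → Vec ℕ n
entries = Vec.map (suc ∘ toℕ)

below : ∀ {m n} → Vec (Fin m) n → ℕ → ℕ
below []      i = 0
below (x ∷ a) i = (if does (toℕ x ℕ.<? i) then 1 else 0) ℕ.+ below a i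

below-#≤ : ∀ {m n} (a : Vec (Fin m) n) i → #≤ (toList (entries a)) i ≡ below a i
below-#≤ []      i = ≡.refl
below-#≤ (x ∷ a) i = ≡.trans (#≤-∷ (suc (toℕ x)) (toList (entries a)) i)
    (≡.cong ((if does (toℕ x ℕ.<? i) then 1 else 0) ℕ.+_) (below-#≤ a i))

parking-below : ∀ {m n} (a : Vec (Fin m) n) → IsParkingFunction (entries a) ⇔ (∀ i → i ≤ n → i ≤ below a i)
parking-below {m} {n} a = mk⇔
  (λ (_ , pw) i i≤n → ≡.subst (i ≤_) (count-eq i) (Equivalence.to counting (≡.subst (Pointwise _≤_ (sort l)) range-eq pw) i
      (≡.subst (i ≤_) (≡.sym len) i≤n)))
  (λ h → positive a , ≡.subst (Pointwise _≤_ (sort l)) (≡.sym range-eq) (Equivalence.from counting λ i i≤ →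
    ≡.subst (i ≤_) (≡.sym (count-eq i)) (h i (≡.subst (i ≤_) len i≤))))
  where
  l = toList (entries a)
  len : length (sort l) ≡ n
  len = ≡.trans (↭-length (sort-↭ l)) (Vec.length-toList (entries a))
  range-eq : [1⋯ n ] ≡ range 0 (length (sort l))
  range-eq = ≡.trans ([1⋯]-range n) (≡.cong (range 0) (≡.sym len))
  counting = pointwise-count (Linked⇒AllPairs ℕ.≤-trans (sort-↗ l)) 0
  count-eq : ∀ i → #≤ (sort l) i ≡ below a i
  count-eq i = ≡.trans (↭-length (filter-↭ (ℕ._≤? i) (sort-↭ l))) (below-#≤ a i)
  positive : ∀ {n} (a : Vec (Fin m) n) → All (1 ≤_) (toList (entries a))
  positive []      = []
  positive (x ∷ a) = s≤s z≤n ∷ positive a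

-- Rotations of the alphabet

module Rotation {m : ℕ} where

  private
    rotateℕ : ℕ → ℕ → ℕ
    rotateℕ c x = if does (c ℕ.≤? x) then x ℕ.∸ c else x ℕ.+ (m ℕ.∸ c)

    rotateℕ-≤ : ∀ {c x} → c ≤ x → rotateℕ c x ≡ x ℕ.∸ c
    rotateℕ-≤ {c} {x} c≤x = ≡.cong (if_then x ℕ.∸ c else x ℕ.+ (m ℕ.∸ c)) (dec-true (c ℕ.≤? x) c≤x)

    rotateℕ-> : ∀ {c x} → x < c → rotateℕ c x ≡ x ℕ.+ (m ℕ.∸ c)
    rotateℕ-> {c} {x} x<c = ≡.cong (if_then x ℕ.∸ c else x ℕ.+ (m ℕ.∸ c)) (dec-false (c ℕ.≤? x) (ℕ.<⇒≱ x<c))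

    rotateℕ-< : ∀ {c x} → c ≤ m → x < m → rotateℕ c x < m
    rotateℕ-< {c} {x} c≤m x<m with c ℕ.≤? x
    ... | yes c≤x = ≡.subst (_< m) (≡.sym (rotateℕ-≤ c≤x)) (ℕ.≤-<-trans (ℕ.m∸n≤m x c) x<m)
    ... | no  c≰x = ≡.subst₂ _<_ (≡.sym (rotateℕ-> (ℕ.≰⇒> c≰x))) (ℕ.m+[n∸m]≡n c≤m) (ℕ.+-monoˡ-< (m ℕ.∸ c) (ℕ.≰⇒> c≰x))

    rotateℕ-inverse : ∀ {c x} → c ≤ m → x < m → rotateℕ (m ℕ.∸ c) (rotateℕ c x) ≡ x
    rotateℕ-inverse {c} {x} c≤m x<m with c ℕ.≤? x
    ... | yes c≤x = ≡.trans (≡.cong (rotateℕ (m ℕ.∸ c)) (rotateℕ-≤ c≤x)) (≡.trans (rotateℕ-> (ℕ.∸-monoˡ-< x<m c≤x))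
      (≡.trans (≡.cong (x ℕ.∸ c ℕ.+_) (ℕ.m∸[m∸n]≡n c≤m)) (ℕ.m∸n+n≡m c≤x)))
    ... | no  c≰x = ≡.trans (≡.cong (rotateℕ (m ℕ.∸ c)) (rotateℕ-> (ℕ.≰⇒> c≰x)))
        (≡.trans (rotateℕ-≤ (ℕ.m≤n+m (m ℕ.∸ c) x)) (ℕ.m+n∸n≡m x (m ℕ.∸ c)))

  rotate : (c : ℕ) → c ≤ m → Fin m → Fin m
  rotate c c≤m x = Fin.fromℕ< (rotateℕ-< c≤m (Fin.toℕ<n x))

  private
    toℕ-rotate : ∀ c c≤m x → toℕ (rotate c c≤m x) ≡ rotateℕ c (toℕ x)
    toℕ-rotate c c≤m x = Fin.toℕ-fromℕ< (rotateℕ-< c≤m (Fin.toℕ<n x))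

  rotate-inverse : ∀ c c≤m x → rotate (m ℕ.∸ c) (ℕ.m∸n≤m m c) (rotate c c≤m x) ≡ x
  rotate-inverse c c≤m x = Fin.toℕ-injective (≡.trans (toℕ-rotate (m ℕ.∸ c) (ℕ.m∸n≤m m c) (rotate c c≤m x))
    (≡.trans (≡.cong (rotateℕ (m ℕ.∸ c)) (toℕ-rotate c c≤m x)) (rotateℕ-inverse c≤m (Fin.toℕ<n x))))

  rotate-inverse′ : ∀ c c≤m x → rotate c c≤m (rotate (m ℕ.∸ c) (ℕ.m∸n≤m m c) x) ≡ x
  rotate-inverse′ c c≤m x = Fin.toℕ-injective (≡.trans (toℕ-rotate c c≤m (rotate (m ℕ.∸ c) (ℕ.m∸n≤m m c) x))
    (≡.trans (≡.cong₂ rotateℕ (≡.sym (ℕ.m∸[m∸n]≡n c≤m)) (toℕ-rotate (m ℕ.∸ c) (ℕ.m∸n≤m m c) x))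
        (rotateℕ-inverse (ℕ.m∸n≤m m c) (Fin.toℕ<n x))))

  rotation : (c : ℕ) → c ≤ m → Permutation′ m
  rotation c c≤m = Perm.permutation (rotate c c≤m) (rotate (m ℕ.∸ c) (ℕ.m∸n≤m m c)) (rotate-inverse′ c c≤m) (rotate-inverse c c≤m)

  private
    [_] : ∀ {A : Set} → Dec A → ℕ
    [ d ] = if does d then 1 else 0

    [yes] : ∀ {A : Set} (d : Dec A) → A → [ d ] ≡ 1
    [yes] d a = ≡.cong (if_then 1 else 0) (dec-true d a)

    [no] : ∀ {A : Set} (d : Dec A) → ¬ A → [ d ] ≡ 0
    [no] d ¬a = ≡.cong (if_then 1 else 0) (dec-false d ¬a)

    [⇔] : ∀ {A B : Set} → A ⇔ B → (d : Dec A) (e : Dec B) → [ d ] ≡ [ e ]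
    [⇔] h d e = ≡.cong (if_then 1 else 0) (does-⇔ h d e)

    -- A rotated letter lies below i exactly if the letter lies in the cyclic interval of length i
    -- starting at c. As long as this interval does not wrap around, it is the difference of the
    -- segments below i + c and below c.
    letter-low : ∀ {c i} x → i ℕ.+ c ≤ m → [ rotateℕ c x ℕ.<? i ] ℕ.+ [ x ℕ.<? c ] ≡ [ x ℕ.<? i ℕ.+ c ]
    letter-low {c} {i} x i+c≤m with x ℕ.<? c
    ... | yes x<c = ≡.trans
      (≡.cong₂ ℕ._+_ ([no] (rotateℕ c x ℕ.<? i) (ℕ.≤⇒≯ (≡.subst (i ≤_) (≡.sym (rotateℕ-> x<c))
        (ℕ.≤-trans (ℕ.m+n≤o⇒m≤o∸n i i+c≤m) (ℕ.m≤n+m (m ℕ.∸ c) x))))) ([yes] (x ℕ.<? c) x<c))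
      (≡.sym ([yes] (x ℕ.<? i ℕ.+ c) (ℕ.<-≤-trans x<c (ℕ.m≤n+m c i))))
    ... | no  x≮c = ≡.trans (≡.cong₂ ℕ._+_ ([⇔] equiv (rotateℕ c x ℕ.<? i) (x ℕ.<? i ℕ.+ c)) ([no] (x ℕ.<? c) x≮c))
        (ℕ.+-identityʳ _)
      where
      c≤x = ℕ.≮⇒≥ x≮c
      equiv : rotateℕ c x < i ⇔ x < i ℕ.+ c
      equiv = mk⇔
        (λ l → ≡.subst (_< i ℕ.+ c) (ℕ.m∸n+n≡m c≤x) (ℕ.+-monoˡ-< c (≡.subst (_< i) (rotateℕ-≤ c≤x) l)))
        (λ l → ≡.subst (_< i) (≡.sym (rotateℕ-≤ c≤x)) (≡.subst (x ℕ.∸ c <_) (ℕ.m+n∸n≡m i c) (ℕ.∸-monoˡ-< l c≤x)))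

    letter-high : ∀ {c i} x → c ≤ m → i ≤ m → m ≤ i ℕ.+ c → x < m →
                  [ rotateℕ c x ℕ.<? i ] ℕ.+ [ x ℕ.<? c ] ≡ 1 ℕ.+ [ x ℕ.<? i ℕ.+ c ℕ.∸ m ]
    letter-high {c} {i} x c≤m i≤m m≤i+c x<m with x ℕ.<? c
    ... | yes x<c = ≡.trans (≡.cong₂ ℕ._+_ ([⇔] equiv (rotateℕ c x ℕ.<? i) (x ℕ.<? i ℕ.+ c ℕ.∸ m)) ([yes] (x ℕ.<? c) x<c))
        (ℕ.+-comm _ 1)
      where
      shifted : x ℕ.+ (m ℕ.∸ c) ℕ.+ c ≡ x ℕ.+ m
      shifted = ≡.trans (ℕ.+-assoc x (m ℕ.∸ c) c) (≡.cong (x ℕ.+_) (ℕ.m∸n+n≡m c≤m))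
      equiv : rotateℕ c x < i ⇔ x < i ℕ.+ c ℕ.∸ m
      equiv = mk⇔
        (λ l → ℕ.m+n≤o⇒m≤o∸n (suc x) (≡.subst (_< i ℕ.+ c) shifted (ℕ.+-monoˡ-< c (≡.subst (_< i) (rotateℕ-> x<c) l))))
        (λ l → ≡.subst (_< i) (≡.sym (rotateℕ-> x<c)) (ℕ.+-cancelʳ-< c _ _
            (≡.subst₂ _<_ (≡.sym shifted) (ℕ.m∸n+n≡m m≤i+c) (ℕ.+-monoˡ-< m l))))
    ... | no  x≮c = ≡.trans (≡.cong₂ ℕ._+_ ([yes] (rotateℕ c x ℕ.<? i) small) ([no] (x ℕ.<? c) x≮c))
      (≡.cong suc (≡.sym ([no] (x ℕ.<? i ℕ.+ c ℕ.∸ m) (ℕ.≤⇒≯ (ℕ.≤-trans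
        (≡.subst (i ℕ.+ c ℕ.∸ m ≤_) (ℕ.m+n∸m≡n m c) (ℕ.∸-monoˡ-≤ m (ℕ.+-monoˡ-≤ c i≤m))) c≤x)))))
      where
      c≤x = ℕ.≮⇒≥ x≮c
      small : rotateℕ c x < i
      small = ≡.subst (_< i) (≡.sym (rotateℕ-≤ c≤x)) (≡.subst (x ℕ.∸ c <_) (ℕ.m+n∸n≡m i c)
          (ℕ.∸-monoˡ-< (ℕ.<-≤-trans x<m m≤i+c) c≤x))

    interchange : ∀ a b c d → (a ℕ.+ b) ℕ.+ (c ℕ.+ d) ≡ (a ℕ.+ c) ℕ.+ (b ℕ.+ d)
    interchange = solve-∀

  below-rotate-low : ∀ {n c} c≤m {i} (a : Vec (Fin m) n) → i ℕ.+ c ≤ m →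
                     below (Vec.map (rotate c c≤m) a) i ℕ.+ below a c ≡ below a (i ℕ.+ c)
  below-rotate-low c≤m []      _ = ≡.refl
  below-rotate-low {c = c} c≤m {i} (x ∷ a) l = ≡.trans
    (interchange [ toℕ (rotate c c≤m x) ℕ.<? i ] (below (Vec.map (rotate c c≤m) a) i) [ toℕ x ℕ.<? c ] (below a c))
    (≡.cong₂ ℕ._+_ (≡.trans (≡.cong (λ y → [ y ℕ.<? i ] ℕ.+ [ toℕ x ℕ.<? c ]) (toℕ-rotate c c≤m x))
        (letter-low {c} {i} (toℕ x) l))
      (below-rotate-low c≤m a l))

  -- Once the interval wraps, it consists of everything from c upwards and the lowest i + c - m
  -- values. With the letters below c added on the left, every letter is counted once and the lowest
  -- ones once more.
  below-rotate-high : ∀ {n c} c≤m {i} (a : Vec (Fin m) n) → i ≤ m → m ≤ i ℕ.+ c →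
                      below (Vec.map (rotate c c≤m) a) i ℕ.+ below a c ≡ n ℕ.+ below a (i ℕ.+ c ℕ.∸ m)
  below-rotate-high c≤m []      _ _ = ≡.refl
  below-rotate-high {suc n} {c} c≤m {i} (x ∷ a) i≤m l = ≡.trans
    (interchange [ toℕ (rotate c c≤m x) ℕ.<? i ] (below (Vec.map (rotate c c≤m) a) i) [ toℕ x ℕ.<? c ] (below a c))
    (≡.trans (≡.cong₂ ℕ._+_ (≡.trans (≡.cong (λ y → [ y ℕ.<? i ] ℕ.+ [ toℕ x ℕ.<? c ]) (toℕ-rotate c c≤m x))
        (letter-high (toℕ x) c≤m i≤m l (Fin.toℕ<n x)))
      (below-rotate-high c≤m a i≤m l))
      (interchange 1 [ toℕ x ℕ.<? i ℕ.+ c ℕ.∸ m ] n (below a (i ℕ.+ c ℕ.∸ m))))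

open Rotation using (rotate; rotation; below-rotate-low; below-rotate-high)

-- c is the first place where T y - y attains its minimum (both sides are moved
-- so that no subtraction occurs).
FirstMinimum : ∀ {n} → (ℕ → ℕ) → Fin (suc n) → Set
FirstMinimum {n} T c =
  (∀ y → toℕ c ≤ y → y ≤ n → T (toℕ c) ℕ.+ y ≤ T y ℕ.+ toℕ c) × (∀ y → y < toℕ c → T (toℕ c) ℕ.+ y < T y ℕ.+ toℕ c)

-- The cycle lemma: rotating by c turns T into i ↦ T (c + i) - T c, where T
-- is continued by T (y + n + 1) = T y + n.
parking-rotate : ∀ {n} (a : Vec (Fin (suc n)) n) (c : Fin (suc n)) →
                 (∀ i → i ≤ n → i ≤ below (Vec.map (rotate (toℕ c) (ℕ.<⇒≤ (Fin.toℕ<n c))) a) i) ⇔ FirstMinimum {n} (below a) c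
parking-rotate {n} a c = mk⇔ (λ h → low h , high h) from
  where
  k = toℕ c
  k≤1+n = ℕ.<⇒≤ (Fin.toℕ<n c)
  T = below a
  R = below (Vec.map (rotate k k≤1+n) a)
  low : (∀ i → i ≤ n → i ≤ R i) → ∀ y → k ≤ y → y ≤ n → T k ℕ.+ y ≤ T y ℕ.+ k
  low h y k≤y y≤n = begin
    T k ℕ.+ y                     ≡⟨ ≡.cong (T k ℕ.+_) (ℕ.m∸n+n≡m k≤y) ⟨
    T k ℕ.+ (i ℕ.+ k)             ≡⟨ ℕ.+-assoc (T k) i k ⟨
    T k ℕ.+ i ℕ.+ k               ≤⟨ ℕ.+-monoˡ-≤ k (ℕ.+-monoʳ-≤ (T k) (h i (ℕ.≤-trans (ℕ.m∸n≤m y k) y≤n))) ⟩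
    T k ℕ.+ R i ℕ.+ k             ≡⟨ ≡.cong (ℕ._+ k) (≡.trans (ℕ.+-comm (T k) (R i))
        (≡.trans (below-rotate-low k≤1+n a (≡.subst (_≤ suc n) (≡.sym (ℕ.m∸n+n≡m k≤y)) (ℕ.m≤n⇒m≤1+n y≤n)))
        (≡.cong T (ℕ.m∸n+n≡m k≤y)))) ⟩
    T y ℕ.+ k                     ∎
    where
    open ℕ.≤-Reasoning
    i = y ℕ.∸ k
  -- Wrapping around adds n + 1 to the position but only n to the count. The surplus 1 makes the
  -- inequality strict and so singles out the first of several minima.
  high : (∀ i → i ≤ n → i ≤ R i) → ∀ y → y < k → T k ℕ.+ y < T y ℕ.+ k
  high h y y<k = ℕ.+-cancelˡ-≤ n _ _ (begin
    n ℕ.+ suc (T k ℕ.+ y)         ≡⟨ arrange n (T k) y ⟩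
    T k ℕ.+ (y ℕ.+ suc n)         ≡⟨ ≡.cong (T k ℕ.+_) i+k ⟨
    T k ℕ.+ (i ℕ.+ k)             ≡⟨ ℕ.+-assoc (T k) i k ⟨
    T k ℕ.+ i ℕ.+ k               ≤⟨ ℕ.+-monoˡ-≤ k (ℕ.+-monoʳ-≤ (T k) (h i i≤n)) ⟩
    T k ℕ.+ R i ℕ.+ k             ≡⟨ ≡.cong (ℕ._+ k) (≡.trans (ℕ.+-comm (T k) (R i))
        (≡.trans (below-rotate-high k≤1+n a (ℕ.m≤n⇒m≤1+n i≤n) (≡.subst (suc n ≤_) (≡.sym i+k) (ℕ.m≤n+m (suc n) y)))
        (≡.cong (λ j → n ℕ.+ T j) (≡.trans (≡.cong (ℕ._∸ suc n) i+k) (ℕ.m+n∸n≡m y (suc n)))))) ⟩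
    n ℕ.+ T y ℕ.+ k               ≡⟨ ℕ.+-assoc n (T y) k ⟩
    n ℕ.+ (T y ℕ.+ k)             ∎)
    where
    open ℕ.≤-Reasoning
    arrange : ∀ n t y → n ℕ.+ suc (t ℕ.+ y) ≡ t ℕ.+ (y ℕ.+ suc n)
    arrange = solve-∀
    i = y ℕ.+ suc n ℕ.∸ k
    i+k : i ℕ.+ k ≡ y ℕ.+ suc n
    i+k = ℕ.m∸n+n≡m (ℕ.≤-trans k≤1+n (ℕ.m≤n+m (suc n) y))
    i≤n : i ≤ n
    i≤n = ℕ.+-cancelʳ-≤ k i n (≡.subst₂ _≤_ (≡.trans (≡.sym (ℕ.+-suc y n)) (≡.sym i+k)) (ℕ.+-comm k n) (ℕ.+-monoˡ-≤ n y<k))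
  from : FirstMinimum {n} T c → ∀ i → i ≤ n → i ≤ R i
  from (lo , hi) i i≤n with i ℕ.+ k ℕ.≤? n
  ... | yes i+k≤n = ℕ.+-cancelʳ-≤ (T k) _ _ (ℕ.+-cancelʳ-≤ k _ _ (begin
    i ℕ.+ T k ℕ.+ k               ≡⟨ arrange i (T k) k ⟩
    T k ℕ.+ (i ℕ.+ k)             ≤⟨ lo (i ℕ.+ k) (ℕ.m≤n+m k i) i+k≤n ⟩
    T (i ℕ.+ k) ℕ.+ k             ≡⟨ ≡.cong (ℕ._+ k) (below-rotate-low k≤1+n a (ℕ.m≤n⇒m≤1+n i+k≤n)) ⟨
    R i ℕ.+ T k ℕ.+ k             ∎))
    where
    open ℕ.≤-Reasoning
    arrange : ∀ i t k → i ℕ.+ t ℕ.+ k ≡ t ℕ.+ (i ℕ.+ k)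
    arrange = solve-∀
  ... | no  i+k≰n = ℕ.+-cancelʳ-≤ (T k) _ _ (ℕ.+-cancelʳ-≤ k _ _ (begin
    i ℕ.+ T k ℕ.+ k               ≡⟨ arrange₁ i (T k) k ⟩
    T k ℕ.+ (i ℕ.+ k)             ≡⟨ ≡.cong (T k ℕ.+_) (ℕ.m∸n+n≡m n<i+k) ⟨
    T k ℕ.+ (y ℕ.+ suc n)         ≡⟨ arrange₂ n (T k) y ⟨
    n ℕ.+ suc (T k ℕ.+ y)         ≤⟨ ℕ.+-monoʳ-≤ n (hi y y<k) ⟩
    n ℕ.+ (T y ℕ.+ k)             ≡⟨ ℕ.+-assoc n (T y) k ⟨
    n ℕ.+ T y ℕ.+ k               ≡⟨ ≡.cong (ℕ._+ k) (below-rotate-high k≤1+n a (ℕ.m≤n⇒m≤1+n i≤n) n<i+k) ⟨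
    R i ℕ.+ T k ℕ.+ k             ∎))
    where
    open ℕ.≤-Reasoning
    arrange₁ : ∀ i t k → i ℕ.+ t ℕ.+ k ≡ t ℕ.+ (i ℕ.+ k)
    arrange₁ = solve-∀
    arrange₂ : ∀ n t y → n ℕ.+ suc (t ℕ.+ y) ≡ t ℕ.+ (y ℕ.+ suc n)
    arrange₂ = solve-∀
    n<i+k = ℕ.≰⇒> i+k≰n
    y = i ℕ.+ k ℕ.∸ suc n
    y<k : y < k
    y<k = ≡.subst (y <_) (ℕ.m+n∸m≡n (suc n) k) (ℕ.∸-monoˡ-< (ℕ.+-monoˡ-< k (s≤s i≤n)) n<i+k)

firstArgmin : ∀ {n} (f : Fin (suc n) → ℕ) → ∃ λ c → (∀ y → f c ≤ f y) × (∀ y → y Fin.< c → f c < f y)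
firstArgmin {zero}  f = Fin.zero , (λ { Fin.zero → ℕ.≤-refl }) , λ _ ()
firstArgmin {suc n} f with c , c≤ , c< ← firstArgmin (f ∘ Fin.suc) with f Fin.zero ℕ.≤? f (Fin.suc c)
... | yes l = Fin.zero , (λ { Fin.zero → ℕ.≤-refl ; (Fin.suc y) → ℕ.≤-trans l (c≤ y) }) , λ _ ()
... | no ¬l = Fin.suc c , (λ { Fin.zero → ℕ.<⇒≤ (ℕ.≰⇒> ¬l) ; (Fin.suc y) → c≤ y })
            , λ { Fin.zero _ → ℕ.≰⇒> ¬l ; (Fin.suc y) (s≤s y<c) → c< y y<c }

firstMinimum : ∀ {n} (T : ℕ → ℕ) → ∃ λ c → FirstMinimum {n} T c × (∀ d → FirstMinimum {n} T d → d ≡ c)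
firstMinimum {n} T = c , isMin , unique
  where
  f : Fin (suc n) → ℕ
  -- This is T y - y raised by the constant n, so that its values stay in ℕ.
  f y = T (toℕ y) ℕ.+ (n ℕ.∸ toℕ y)
  argmin = firstArgmin f
  c = proj₁ argmin
  rearrange : ∀ x → x ≤ n → ∀ y → T x ℕ.+ (n ℕ.∸ x) ℕ.+ (y ℕ.+ x) ≡ T x ℕ.+ y ℕ.+ n
  rearrange x x≤n y = ≡.trans (reorder (T x) (n ℕ.∸ x) y x) (≡.cong (T x ℕ.+ y ℕ.+_) (ℕ.m∸n+n≡m x≤n))
    where
    reorder : ∀ t d y x → t ℕ.+ d ℕ.+ (y ℕ.+ x) ≡ t ℕ.+ y ℕ.+ (d ℕ.+ x)
    reorder = solve-∀
  c≤n = ℕ.≤-pred (Fin.toℕ<n c)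
  isMin : FirstMinimum {n} T c
  isMin = lo , hi
    where
    at : ∀ y (y<1+n : y < suc n) → f (Fin.fromℕ< y<1+n) ≡ T y ℕ.+ (n ℕ.∸ y)
    at y y<1+n = ≡.cong (λ y → T y ℕ.+ (n ℕ.∸ y)) (Fin.toℕ-fromℕ< y<1+n)
    lo : ∀ y → toℕ c ≤ y → y ≤ n → T (toℕ c) ℕ.+ y ≤ T y ℕ.+ toℕ c
    lo y _ y≤n = ℕ.+-cancelʳ-≤ n _ _ (≡.subst₂ _≤_ (rearrange (toℕ c) c≤n y)
      (≡.trans (≡.cong (T y ℕ.+ (n ℕ.∸ y) ℕ.+_) (ℕ.+-comm y (toℕ c))) (rearrange y y≤n (toℕ c)))
      (ℕ.+-monoˡ-≤ (y ℕ.+ toℕ c) (≡.subst (f c ≤_) (at y (s≤s y≤n)) (proj₁ (proj₂ argmin) (Fin.fromℕ< (s≤s y≤n))))))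
    hi : ∀ y → y < toℕ c → T (toℕ c) ℕ.+ y < T y ℕ.+ toℕ c
    hi y y<c = ℕ.+-cancelʳ-< n _ _ (≡.subst₂ _<_ (rearrange (toℕ c) c≤n y)
      (≡.trans (≡.cong (T y ℕ.+ (n ℕ.∸ y) ℕ.+_) (ℕ.+-comm y (toℕ c))) (rearrange y y≤n (toℕ c)))
      (ℕ.+-monoˡ-< (y ℕ.+ toℕ c) (≡.subst (f c <_) (at y (s≤s y≤n))
          (proj₂ (proj₂ argmin) (Fin.fromℕ< (s≤s y≤n)) (≡.subst (_< toℕ c) (≡.sym (Fin.toℕ-fromℕ< (s≤s y≤n))) y<c)))))
      where y≤n = ℕ.≤-trans (ℕ.<⇒≤ y<c) c≤n
  exclude : ∀ {d e} → FirstMinimum {n} T d → FirstMinimum {n} T e → ¬ toℕ d < toℕ e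
  exclude {d} {e} (lo , _) (_ , hi) d<e = ℕ.<-irrefl ≡.refl (ℕ.<-≤-trans (hi (toℕ d) d<e)
      (lo (toℕ e) (ℕ.<⇒≤ d<e) (ℕ.≤-pred (Fin.toℕ<n e))))
  unique : ∀ d → FirstMinimum {n} T d → d ≡ c
  unique d dMin with ℕ.<-cmp (toℕ d) (toℕ c)
  ... | tri< d<c _ _ = contradiction d<c (exclude {d} {c} dMin isMin)
  ... | tri≈ _ d≡c _ = Fin.toℕ-injective d≡c
  ... | tri> _ _ c<d = contradiction c<d (exclude {c} {d} isMin dMin)

range-≤ : ∀ {s} k n → Pointwise _≤_ s (range k n) → All (_≤ k ℕ.+ n) s
range-≤ k zero    []       = []
range-≤ k (suc n) (x≤ ∷ pw) = ℕ.≤-trans x≤ (≡.subst (suc k ≤_) (≡.sym (ℕ.+-suc k n)) (s≤s (ℕ.m≤m+n k n)))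
  ∷ All.map (λ {x} → ≡.subst (x ≤_) (≡.sym (ℕ.+-suc k n))) (range-≤ (suc k) n pw)

parking-≤ : ∀ {n} {a : Vec ℕ n} → IsParkingFunction a → All (_≤ n) (toList a)
parking-≤ {n} {a} (_ , pw) = All-resp-↭ (sort-↭ (toList a)) (range-≤ 0 n (≡.subst (Pointwise _≤_ _) ([1⋯]-range n) pw))

-- Sums over words, and the character of the parking representation

module _ {X : Set} where
  private
    module R = CommutativeRing (polyRing X)
    module ≈ = SetoidReasoning (setoid {X})
  open Sum R.semiring using (sum-replicate-zero; ∑-permute)

  ∑-filter : ∀ {A : Set} {Q : A → Set} (Q? : Decidable Q) (xs : List A) (F : A → Poly X) →
             ∑[ a ∈ filter Q? xs ] F a ≈ ∑[ a ∈ xs ] (if does (Q? a) then F a else con 0ℚ)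
  ∑-filter Q? []       F = ≈-refl
  ∑-filter Q? (x ∷ xs) F with does (Q? x)
  ... | true  = +-congˡ (∑-filter Q? xs F)
  ... | false = ≈-trans (∑-filter Q? xs F) (≈-sym (+-identityˡ _))

  ∑-words-suc : ∀ {A : Set} (as : List A) n (F : Vec A (suc n) → Poly X) →
                ∑[ a ∈ words as (suc n) ] F a ≈ ∑[ x ∈ as ] (∑[ a ∈ words as n ] F (x ∷ a))
  ∑-words-suc as n F = ∑-cartesianProductWith _∷_ as (words as n) F

  ∑-words-map : ∀ {A B : Set} (h : A → B) (as : List A) n (F : Vec B n → Poly X) →
                ∑[ b ∈ words (map h as) n ] F b ≈ ∑[ a ∈ words as n ] F (Vec.map h a)
  ∑-words-map h as zero    F = ≈-refl
  ∑-words-map h as (suc n) F = ≈-trans (∑-words-suc (map h as) n F) (≈-trans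
    (R.reflexive (∑-map h as (λ x → ∑[ b ∈ words (map h as) n ] F (x ∷ b))))
    (≈-trans (∑-cong as λ x → ∑-words-map h as n (λ b → F (h x ∷ b))) (≈-sym (∑-words-suc as n (F ∘ Vec.map h)))))

  -- Parking functions are listed over the letters 1, ..., n, whereas the rotations act on n + 1
  -- letters. Words that use the additional letter contribute nothing, because the summand vanishes
  -- on them.
  ∑-words-∷ʳ : ∀ {A : Set} {Q : A → Set} (as : List A) z → ¬ Q z → ∀ n (F : Vec A n → Poly X) →
               (∀ a → ¬ All Q (toList a) → F a ≈ con 0ℚ) →
               ∑[ a ∈ words (as List.++ List.[ z ]) n ] F a ≈ ∑[ a ∈ words as n ] F a
  ∑-words-∷ʳ as z ¬Qz zero    F F≈0 = ≈-refl
  ∑-words-∷ʳ as z ¬Qz (suc n) F F≈0 = begin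
    ∑[ a ∈ words as⁺ (suc n) ] F a                     ≈⟨ ∑-words-suc as⁺ n F ⟩
    ∑[ x ∈ as⁺ ] S x                                   ≈⟨ ∑-++ as List.[ z ] S ⟩
    ∑[ x ∈ as ] S x + (S z + con 0ℚ)                   ≈⟨ +-congˡ
        (≈-trans (+-identityʳ (S z)) (≈-trans (∑-cong (words as⁺ n) λ a → F≈0 (z ∷ a) λ { (q ∷ _) → ¬Qz q })
        (∑-zero (words as⁺ n)))) ⟩
    ∑[ x ∈ as ] S x + con 0ℚ                           ≈⟨ +-identityʳ _ ⟩
    ∑[ x ∈ as ] S x                                    ≈⟨ ∑-cong as
        (λ x → ∑-words-∷ʳ as z ¬Qz n (λ a → F (x ∷ a)) λ a ¬Qa → F≈0 (x ∷ a) λ { (_ ∷ q) → ¬Qa q }) ⟩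
    ∑[ x ∈ as ] (∑[ a ∈ words as n ] F (x ∷ a))        ≈⟨ ∑-words-suc as n F ⟨
    ∑[ a ∈ words as (suc n) ] F a                      ∎
    where
    open ≈
    as⁺ = as List.++ List.[ z ]
    S = λ x → ∑[ a ∈ words as⁺ n ] F (x ∷ a)

  ∑-words-permute : ∀ {m} (ρ : Permutation′ m) n (F : Vec (Fin m) n → Poly X) →
                    ∑[ a ∈ words (allFin m) n ] F a ≈ ∑[ a ∈ words (allFin m) n ] F (Vec.map (ρ ⟨$⟩ʳ_) a)
  ∑-words-permute     ρ zero    F = ≈-refl
  ∑-words-permute {m} ρ (suc n) F = begin
    ∑[ a ∈ words (allFin m) (suc n) ] F a                          ≈⟨ ∑-words-suc (allFin m) n F ⟩
    ∑[ x ∈ allFin m ] (∑[ a ∈ words (allFin m) n ] F (x ∷ a))      ≡⟨ ∑-allFin (λ x → ∑[ a ∈ words (allFin m) n ] F (x ∷ a)) ⟩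
    sum (λ x → ∑[ a ∈ words (allFin m) n ] F (x ∷ a))              ≈⟨ ∑-permute (λ x → ∑[ a ∈ words (allFin m) n ] F (x ∷ a)) ρ ⟩
    sum (λ x → ∑[ a ∈ words (allFin m) n ] F ((ρ ⟨$⟩ʳ x) ∷ a))     ≈⟨ sum-cong
        (λ x → ∑-words-permute ρ n (λ a → F ((ρ ⟨$⟩ʳ x) ∷ a))) ⟩
    sum (λ x → ∑[ a ∈ words (allFin m) n ] F′ (x ∷ a))             ≡⟨ ∑-allFin (λ x → ∑[ a ∈ words (allFin m) n ] F′ (x ∷ a)) ⟨
    ∑[ x ∈ allFin m ] (∑[ a ∈ words (allFin m) n ] F′ (x ∷ a))     ≈⟨ ∑-words-suc (allFin m) n F′ ⟨
    ∑[ a ∈ words (allFin m) (suc n) ] F′ a                         ∎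
    where
    open ≈
    F′ = F ∘ Vec.map (ρ ⟨$⟩ʳ_)

  ∑-parkingFunctions : ∀ n (F : Vec ℕ n → Poly X) →
    ∑[ a ∈ parkingFunctions n ] F a ≈
    ∑[ a ∈ words (allFin (suc n)) n ] (if does (isParkingFunction? (entries a)) then F (entries a) else con 0ℚ)
  ∑-parkingFunctions n F = begin
    ∑[ a ∈ parkingFunctions n ] F a                    ≈⟨ ∑-filter isParkingFunction? (words [1⋯ n ] n) F ⟩
    ∑[ a ∈ words [1⋯ n ] n ] G a                       ≈⟨ ∑-words-∷ʳ [1⋯ n ] (suc n) ℕ.1+n≰n n G vanish ⟨
    ∑[ a ∈ words ([1⋯ n ] List.++ List.[ suc n ]) n ] G a ≡⟨ ≡.cong (λ as → ∑[ a ∈ words as n ] G a) alphabet ⟩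
    ∑[ a ∈ words (map (suc ∘ toℕ) (allFin (suc n))) n ] G a ≈⟨ ∑-words-map (suc ∘ toℕ) (allFin (suc n)) n G ⟩
    ∑[ a ∈ words (allFin (suc n)) n ] G (entries a)    ∎
    where
    open ≈
    G : Vec ℕ n → Poly X
    G a = if does (isParkingFunction? a) then F a else con 0ℚ
    vanish : ∀ a → ¬ All (_≤ n) (toList a) → G a ≈ con 0ℚ
    vanish a ¬≤ = R.reflexive (≡.cong (if_then F a else con 0ℚ) (dec-false (isParkingFunction? a) (¬≤ ∘ parking-≤)))
    tabulate-applyUpTo : ∀ m (f : ℕ → ℕ) → List.tabulate {n = m} (f ∘ toℕ) ≡ List.applyUpTo f m
    tabulate-applyUpTo zero    f = ≡.refl
    tabulate-applyUpTo (suc m) f = ≡.cong (f 0 ∷_) (tabulate-applyUpTo m (f ∘ suc))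
    alphabet : [1⋯ n ] List.++ List.[ suc n ] ≡ map (suc ∘ toℕ) (allFin (suc n))
    alphabet = ≡.trans (≡.sym (List.map-++ suc (upTo n) List.[ n ])) (≡.trans (≡.cong (map suc) (List.upTo-∷ʳ n))
      (≡.trans (List.map-upTo suc (suc n)) (≡.trans (≡.sym (tabulate-applyUpTo (suc n) suc))
          (≡.sym (List.map-tabulate id (suc ∘ toℕ))))))

  -- Each of the n + 1 copies of the sum is reindexed by its own rotation; after exchanging the
  -- sums, the cycle lemma leaves one term for each word. Invariance of `F` evaluates that term at
  -- the word itself instead of its rotation; it holds for the character since being fixed by w does
  -- not depend on the names of the letters.
  pollak : ∀ n (F : Vec (Fin (suc n)) n → Poly X) → (∀ (ρ : Permutation′ (suc n)) a → F (Vec.map (ρ ⟨$⟩ʳ_) a) ≈ F a) →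
           con (fromℕ (suc n)) * (∑[ a ∈ words (allFin (suc n)) n ]
               (if does (isParkingFunction? (entries a)) then F a else con 0ℚ)) ≈
           ∑[ a ∈ words (allFin (suc n)) n ] F a
  pollak n F invariant = begin
    con (fromℕ (suc n)) * (∑[ a ∈ W ] G a)                ≈⟨ sum-constant (suc n) (∑[ a ∈ W ] G a) ⟨
    sum {n = suc n} (λ c → ∑[ a ∈ W ] G a)                ≈⟨ sum-cong {n = suc n} (λ c → ∑-words-permute (ρ c) n G) ⟩
    sum {n = suc n} (λ c → ∑[ a ∈ W ] G (Vec.map (ρ c ⟨$⟩ʳ_) a)) ≈⟨ sum-∑-comm W (λ c a → G (Vec.map (ρ c ⟨$⟩ʳ_) a)) ⟩
    ∑[ a ∈ W ] (sum {n = suc n} λ c → G (Vec.map (ρ c ⟨$⟩ʳ_) a)) ≈⟨ ∑-cong W exactlyOne ⟩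
    ∑[ a ∈ W ] F a                                        ∎
    where
    open ≈
    W = words (allFin (suc n)) n
    G : Vec (Fin (suc n)) n → Poly X
    G a = if does (isParkingFunction? (entries a)) then F a else con 0ℚ
    ρ : Fin (suc n) → Permutation′ (suc n)
    ρ c = rotation (toℕ c) (ℕ.<⇒≤ (Fin.toℕ<n c))
    exactlyOne : ∀ a → sum {n = suc n} (λ c → G (Vec.map (ρ c ⟨$⟩ʳ_) a)) ≈ F a
    exactlyOne a with c , c-first , uniq ← firstMinimum {n} (below a) = ≈-trans
      (sum-cong λ d → if-cong (does (isParkingFunction? (entries (Vec.map (ρ d ⟨$⟩ʳ_) a)))) (invariant (ρ d) a))
      (sum-unique (λ d → does (isParkingFunction? (entries (Vec.map (ρ d ⟨$⟩ʳ_) a)))) c (F a)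
        (dec-true (isParkingFunction? (entries (Vec.map (ρ c ⟨$⟩ʳ_) a)))
            (Equivalence.from (parking-below (Vec.map (ρ c ⟨$⟩ʳ_) a)) (Equivalence.from (parking-rotate a c) c-first)))
        λ d → only d (isParkingFunction? (entries (Vec.map (ρ d ⟨$⟩ʳ_) a))))
      where
      if-cong : ∀ b {f g : Poly X} → f ≈ g → (if b then f else con 0ℚ) ≈ (if b then g else con 0ℚ)
      if-cong true  e = e
      if-cong false e = ≈-refl
      only : ∀ d (p? : Dec (IsParkingFunction (entries (Vec.map (ρ d ⟨$⟩ʳ_) a)))) → does p? ≡ true → d ≡ c
      only d (yes p) _ = uniq d (Equivalence.to (parking-rotate a d) (Equivalence.to (parking-below (Vec.map (ρ d ⟨$⟩ʳ_) a)) p))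

  con-foldr : ∀ {A : Set} (xs : List A) (f : A → ℚ) → con {X} (List.foldr (λ a → f a ℚ.+_) 0ℚ xs) ≈ ∑[ a ∈ xs ] con (f a)
  con-foldr []       f = ≈-refl
  con-foldr (x ∷ xs) f = ≈-trans (con-+ (f x) _) (+-congˡ (con-foldr xs f))

  entry-fixed : ∀ {m n} (w : Permutation′ n) (a : Vec (Fin m) n) → con {X} (entry w (entries a) (entries a)) ≈ 𝟙
      (does (fixed? w a))
  entry-fixed w a = ≈-trans (con-if (does (Vec.≡-dec ℕ._≟_ (entries a) (permute w (entries a)))))
    (R.reflexive (≡.cong 𝟙 (does-⇔ (mk⇔ to from) (Vec.≡-dec ℕ._≟_ (entries a) (permute w (entries a))) (fixed? w a))))
    where
    con-if : ∀ b → con {X} (if b then 1ℚ else 0ℚ) ≈ 𝟙 b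
    con-if true  = ≈-refl
    con-if false = ≈-refl
    lookup-permute : ∀ i → lookup (permute w (entries a)) i ≡ suc (toℕ (lookup a (w ⟨$⟩ˡ i)))
    lookup-permute i = ≡.trans (Vec.lookup∘tabulate (λ i → lookup (entries a) (w ⟨$⟩ˡ i)) i)
        (Vec.lookup-map (w ⟨$⟩ˡ i) (suc ∘ toℕ) a)
    to : entries a ≡ permute w (entries a) → Fixed w a
    to e i = Fin.toℕ-injective (ℕ.suc-injective (≡.trans (≡.sym (Vec.lookup-map (w ⟨$⟩ʳ i) (suc ∘ toℕ) a))
      (≡.trans (≡.cong (λ v → lookup v (w ⟨$⟩ʳ i)) e) (≡.trans (lookup-permute (w ⟨$⟩ʳ i))
          (≡.cong (suc ∘ toℕ ∘ lookup a) (Perm.inverseˡ w))))))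
    from : Fixed w a → entries a ≡ permute w (entries a)
    from f = ≡.trans (≡.sym (Vec.tabulate∘lookup (entries a))) (≡.trans (Vec.tabulate-cong λ i →
      ≡.trans (Vec.lookup-map i (suc ∘ toℕ) a)
          (≡.trans (≡.cong (suc ∘ toℕ) (≡.trans (≡.cong (lookup a) (≡.sym (Perm.inverseʳ w))) (f (w ⟨$⟩ˡ i))))
      (≡.sym (lookup-permute i)))) (Vec.tabulate∘lookup (permute w (entries a))))

  fixed-map : ∀ {m n} (w : Permutation′ n) (ρ : Permutation′ m) (a : Vec (Fin m) n) →
              does (fixed? w (Vec.map (ρ ⟨$⟩ʳ_) a)) ≡ does (fixed? w a)
  fixed-map w ρ a = does-⇔ (mk⇔
    (λ f i → Injection.injective (↔⇒↣ ρ) (≡.trans (≡.sym (Vec.lookup-map (w ⟨$⟩ʳ i) (ρ ⟨$⟩ʳ_) a))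
        (≡.trans (f i) (Vec.lookup-map i (ρ ⟨$⟩ʳ_) a))))
    (λ f i → ≡.trans (Vec.lookup-map (w ⟨$⟩ʳ i) (ρ ⟨$⟩ʳ_) a)
        (≡.trans (≡.cong (ρ ⟨$⟩ʳ_) (f i)) (≡.sym (Vec.lookup-map i (ρ ⟨$⟩ʳ_) a)))))
    (fixed? w (Vec.map (ρ ⟨$⟩ʳ_) a)) (fixed? w a)

  parkingCharacter-cycleWeight : ∀ n (w : Permutation′ n) →
    con (fromℕ (suc n)) * con {X} (parkingCharacter n w) ≈ cycleWeight (λ _ → con (fromℕ (suc n))) w
  parkingCharacter-cycleWeight n w = begin
    con (fromℕ (suc n)) * con (parkingCharacter n w)
      ≈⟨ *-congˡ (con-foldr (parkingFunctions n) (λ a → entry w a a)) ⟩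
    con (fromℕ (suc n)) * (∑[ a ∈ parkingFunctions n ] con (entry w a a))
      ≈⟨ *-congˡ (∑-parkingFunctions n (λ a → con (entry w a a))) ⟩
    con (fromℕ (suc n)) * (∑[ a ∈ words (allFin (suc n)) n ] (if does (isParkingFunction? (entries a)) then F a else con 0ℚ))
      ≈⟨ pollak n F (λ ρ a → ≈-trans (entry-fixed w (Vec.map (ρ ⟨$⟩ʳ_) a))
          (≈-trans (R.reflexive (≡.cong 𝟙 (fixed-map w ρ a))) (≈-sym (entry-fixed w a)))) ⟩
    ∑[ a ∈ words (allFin (suc n)) n ] F a
      ≈⟨ ∑-cong (words (allFin (suc n)) n) (entry-fixed w) ⟩
    fixedWords (suc n) w
      ≈⟨ fixedWords-cycleWeight (suc n) w ⟩
    cycleWeight (λ _ → con (fromℕ (suc n))) w ∎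
    where
    open ≈
    F : Vec (Fin (suc n)) n → Poly X
    F a = con (entry w (entries a) (entries a))

-- The multinomial theorem

unique-⇔-↭ : ∀ {A : Set} {xs ys : List A} → Unique xs → Unique ys → (∀ x → x ∈ xs ⇔ x ∈ ys) → xs ↭ ys
unique-⇔-↭ u v e = ∼bag⇒↭ (unique∧set⇒bag u v λ {x} → e x)

∑-↭ : ∀ {X A : Set} {xs ys : List A} → xs ↭ ys → (f : A → Poly X) → ∑[ a ∈ xs ] f a ≈ ∑[ a ∈ ys ] f a
∑-↭ refl          f = ≈-refl
∑-↭ (prep x p)    f = +-congˡ (∑-↭ p f)
∑-↭ {X} (swap x y p)  f = ≈-trans (+-congˡ (+-congˡ (∑-↭ p f)))
  (PS.solve 3 (λ a b c → a PS.:+ (b PS.:+ c) PS.:= b PS.:+ (a PS.:+ c)) ≈-refl (f x) (f y) _)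
  where module PS = Solver {X}
∑-↭ (trans p q)   f = ≈-trans (∑-↭ p f) (∑-↭ q f)

words-unique : ∀ {A : Set} {as : List A} → Unique as → ∀ n → Unique (words as n)
words-unique u zero    = [] ∷ []
words-unique u (suc n) = Unique.cartesianProductWith⁺ _∷_ (λ e → Vec.∷-injective e) u (words-unique u n)

∈-words⁺ : ∀ {A : Set} {as : List A} {n} (a : Vec A n) → All (_∈ as) (toList a) → a ∈ words as n
∈-words⁺ []      []       = here ≡.refl
∈-words⁺ (x ∷ a) (x∈ ∷ p) = ∈-cartesianProductWith⁺ _∷_ x∈ (∈-words⁺ a p)

∈-words⁻ : ∀ {A : Set} {as : List A} n {a : Vec A n} → a ∈ words as n → All (_∈ as) (toList a)
∈-words⁻ zero    {[]} _ = []
∈-words⁻ {as = as} (suc n) p with _ , _ , x∈ , a∈ , ≡.refl ← ∈-cartesianProductWith⁻ _∷_ as (words as n) p = x∈ ∷ ∈-words⁻ n a∈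

wordLists : List ℕ → ℕ → List (List ℕ)
wordLists as ℓ = map toList (words as ℓ)

wordLists-unique : ∀ {as} → Unique as → ∀ ℓ → Unique (wordLists as ℓ)
wordLists-unique u ℓ = Unique.map⁺ (λ {a} {b} e → ≡.trans (≡.sym (Vec.cast-is-id ≡.refl a)) (Vec.toList-injective ≡.refl a b e))
    (words-unique u ℓ)

∈-wordLists⁺ : ∀ {as} (xs : List ℕ) → All (_∈ as) xs → xs ∈ wordLists as (length xs)
∈-wordLists⁺ {as} xs p = ≡.subst (_∈ wordLists as (length xs)) (Vec.toList∘fromList xs)
  (∈-map⁺ toList (∈-words⁺ (Vec.fromList xs) (≡.subst (All (_∈ as)) (≡.sym (Vec.toList∘fromList xs)) p)))

∈-wordLists⁻ : ∀ {as} ℓ {xs} → xs ∈ wordLists as ℓ → All (_∈ as) xs × length xs ≡ ℓ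
∈-wordLists⁻ ℓ p with a , a∈ , ≡.refl ← ∈-map⁻ toList p = ∈-words⁻ ℓ a∈ , Vec.length-toList a

sorted-↭ : ∀ {xs ys} → AllPairs _≥_ xs → AllPairs _≥_ ys → xs ↭ ys → xs ≡ ys
sorted-↭ {[]}     {[]}     _ _ _ = ≡.refl
sorted-↭ {[]}     {y ∷ ys} _ _ p with () ← ↭-length p
sorted-↭ {x ∷ xs} {[]}     _ _ p with () ← ↭-length p
sorted-↭ {x ∷ xs} {y ∷ ys} (x≥ ∷ s) (y≥ ∷ s′) p with ℕ.≤-antisym (top y≥ (∈-resp-↭ p (here ≡.refl)))
    (top x≥ (∈-resp-↭ (↭-sym p) (here ≡.refl)))
  where
  top : ∀ {x y ys} → All (y ≥_) ys → x ∈ y ∷ ys → x ≤ y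
  top y≥ (here ≡.refl) = ℕ.≤-refl
  top y≥ (there x∈)    = All.lookup y≥ x∈
... | ≡.refl = ≡.cong (x ∷_) (sorted-↭ s s′ (drop-∷ p))

decreasing : ∀ {xs} → Linked _≥_ xs → AllPairs _≥_ xs
decreasing = Linked⇒AllPairs λ p q → ℕ.≤-trans q p

-- A multiset is represented by its weakly decreasing listing, the normal form that partitions have,
-- so that equal multisets are equal lists.
multisets : List ℕ → ℕ → List (List ℕ)
multisets as ℓ = filter (linked? ℕ._≥?_) (wordLists as ℓ)

∈-multisets⁺ : ∀ {as xs} → Linked _≥_ xs → All (_∈ as) xs → ∀ {ℓ} → length xs ≡ ℓ → xs ∈ multisets as ℓ
∈-multisets⁺ {xs = xs} s p ≡.refl = ∈-filter⁺ (linked? ℕ._≥?_) (∈-wordLists⁺ xs p) s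

∈-multisets⁻ : ∀ {as} ℓ {xs} → xs ∈ multisets as ℓ → Linked _≥_ xs × All (_∈ as) xs × length xs ≡ ℓ
∈-multisets⁻ {as} ℓ p with p′ , s ← ∈-filter⁻ (linked? ℕ._≥?_) {xs = wordLists as ℓ} p = s , ∈-wordLists⁻ ℓ p′

multisets-unique : ∀ {as} → Unique as → ∀ ℓ → Unique (multisets as ℓ)
multisets-unique u ℓ = Unique.filter⁺ (linked? ℕ._≥?_) (wordLists-unique u ℓ)

adjoin : ℕ → List ℕ → List ℕ
adjoin k xs = ↘.sort (k ∷ xs)

adjoin-↭ : ∀ k xs → adjoin k xs ↭ k ∷ xs
adjoin-↭ k xs = ↘.sort-↭ (k ∷ xs)

multiplicity-↭ : ∀ k {xs ys} → xs ↭ ys → multiplicity k xs ≡ multiplicity k ys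
multiplicity-↭ k p = ↭-length (filter-↭ (k ℕ.≟_) p)

multiplicity-same : ∀ k xs → multiplicity k (k ∷ xs) ≡ suc (multiplicity k xs)
multiplicity-same k xs = ≡.cong length (List.filter-accept (k ℕ.≟_) ≡.refl)

multiplicity-other : ∀ {k x} xs → k ≢ x → multiplicity k (x ∷ xs) ≡ multiplicity k xs
multiplicity-other {k} xs k≢x = ≡.cong length (List.filter-reject (k ℕ.≟_) k≢x)

-- Sorting k into a multiset is undone by removing one copy of k. Neither list has repetitions, so
-- comparing members is enough and the order of enumeration is irrelevant.
containing : ∀ {as} → Unique as → ∀ {k} → k ∈ as → ∀ ℓ →
             filter (λ xs → 1 ℕ.≤? multiplicity k xs) (multisets as (suc ℓ)) ↭ map (adjoin k) (multisets as ℓ)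
containing {as} u {k} k∈ ℓ = unique-⇔-↭
  (Unique.filter⁺ k∈? (multisets-unique u (suc ℓ)))
  (map-unique (multisets as ℓ) (λ p → decreasing (proj₁ (∈-multisets⁻ ℓ p))) (multisets-unique u ℓ))
  λ xs → mk⇔ to from
  where
  k∈? : ∀ xs → Dec (1 ≤ multiplicity k xs)
  k∈? xs = 1 ℕ.≤? multiplicity k xs
  adjoin-injective : ∀ {xs ys} → AllPairs _≥_ xs → AllPairs _≥_ ys → adjoin k xs ≡ adjoin k ys → xs ≡ ys
  adjoin-injective {xs} {ys} s s′ e = sorted-↭ s s′
      (drop-∷ (↭-trans (↭-sym (adjoin-↭ k xs)) (≡.subst (_↭ k ∷ ys) (≡.sym e) (adjoin-↭ k ys))))
  map-unique : ∀ xss → (∀ {xs} → xs ∈ xss → AllPairs _≥_ xs) → Unique xss → Unique (map (adjoin k) xss)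
  map-unique []         _ []       = []
  map-unique (xs ∷ xss) s (x≢ ∷ v) = All.map⁺ (All.tabulate λ ys∈ e → All.lookup x≢ ys∈
      (adjoin-injective (s (here ≡.refl)) (s (there ys∈)) e))
    ∷ map-unique xss (s ∘ there) v
  multiplicity-∈ : ∀ xs → 1 ≤ multiplicity k xs → k ∈ xs
  multiplicity-∈ (x ∷ xs) p with k ℕ.≟ x
  ... | yes ≡.refl = here ≡.refl
  ... | no  k≢x    = there (multiplicity-∈ xs (≡.subst (1 ≤_) (multiplicity-other xs k≢x) p))
  to : ∀ {xs} → xs ∈ filter k∈? (multisets as (suc ℓ)) → xs ∈ map (adjoin k) (multisets as ℓ)
  to {xs} p with p′ , k≤ ← ∈-filter⁻ k∈? {xs = multisets as (suc ℓ)} p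
    with s , a , len ← ∈-multisets⁻ (suc ℓ) p′
    with ys , zs , ≡.refl ← ∈-∃++ (multiplicity-∈ xs k≤) =
    ≡.subst (_∈ map (adjoin k) (multisets as ℓ))
      (sorted-↭ (decreasing (↘.sort-↗ (k ∷ rest))) (decreasing s)
          (↭-trans (↘.sort-↭ (k ∷ rest)) (↭-trans (prep k rest↭) (↭-sym (↭-shift k ys zs)))))
      (∈-map⁺ (adjoin k) (∈-multisets⁺ {as} {rest} (↘.sort-↗ (ys List.++ zs))
        (All-resp-↭ (↭-sym rest↭) (All.tail (All-resp-↭ (↭-shift k ys zs) a)))
        (ℕ.suc-injective (≡.trans (≡.cong suc (↭-length rest↭)) (≡.trans (≡.sym (↭-length (↭-shift k ys zs))) len)))))
    where
    rest = ↘.sort (ys List.++ zs)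
    rest↭ = ↘.sort-↭ (ys List.++ zs)
  from : ∀ {xs} → xs ∈ map (adjoin k) (multisets as ℓ) → xs ∈ filter k∈? (multisets as (suc ℓ))
  from p with ys , ys∈ , ≡.refl ← ∈-map⁻ (adjoin k) p
    with s , a , len ← ∈-multisets⁻ ℓ ys∈ =
    ∈-filter⁺ k∈? (∈-multisets⁺ (↘.sort-↗ (k ∷ ys)) (All-resp-↭ (↭-sym (adjoin-↭ k ys)) (k∈ ∷ a))
        (≡.trans (↭-length (adjoin-↭ k ys)) (≡.cong suc len)))
      (≡.subst (1 ≤_) (≡.sym (≡.trans (multiplicity-↭ k (adjoin-↭ k ys)) (multiplicity-same k ys))) (s≤s z≤n))

multiplicityFactorials : List ℕ → List ℕ → ℕ
multiplicityFactorials as xs = product (map (λ k → multiplicity k xs !) as)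

multiplicityFactorials≢0 : ∀ as xs → NonZero (multiplicityFactorials as xs)
multiplicityFactorials≢0 as xs = product≢0 (All.map⁺ (All.universal (λ k → multiplicity k xs !≢0) as))

-- The multinomial coefficient without its numerator ℓ!. In this form the removal of one letter k
-- multiplies it by the multiplicity of k and by nothing else.
weight : List ℕ → List ℕ → ℚ
weight as xs = (+ 1 ℚ./ multiplicityFactorials as xs) {{multiplicityFactorials≢0 as xs}}

multiplicityFactorials-adjoin : ∀ {as} → Unique as → ∀ {k} → k ∈ as → ∀ xs →
  multiplicityFactorials as (adjoin k xs) ≡ multiplicity k (adjoin k xs) ℕ.* multiplicityFactorials as xs
multiplicityFactorials-adjoin {a ∷ as} (a∉ ∷ u) {k} k∈ xs with k∈
... | here ≡.refl = begin
  m ! ℕ.* multiplicityFactorials as (adjoin k xs)     ≡⟨ ≡.cong (m ! ℕ.*_) (others as a∉) ⟩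
  m ! ℕ.* multiplicityFactorials as xs                ≡⟨ ≡.cong (λ j → j ! ℕ.* multiplicityFactorials as xs) m≡ ⟩
  suc m′ ℕ.* m′ ! ℕ.* multiplicityFactorials as xs    ≡⟨ ℕ.*-assoc (suc m′) (m′ !) _ ⟩
  suc m′ ℕ.* (m′ ! ℕ.* multiplicityFactorials as xs)  ≡⟨ ≡.cong (ℕ._* (m′ ! ℕ.* multiplicityFactorials as xs)) m≡ ⟨
  m ℕ.* (m′ ! ℕ.* multiplicityFactorials as xs)       ∎
  where
  open ≡.≡-Reasoning
  m = multiplicity k (adjoin k xs)
  m′ = multiplicity k xs
  m≡ : m ≡ suc m′
  m≡ = ≡.trans (multiplicity-↭ k (adjoin-↭ k xs)) (multiplicity-same k xs)
  others : ∀ bs → All (k ≢_) bs → multiplicityFactorials bs (adjoin k xs) ≡ multiplicityFactorials bs xs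
  others []       []         = ≡.refl
  others (b ∷ bs) (k≢b ∷ q) = ≡.cong₂ (λ j l → j ! ℕ.* l)
    (≡.trans (multiplicity-↭ b (adjoin-↭ k xs)) (multiplicity-other xs (k≢b ∘ ≡.sym))) (others bs q)
... | there k∈′ = begin
  multiplicity a (adjoin k xs) ! ℕ.* multiplicityFactorials as (adjoin k xs)
    ≡⟨ ≡.cong₂ (λ j l → j ! ℕ.* l) (≡.trans (multiplicity-↭ a (adjoin-↭ k xs)) (multiplicity-other xs (All.lookup a∉ k∈′)))
        (multiplicityFactorials-adjoin u k∈′ xs) ⟩
  multiplicity a xs ! ℕ.* (m ℕ.* multiplicityFactorials as xs)
    ≡⟨ x∙yz≈y∙xz (multiplicity a xs !) m (multiplicityFactorials as xs) ⟩
  m ℕ.* (multiplicity a xs ! ℕ.* multiplicityFactorials as xs) ∎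
  where
  open ≡.≡-Reasoning
  open CommutativeSemigroup ℕ.*-commutativeSemigroup using (x∙yz≈y∙xz)
  m = multiplicity k (adjoin k xs)

weight-adjoin : ∀ {as} → Unique as → ∀ {k} → k ∈ as → ∀ xs →
                fromℕ (multiplicity k (adjoin k xs)) ℚ.* weight as (adjoin k xs) ≡ weight as xs
weight-adjoin {as} u {k} k∈ xs = /-cancel (multiplicityFactorials as (adjoin k xs)) (multiplicityFactorials as xs)
  {{multiplicityFactorials≢0 as (adjoin k xs)}} {{multiplicityFactorials≢0 as xs}} (multiplicity k (adjoin k xs))
      (multiplicityFactorials-adjoin u k∈ xs)

∑-cong-∈ : ∀ {X A : Set} (xs : List A) {f g : A → Poly X} → (∀ a → a ∈ xs → f a ≈ g a) → ∑[ a ∈ xs ] f a ≈ ∑[ a ∈ xs ] g a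
∑-cong-∈ []       e = ≈-refl
∑-cong-∈ (x ∷ xs) e = +-cong (e x (here ≡.refl)) (∑-cong-∈ xs λ a a∈ → e a (there a∈))

∑-indicator-∉ : ∀ {X : Set} (f : ℕ → Poly X) {x} (as : List ℕ) → All (x ≢_) as →
                ∑[ k ∈ as ] (if does (k ℕ.≟ x) then f k else con 0ℚ) ≈ con 0ℚ
∑-indicator-∉ f []       []        = ≈-refl
∑-indicator-∉ f {x} (a ∷ as) (x≢a ∷ q) = ≈-trans
  (+-cong (CommutativeRing.reflexive (polyRing _) (≡.cong (if_then f a else con 0ℚ) (dec-false (a ℕ.≟ x) (x≢a ∘ ≡.sym))))
      (∑-indicator-∉ f as q))
  (+-identityˡ _)

∑-indicator-∈ : ∀ {X : Set} (f : ℕ → Poly X) {x} {as : List ℕ} → Unique as → x ∈ as →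
                ∑[ k ∈ as ] (if does (k ℕ.≟ x) then f k else con 0ℚ) ≈ f x
∑-indicator-∈ f {x} {a ∷ as} (a∉ ∷ u) (here ≡.refl) = ≈-trans
  (+-cong (CommutativeRing.reflexive (polyRing _) (≡.cong (if_then f a else con 0ℚ) (dec-true (a ℕ.≟ a) ≡.refl)))
      (∑-indicator-∉ f as a∉))
  (+-identityʳ _)
∑-indicator-∈ f {x} {a ∷ as} (a∉ ∷ u) (there x∈) = ≈-trans
  (+-cong (CommutativeRing.reflexive (polyRing _) (≡.cong (if_then f a else con 0ℚ) (dec-false (a ℕ.≟ x) (All.lookup a∉ x∈))))
      (∑-indicator-∈ f u x∈))
  (+-identityˡ _)

∑-multiplicity : ∀ {X : Set} {as} → Unique as → ∀ xs → All (_∈ as) xs → con {X} (fromℕ (length xs)) ≈ ∑[ k ∈ as ] con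
    (fromℕ (multiplicity k xs))
∑-multiplicity {as = as} u []       []       = ≈-sym (∑-zero as)
∑-multiplicity {X} {as} u (x ∷ xs) (x∈ ∷ p) = begin
  con (fromℕ (suc (length xs)))                  ≈⟨ con-suc (length xs) ⟩
  con 1ℚ + con (fromℕ (length xs))               ≈⟨ +-cong (≈-sym (∑-indicator-∈ (λ _ → con 1ℚ) u x∈)) (∑-multiplicity u xs p) ⟩
  (∑[ k ∈ as ] 𝟙 (does (k ℕ.≟ x))) + (∑[ k ∈ as ] con (fromℕ (multiplicity k xs)))
    ≈⟨ ∑-+ as (λ k → 𝟙 (does (k ℕ.≟ x))) (λ k → con (fromℕ (multiplicity k xs))) ⟨
  ∑[ k ∈ as ] (𝟙 (does (k ℕ.≟ x)) + con (fromℕ (multiplicity k xs)))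
    ≈⟨ ∑-cong as (λ k → step k (k ℕ.≟ x)) ⟩
  ∑[ k ∈ as ] con (fromℕ (multiplicity k (x ∷ xs))) ∎
  where
  open SetoidReasoning (setoid {X})
  step : ∀ k (k≟x : Dec (k ≡ x)) → 𝟙 {X} (does k≟x) + con (fromℕ (multiplicity k xs)) ≈ con (fromℕ (multiplicity k (x ∷ xs)))
  step k (yes ≡.refl) = ≈-sym (≈-trans (CommutativeRing.reflexive (polyRing X) (≡.cong (con ∘ fromℕ) (multiplicity-same k xs)))
      (con-suc (multiplicity k xs)))
  step k (no k≢x)     = ≈-trans (+-identityˡ _) (CommutativeRing.reflexive (polyRing X)
      (≡.cong (con ∘ fromℕ) (≡.sym (multiplicity-other xs k≢x))))

module Multinomial {X : Set} {as : List ℕ} (u : Unique as) (v : ℕ → Series {X}) where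
  private
    module R = CommutativeRing (polyRing X)
    module S = CommutativeRing (seriesRing {X})

  monomial : List ℕ → Series {X}
  monomial []       = 1ₛ
  monomial (k ∷ xs) = v k ⋆ monomial xs

  monomial-↭ : ∀ {xs ys} → xs ↭ ys → monomial xs ≋ monomial ys
  monomial-↭ refl         = S.refl
  monomial-↭ (prep x p)   = S.*-congˡ {v x} (monomial-↭ p)
  monomial-↭ (swap {xs} {ys} x y p) = S.trans (S.*-congˡ {v x} (S.*-congˡ {v y} (monomial-↭ p)))
    (SS.solve 3 (λ a b c → a SS.:* (b SS.:* c) SS.:= b SS.:* (a SS.:* c)) S.refl (v x) (v y) (monomial ys))
    where module SS = SeriesOver.Solver {X}
  monomial-↭ (trans p q)  = S.trans (monomial-↭ p) (monomial-↭ q)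

  letterSum : Series {X}
  letterSum n = ∑[ k ∈ as ] v k n

  multisetSum : ℕ → Series {X}
  multisetSum ℓ n = ∑[ xs ∈ multisets as ℓ ] (con (weight as xs) * monomial xs n)

  ⋆-∑ : ∀ {A : Set} (f : Series {X}) (xs : List A) (g : A → Series {X}) n →
        (f ⋆ (λ n → ∑[ a ∈ xs ] g a n)) n ≈ ∑[ a ∈ xs ] (f ⋆ g a) n
  ⋆-∑ f []       g n = S.zeroʳ f n
  ⋆-∑ f (x ∷ xs) g n = ≈-trans (S.distribˡ f (g x) (λ n → ∑[ a ∈ xs ] g a n) n) (+-congˡ (⋆-∑ f xs g n))

  -- Double counting of multisets with a distinguished letter. The size ℓ + 1 is the sum of the
  -- multiplicities, and the multiplicity of k times the weight is the weight after one k has been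
  -- removed; the removed letter leaves the factor `v k`.
  multisetSum-suc : ∀ ℓ n → con (fromℕ (suc ℓ)) * multisetSum (suc ℓ) n ≈ (letterSum ⋆ multisetSum ℓ) n
  multisetSum-suc ℓ n = begin
    con (fromℕ (suc ℓ)) * multisetSum (suc ℓ) n
      ≈⟨ ∑-distribˡ (con (fromℕ (suc ℓ))) L (λ xs → term xs) ⟩
    ∑[ xs ∈ L ] (con (fromℕ (suc ℓ)) * term xs)
      ≈⟨ ∑-cong-∈ L (λ xs xs∈ → expand xs (proj₂ (∈-multisets⁻ (suc ℓ) xs∈))) ⟩
    ∑[ xs ∈ L ] (∑[ k ∈ as ] (con (fromℕ (multiplicity k xs)) * term xs))
      ≈⟨ ∑-comm L as (λ xs k → con (fromℕ (multiplicity k xs)) * term xs) ⟩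
    ∑[ k ∈ as ] (∑[ xs ∈ L ] (con (fromℕ (multiplicity k xs)) * term xs))
      ≈⟨ ∑-cong-∈ as (λ k k∈ → remove k k∈) ⟩
    ∑[ k ∈ as ] (v k ⋆ multisetSum ℓ) n
      ≈⟨ ∑-cong as (λ k → ⋆-comm (v k) (multisetSum ℓ) n) ⟩
    ∑[ k ∈ as ] (multisetSum ℓ ⋆ v k) n
      ≈⟨ ⋆-∑ (multisetSum ℓ) as v n ⟨
    (multisetSum ℓ ⋆ letterSum) n
      ≈⟨ ⋆-comm (multisetSum ℓ) letterSum n ⟩
    (letterSum ⋆ multisetSum ℓ) n ∎
    where
    open SetoidReasoning (setoid {X})
    L = multisets as (suc ℓ)
    term : List ℕ → Poly X
    term xs = con (weight as xs) * monomial xs n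
    expand : ∀ xs → All (_∈ as) xs × length xs ≡ suc ℓ → con (fromℕ (suc ℓ)) * term xs ≈ ∑[ k ∈ as ]
        (con (fromℕ (multiplicity k xs)) * term xs)
    expand xs (a , len) = begin
      con (fromℕ (suc ℓ)) * term xs                            ≈⟨ *-congʳ (R.reflexive (≡.cong (con ∘ fromℕ) (≡.sym len))) ⟩
      con (fromℕ (length xs)) * term xs                        ≈⟨ *-congʳ (∑-multiplicity u xs a) ⟩
      (∑[ k ∈ as ] con (fromℕ (multiplicity k xs))) * term xs  ≈⟨ *-comm _ (term xs) ⟩
      term xs * (∑[ k ∈ as ] con (fromℕ (multiplicity k xs)))  ≈⟨ ∑-distribˡ (term xs) as
          (λ k → con (fromℕ (multiplicity k xs))) ⟩
      ∑[ k ∈ as ] (term xs * con (fromℕ (multiplicity k xs)))  ≈⟨ ∑-cong as (λ k → *-comm (term xs) _) ⟩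
      ∑[ k ∈ as ] (con (fromℕ (multiplicity k xs)) * term xs)  ∎
    remove : ∀ k → k ∈ as → ∑[ xs ∈ L ] (con (fromℕ (multiplicity k xs)) * term xs) ≈ (v k ⋆ multisetSum ℓ) n
    remove k k∈ = begin
      ∑[ xs ∈ L ] (con (fromℕ (multiplicity k xs)) * term xs)
        ≈⟨ ∑-cong L (λ xs → present xs (1 ℕ.≤? multiplicity k xs)) ⟩
      ∑[ xs ∈ L ] (if does (1 ℕ.≤? multiplicity k xs) then con (fromℕ (multiplicity k xs)) * term xs else con 0ℚ)
        ≈⟨ ∑-filter (λ xs → 1 ℕ.≤? multiplicity k xs) L (λ xs → con (fromℕ (multiplicity k xs)) * term xs) ⟨
      ∑[ xs ∈ filter (λ xs → 1 ℕ.≤? multiplicity k xs) L ] (con (fromℕ (multiplicity k xs)) * term xs)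
        ≈⟨ ∑-↭ (containing u k∈ ℓ) (λ xs → con (fromℕ (multiplicity k xs)) * term xs) ⟩
      ∑[ xs ∈ map (adjoin k) (multisets as ℓ) ] (con (fromℕ (multiplicity k xs)) * term xs)
        ≡⟨ ∑-map (adjoin k) (multisets as ℓ) (λ xs → con (fromℕ (multiplicity k xs)) * term xs) ⟩
      ∑[ xs ∈ multisets as ℓ ] (con (fromℕ (multiplicity k (adjoin k xs))) * term (adjoin k xs))
        ≈⟨ ∑-cong (multisets as ℓ) (λ xs → ≈-trans (≈-sym (*-assoc _ _ _)) (*-cong
             (≈-trans (≈-sym (con-* _ _)) (R.reflexive (≡.cong con (weight-adjoin u k∈ xs)))) (monomial-↭ (adjoin-↭ k xs) n))) ⟩
      ∑[ xs ∈ multisets as ℓ ] (con (weight as xs) * (v k ⋆ monomial xs) n)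
        ≈⟨ ∑-cong (multisets as ℓ) (λ xs → ≈-trans (*-congˡ (⋆-comm (v k) (monomial xs) n))
            (≈-trans (≈-sym (·-⋆ (con (weight as xs)) (monomial xs) (v k) n))
            (⋆-comm (con (weight as xs) · monomial xs) (v k) n))) ⟩
      ∑[ xs ∈ multisets as ℓ ] (v k ⋆ (con (weight as xs) · monomial xs)) n
        ≈⟨ ⋆-∑ (v k) (multisets as ℓ) (λ xs → con (weight as xs) · monomial xs) n ⟨
      (v k ⋆ multisetSum ℓ) n ∎
      where
      present : ∀ xs (p? : Dec (1 ≤ multiplicity k xs)) → con (fromℕ (multiplicity k xs)) * term xs ≈
                (if does p? then con (fromℕ (multiplicity k xs)) * term xs else con 0ℚ)
      present xs (yes _) = ≈-refl
      present xs (no ¬p) = ≈-trans (*-congʳ (R.reflexive (≡.cong (con ∘ fromℕ) (ℕ.n<1⇒n≡0 (ℕ.≰⇒> ¬p))))) (zeroˡ _)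

  multinomial : ∀ ℓ → letterSum ^ₛ ℓ ≋ con (fromℕ (ℓ !)) · multisetSum ℓ
  multinomial zero n = ≈-sym (≈-trans (*-identityˡ _) (≈-trans (+-identityʳ _)
      (≈-trans (*-congʳ (R.reflexive (≡.cong con weight-[]))) (*-identityˡ _))))
    where
    factorials-[] : ∀ as → multiplicityFactorials as [] ≡ 1
    factorials-[] []       = ≡.refl
    factorials-[] (a ∷ as) = ≡.trans (ℕ.+-identityʳ _) (factorials-[] as)
    weight-[] : weight as [] ≡ 1ℚ
    weight-[] = ≡.trans (≡.sym (ℚ.*-identityˡ (weight as [])))
        (/-cancel (multiplicityFactorials as []) 1 {{multiplicityFactorials≢0 as []}} 1
      (≡.trans (factorials-[] as) ≡.refl))
  multinomial (suc ℓ) n = begin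
    (letterSum ⋆ letterSum ^ₛ ℓ) n                             ≈⟨ S.*-congˡ {letterSum} (multinomial ℓ) n ⟩
    (letterSum ⋆ (con (fromℕ (ℓ !)) · multisetSum ℓ)) n        ≈⟨ ⋆-comm letterSum (con (fromℕ (ℓ !)) · multisetSum ℓ) n ⟩
    ((con (fromℕ (ℓ !)) · multisetSum ℓ) ⋆ letterSum) n        ≈⟨ ·-⋆ (con (fromℕ (ℓ !))) (multisetSum ℓ) letterSum n ⟩
    con (fromℕ (ℓ !)) * (multisetSum ℓ ⋆ letterSum) n          ≈⟨ *-congˡ (⋆-comm (multisetSum ℓ) letterSum n) ⟩
    con (fromℕ (ℓ !)) * (letterSum ⋆ multisetSum ℓ) n          ≈⟨ *-congˡ (multisetSum-suc ℓ n) ⟨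
    con (fromℕ (ℓ !)) * (con (fromℕ (suc ℓ)) * multisetSum (suc ℓ) n) ≈⟨ *-assoc _ _ _ ⟨
    con (fromℕ (ℓ !)) * con (fromℕ (suc ℓ)) * multisetSum (suc ℓ) n
      ≈⟨ *-congʳ (≈-trans (≈-sym (con-* (fromℕ (ℓ !)) (fromℕ (suc ℓ)))) (R.reflexive (≡.cong con
           (≡.trans (≡.sym (fromℕ-* (ℓ !) (suc ℓ))) (≡.cong fromℕ (ℕ.*-comm (ℓ !) (suc ℓ))))))) ⟩
    con (fromℕ (suc ℓ !)) * multisetSum (suc ℓ) n ∎
    where open SetoidReasoning (setoid {X})

-- The coefficients of exp ((n + 1) arsinh w)

private
  steppedFactor : ℕ → ℕ → ℕ → ℤ
  steppedFactor n ℓ j = + n ℤ.+ + ℓ ℤ.- + 1 ℤ.- + 2 ℤ.* + j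

  foldr-last : ∀ (f : ℕ → ℤ) (h : ℕ → ℕ) k →
    List.foldr (λ j → f j ℤ.*_) (+ 1) (List.applyUpTo h (suc k)) ≡ List.foldr (λ j → f j ℤ.*_) (+ 1) (List.applyUpTo h k) ℤ.* f
        (h k)
  foldr-last f h zero    = ℤ.*-comm (f (h 0)) (+ 1)
  foldr-last f h (suc k) = ≡.trans (≡.cong (f (h 0) ℤ.*_) (foldr-last f (h ∘ suc) k)) (≡.sym (ℤ.*-assoc (f (h 0)) _ _))

  foldr-reindex : ∀ (f g : ℕ → ℤ) (h h′ : ℕ → ℕ) → (∀ i → f (h i) ≡ g (h′ i)) → ∀ k →
    List.foldr (λ j → f j ℤ.*_) (+ 1) (List.applyUpTo h k) ≡ List.foldr (λ j → g j ℤ.*_) (+ 1) (List.applyUpTo h′ k)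
  foldr-reindex f g h h′ e zero    = ≡.refl
  foldr-reindex f g h h′ e (suc k) = ≡.cong₂ ℤ._*_ (e 0) (foldr-reindex f g (h ∘ suc) (h′ ∘ suc) (e ∘ suc) k)

  factor-shift : ∀ n l i → n ℤ.+ (+ 2 ℤ.+ l) ℤ.- + 1 ℤ.- + 2 ℤ.* (+ 1 ℤ.+ i) ≡ n ℤ.+ l ℤ.- + 1 ℤ.- + 2 ℤ.* i
  factor-shift = ℤ-solve-∀

  factor-square : ∀ n l → (n ℤ.+ (+ 2 ℤ.+ l) ℤ.- + 1 ℤ.- + 2 ℤ.* + 0) ℤ.* (n ℤ.+ (+ 2 ℤ.+ l) ℤ.- + 1 ℤ.- + 2 ℤ.* l) ℤ.+ l ℤ.* l ≡
      (+ 1 ℤ.+ n) ℤ.* (+ 1 ℤ.+ n)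
  factor-square = ℤ-solve-∀

  factor-two : ∀ n → (n ℤ.+ + 2 ℤ.- + 1 ℤ.- + 2 ℤ.* + 0) ℤ.* + 1 ≡ + 1 ℤ.+ n
  factor-two = ℤ-solve-∀

-- The factors form an arithmetic progression of step two centred at n + 1, so lengthening ℓ by two
-- adds one factor at either end. With l = j + 1 these are n + 1 + l and n + 1 - l, of product (n +
-- 1)² - l²; this is `factor-square`.
steppedProduct-suc-suc : ∀ n j → steppedProduct n (3 ℕ.+ j) ≡
  steppedFactor n (3 ℕ.+ j) 0 ℤ.* (steppedProduct n (suc j) ℤ.* steppedFactor n (3 ℕ.+ j) (suc j))
steppedProduct-suc-suc n j = ≡.cong (steppedFactor n (3 ℕ.+ j) 0 ℤ.*_)
  (≡.trans (foldr-last (steppedFactor n (3 ℕ.+ j)) suc j)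
    (≡.cong (ℤ._* steppedFactor n (3 ℕ.+ j) (suc j))
      (foldr-reindex (steppedFactor n (3 ℕ.+ j)) (steppedFactor n (suc j)) suc id (λ i → factor-shift (+ n) (+ suc j) (+ i)) j)))

-- The constant term is set apart: at ℓ = 0 truncated subtraction makes the stepped product empty,
-- and the general formula would give n + 1 instead of 1.
expansionCoefficient : ℕ → ℕ → ℚ
expansionCoefficient n zero    = 1ℚ
expansionCoefficient n (suc ℓ) = fromℕ (suc n) ℚ.* fromℤ (steppedProduct n (suc ℓ)) ℚ.* 1/ suc ℓ !

-- The recursion obtained by comparing coefficients of wˡ in (1 + w²) y″ + w y′ = m² y. The two
-- leading integers reduce the factorial to 1/ℓ!, and the two new factors of the stepped product
-- supply m² - ℓ².
expansionCoefficient-step : ∀ n ℓ → let b = expansionCoefficient n in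
  fromℕ (suc ℓ) ℚ.* (fromℕ (suc (suc ℓ)) ℚ.* b (suc (suc ℓ))) ℚ.+ fromℕ ℓ ℚ.* (fromℕ ℓ ℚ.* b ℓ) ≡ fromℕ (suc n) ℚ.*
      (fromℕ (suc n) ℚ.* b ℓ)
expansionCoefficient-step n ℓ = ≡.trans (≡.cong (ℚ._+ fromℕ ℓ ℚ.* (fromℕ ℓ ℚ.* b ℓ)) collect) (step ℓ)
  where
  open ≡.≡-Reasoning
  open ℚ-Solver.+-*-Solver using (solve; _:*_; _:+_; _:=_)
  b = expansionCoefficient n
  M = fromℕ (suc n)
  s″ : ℚ
  s″ = fromℤ (steppedProduct n (suc (suc ℓ)))
  collect : fromℕ (suc ℓ) ℚ.* (fromℕ (suc (suc ℓ)) ℚ.* b (suc (suc ℓ))) ≡ M ℚ.* s″ ℚ.* 1/ ℓ !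
  collect = begin
    fromℕ (suc ℓ) ℚ.* (fromℕ (suc (suc ℓ)) ℚ.* (M ℚ.* s″ ℚ.* 1/ suc (suc ℓ) !))
      ≡⟨ solve 4 (λ x y z f → x :* (y :* (z :* f)) := z :* (x :* (y :* f))) ≡.refl (fromℕ (suc ℓ)) (fromℕ (suc (suc ℓ)))
          (M ℚ.* s″) (1/ suc (suc ℓ) !) ⟩
    M ℚ.* s″ ℚ.* (fromℕ (suc ℓ) ℚ.* (fromℕ (suc (suc ℓ)) ℚ.* 1/ suc (suc ℓ) !))
      ≡⟨ ≡.cong (λ f → M ℚ.* s″ ℚ.* (fromℕ (suc ℓ) ℚ.* f)) (1/-!-suc (suc ℓ)) ⟩
    M ℚ.* s″ ℚ.* (fromℕ (suc ℓ) ℚ.* 1/ suc ℓ !)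
      ≡⟨ ≡.cong (M ℚ.* s″ ℚ.*_) (1/-!-suc ℓ) ⟩
    M ℚ.* s″ ℚ.* 1/ ℓ ! ∎
  step : ∀ ℓ → M ℚ.* fromℤ (steppedProduct n (suc (suc ℓ))) ℚ.* 1/ ℓ ! ℚ.+ fromℕ ℓ ℚ.* (fromℕ ℓ ℚ.* b ℓ) ≡ M ℚ.* (M ℚ.* b ℓ)
  -- The constant term does not have the product form, so the passage from ℓ = 0 to ℓ = 2 is checked
  -- by itself.
  step zero = begin
    M ℚ.* fromℤ (steppedProduct n 2) ℚ.* 1ℚ ℚ.+ 0ℚ ℚ.* (0ℚ ℚ.* 1ℚ)
      ≡⟨ ≡.cong (λ i → M ℚ.* fromℤ i ℚ.* 1ℚ ℚ.+ 0ℚ ℚ.* (0ℚ ℚ.* 1ℚ)) (factor-two (+ n)) ⟩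
    M ℚ.* M ℚ.* 1ℚ ℚ.+ 0ℚ ℚ.* (0ℚ ℚ.* 1ℚ)
      ≡⟨ ≡.trans (ℚ.+-identityʳ (M ℚ.* M ℚ.* 1ℚ)) (ℚ.*-assoc M M 1ℚ) ⟩
    M ℚ.* (M ℚ.* 1ℚ) ∎
  step ℓ@(suc j) = begin
    M ℚ.* fromℤ (steppedProduct n (3 ℕ.+ j)) ℚ.* f ℚ.+ L ℚ.* (L ℚ.* (M ℚ.* s ℚ.* f))
      ≡⟨ ≡.cong (λ t → M ℚ.* t ℚ.* f ℚ.+ L ℚ.* (L ℚ.* (M ℚ.* s ℚ.* f))) (begin
           fromℤ (steppedProduct n (3 ℕ.+ j))                           ≡⟨ ≡.cong fromℤ (steppedProduct-suc-suc n j) ⟩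
           fromℤ (g₀ ℤ.* (steppedProduct n ℓ ℤ.* g₁))                   ≡⟨ fromℤ-* g₀ _ ⟩
           fromℤ g₀ ℚ.* fromℤ (steppedProduct n ℓ ℤ.* g₁)               ≡⟨ ≡.cong (fromℤ g₀ ℚ.*_)
               (fromℤ-* (steppedProduct n ℓ) g₁) ⟩
           fromℤ g₀ ℚ.* (s ℚ.* fromℤ g₁)                                ∎) ⟩
    M ℚ.* (fromℤ g₀ ℚ.* (s ℚ.* fromℤ g₁)) ℚ.* f ℚ.+ L ℚ.* (L ℚ.* (M ℚ.* s ℚ.* f))
      ≡⟨ solve 6 (λ m x s y f l → m :* (x :* (s :* y)) :* f :+ l :* (l :* (m :* s :* f)) := (x :* y :+ l :* l) :* (m :* s :* f))
          ≡.refl M (fromℤ g₀) s (fromℤ g₁) f L ⟩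
    (fromℤ g₀ ℚ.* fromℤ g₁ ℚ.+ L ℚ.* L) ℚ.* b ℓ
      ≡⟨ ≡.cong (ℚ._* b ℓ) (begin
           fromℤ g₀ ℚ.* fromℤ g₁ ℚ.+ L ℚ.* L                            ≡⟨ ≡.cong₂ ℚ._+_ (fromℤ-* g₀ g₁) (fromℤ-* (+ ℓ) (+ ℓ)) ⟨
           fromℤ (g₀ ℤ.* g₁) ℚ.+ fromℤ (+ ℓ ℤ.* + ℓ)                    ≡⟨ fromℤ-+ (g₀ ℤ.* g₁) (+ ℓ ℤ.* + ℓ) ⟨
           fromℤ (g₀ ℤ.* g₁ ℤ.+ + ℓ ℤ.* + ℓ)                            ≡⟨ ≡.cong fromℤ (factor-square (+ n) (+ ℓ)) ⟩
           fromℤ (+ suc n ℤ.* + suc n)                                  ≡⟨ fromℤ-* (+ suc n) (+ suc n) ⟩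
           M ℚ.* M                                                      ∎) ⟩
    M ℚ.* M ℚ.* b ℓ
      ≡⟨ ℚ.*-assoc M M (b ℓ) ⟩
    M ℚ.* (M ℚ.* b ℓ) ∎
    where
    f = 1/ ℓ !
    L = fromℕ ℓ
    s = fromℤ (steppedProduct n ℓ)
    g₀ = steppedFactor n (3 ℕ.+ j) 0
    g₁ = steppedFactor n (3 ℕ.+ j) (suc j)

module _ {X : Set} where
  private
    module R = CommutativeRing (polyRing X)
    module PS = Solver {X}

  expansionSeries : ℕ → Series {X}
  expansionSeries n ℓ = con (expansionCoefficient n ℓ)

  expansionSeries-one : ∀ n → expansionSeries n 1 ≈ con (fromℕ (suc n))
  expansionSeries-one n = R.reflexive (≡.cong con (≡.trans (ℚ.*-identityʳ _) (ℚ.*-identityʳ (fromℕ (suc n)))))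

  expansionSeries-step : ∀ n ℓ → let a = expansionSeries n in
    con (fromℕ (suc ℓ)) * (con (fromℕ (suc (suc ℓ))) * a (suc (suc ℓ))) + con (fromℕ ℓ) * (con (fromℕ ℓ) * a ℓ) ≈ con
        (fromℕ (suc n)) * (con (fromℕ (suc n)) * a ℓ)
  expansionSeries-step n ℓ = ≈-trans (+-cong (merge (fromℕ (suc ℓ)) (fromℕ (suc (suc ℓ))) (b (suc (suc ℓ))))
      (merge (fromℕ ℓ) (fromℕ ℓ) (b ℓ)))
    (≈-trans (≈-sym (con-+ _ _)) (≈-trans (R.reflexive (≡.cong con (expansionCoefficient-step n ℓ)))
        (≈-sym (merge (fromℕ (suc n)) (fromℕ (suc n)) (b ℓ)))))
    where
    b = expansionCoefficient n
    merge : ∀ x y z → con x * (con y * con z) ≈ con {X} (x ℚ.* (y ℚ.* z))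
    merge x y z = ≈-trans (*-congˡ (≈-sym (con-* y z))) (≈-sym (con-* x (y ℚ.* z)))

  -- In degree k + 2 the terms w y′ and w² y″ contribute k + 2 and (k + 2)(k + 1), together (k +
  -- 2)². In degrees 0 and 1 the entries brought in by `shift` are zero, and each of these degrees
  -- is a case of its own.
  expansionSeries-ode : ∀ n → let a = expansionSeries n in
    shift (D a) ⊕ (D (D a) ⊕ shift (shift (D (D a)))) ≋ con (fromℕ (suc n)) · (con (fromℕ (suc n)) · a)
  expansionSeries-ode n zero = ≈-trans
    (PS.solve 2 (λ x z → PS.con 0ℚ PS.:+ (x PS.:+ PS.con 0ℚ) PS.:= x PS.:+ PS.con 0ℚ PS.:* (PS.con 0ℚ PS.:* z)) ≈-refl
        (D (D (expansionSeries n)) 0) (expansionSeries n 0))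
    (expansionSeries-step n 0)
  expansionSeries-ode n (suc zero) = ≈-trans
    (PS.solve 2 (λ x z → PS.con 1ℚ PS.:* z PS.:+ (x PS.:+ PS.con 0ℚ) PS.:= x PS.:+ PS.con 1ℚ PS.:* (PS.con 1ℚ PS.:* z)) ≈-refl
        (D (D (expansionSeries n)) 1) (expansionSeries n 1))
    (expansionSeries-step n 1)
  expansionSeries-ode n (suc (suc k)) = ≈-trans
    (≈-trans (PS.solve 4 (λ x y u z → x PS.:* z PS.:+ (y PS.:+ u PS.:* (x PS.:* z)) PS.:= y PS.:+ (PS.con 1ℚ PS.:+ u) PS.:*
        (x PS.:* z)) ≈-refl
      (con (fromℕ (suc (suc k)))) (D (D (expansionSeries n)) (suc (suc k))) (con (fromℕ (suc k)))
          (expansionSeries n (suc (suc k))))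
      (+-congˡ (*-congʳ (≈-sym (con-suc (suc k))))))
    (expansionSeries-step n (suc (suc k)))

-- SHₙ as a coefficient of a power of the generating function

substitute-⋆ : ∀ {X Y : Set} (s : X → Poly Y) (f g : Series {X}) → substitute s ∘ (f ⋆ g) ≋ (substitute s ∘ f) ⋆
    (substitute s ∘ g)
substitute-⋆ s f g n = CommutativeRing.reflexive (polyRing _) (substitute-sum s {suc n} (λ k → f (toℕ k) * g (n ℕ.∸ toℕ k)))

-- The factor n + 1 turns the character into a product over cycles, so it can be shared out as one
-- factor n + 1 for each pₖ.
PF-cycleIndex : ∀ n → con (fromℕ (suc n)) * PF n ≈ CycleIndex.cycleIndex (fromℕ (suc n)) n
PF-cycleIndex n = begin
  M * (con (1/ n !) * T)                          ≈⟨ PS.solve 3 (λ a b c → a PS.:* (b PS.:* c) PS.:= b PS.:* (a PS.:* c)) ≈-refl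
      M (con (1/ n !)) T ⟩
  con (1/ n !) * (M * T)                          ≈⟨ *-congˡ
      (∑-distribˡ M (permutations n) (λ w → con (χ w) * (∏[ k ∈ cycleType w ] p k))) ⟩
  con (1/ n !) * (∑[ w ∈ permutations n ] (M * (con (χ w) * (∏[ k ∈ cycleType w ] p k))))
    ≈⟨ *-congˡ (∑-cong (permutations n) λ w → ≈-trans (≈-sym (*-assoc M (con (χ w)) _))
         (≈-trans (*-congʳ (parkingCharacter-cycleWeight n w)) (≈-sym (∏-* (cycleType w) (λ _ → M) p)))) ⟩
  con (1/ n !) * (∑[ w ∈ permutations n ] (∏[ k ∈ cycleType w ] (M * p k))) ∎
  where
  open SetoidReasoning (setoid {ℕ})
  module PS = Solver {ℕ}
  χ = parkingCharacter n
  M : Λ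
  M = con (fromℕ (suc n))
  T : Λ
  T = ∑[ w ∈ permutations n ] (con (χ w) * (∏[ k ∈ cycleType w ] p k))

module _ (N : ℕ) where
  private
    module R = CommutativeRing (polyRing (Fin N))
    module S = CommutativeRing (seriesRing {Fin N})
    module PS = Solver {Fin N}
    G = generatingFunction N
    r : Series {Fin N}
    r = totalRate {N = N} var
    s : Λ → Poly (Fin N)
    s f = inVariables N (shiftify f)

  specialise-cong : ∀ {f g} → f ≈ g → s f ≈ s g
  specialise-cong e = substitute-cong _ (substitute-cong _ e)

  rate-parity : ∀ (x : Poly (Fin N)) n → rate x n ≈ (con 1ℚ + alternating n) * x ^ suc n
  rate-parity x n = ≈-trans (+-congˡ (*-congˡ (^-neg x n)))
    (PS.solve 3 (λ e x y → x PS.:* y PS.:+ x PS.:* (e PS.:* y) PS.:= (PS.con 1ℚ PS.:+ e) PS.:* (x PS.:* y)) ≈-refl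
        (alternating n) x (x ^ n))

  -- Doubling odd power sums and killing even ones is multiplication of pₙ₊₁ by 1 + (-1)ⁿ, and this
  -- factor is built into the rate x (xⁿ + (-x)ⁿ) of each variable.
  shiftify-p : ∀ n → s (p (suc n)) ≈ r n
  shiftify-p n = ≈-trans (case (2 ∣? suc n) (parity {Fin N} n))
      (≈-trans (*-distribˡ-sum (con 1ℚ + alternating n) (λ i → var i ^ suc n))
    (sum-cong {n = N} λ i → ≈-sym (rate-parity (var i) n)))
    where
    open Sum R.semiring using (*-distribˡ-sum)
    case : (d : Dec (2 ∣ suc n)) → (2 ∣ n × alternating {Fin N} n ≈ con 1ℚ) ⊎ (¬ 2 ∣ n × alternating {Fin N} n ≈ - con 1ℚ) →
           inVariables N (if does d then con 0ℚ else con (1ℚ ℚ.+ 1ℚ) * p (suc n)) ≈ (con 1ℚ + alternating n) * sum {n = N}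
               (λ i → var i ^ suc n)
    case (no _)  (inj₁ (_ , a)) = *-congʳ (≈-trans (con-+ 1ℚ 1ℚ) (+-congˡ (≈-sym a)))
    case (yes _) (inj₂ (_ , a)) = ≈-sym (≈-trans (*-congʳ (≈-trans (+-congˡ a) (R.-‿inverseʳ (con 1ℚ)))) (zeroˡ _))
    case (yes d) (inj₁ (e , _)) = contradiction (∣1⇒≡1 (∣m+n∣m⇒∣n (≡.subst (2 ∣_) (ℕ.+-comm 1 n) d) e)) λ ()
    case (no ¬d) (inj₂ (o , _)) = contradiction (even-or-next n) λ { (inj₁ e) → o e ; (inj₂ e) → ¬d e }
      where
      even-or-next : ∀ n → 2 ∣ n ⊎ 2 ∣ suc n
      even-or-next zero = inj₁ (divides 0 ≡.refl)
      even-or-next (suc n) with even-or-next n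
      ... | inj₁ e = inj₂ (∣m∣n⇒∣m+n {2} {2} ∣-refl e)
      ... | inj₂ e = inj₁ e

  -- Shiftification and the passage to variables are ring homomorphisms fixing the rationals, so
  -- they carry `D-cycleIndex` over to D F = (n + 1) r F. The power of G satisfies the same equation
  -- with the same constant term; degree n is selected only after the series have been identified.
  SH-power : ∀ n → con (fromℕ (suc n)) * inVariables N (SH n) ≈ (G ^ₛ suc n) n
  SH-power n = ≈-trans (specialise-cong (PF-cycleIndex n)) (D-unique-⋆ (conₛ (fromℕ (suc n)) ⋆ r) DE
      (D-power {r = r} {G} (D-factorProduct {N = N} var) (suc n))
    (≈-trans (specialise-cong cycleIndex-zero)
        (≈-sym (power-zero {r = r} {G} (D-factorProduct {N = N} var) (factorProduct-zero {N = N} var) (σ-totalRate {N = N} var)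
        (suc n)))) n)
    where
    open CycleIndex (fromℕ (suc n))
    Y : Series {ℕ}
    Y k = con (fromℕ (suc n)) * p (suc k)
    DE : D (s ∘ cycleIndex) ≋ (conₛ (fromℕ (suc n)) ⋆ r) ⋆ (s ∘ cycleIndex)
    DE k = ≈-trans (specialise-cong (D-cycleIndex k)) (≈-trans
      (≈-trans (substitute-cong _ (substitute-⋆ _ Y cycleIndex k)) (substitute-⋆ _ (shiftify ∘ Y) (shiftify ∘ cycleIndex) k))
      (S.*-congʳ {s ∘ cycleIndex} {λ k → con (fromℕ (suc n)) * s (p (suc k))} {conₛ (fromℕ (suc n)) ⋆ r}
        (λ k → ≈-trans (*-congˡ (shiftify-p k)) (≈-sym (conₛ-⋆ (fromℕ (suc n)) r k))) k))

  SH-expansion : ∀ n → con (fromℕ (suc n)) * inVariables N (SH n) ≈ sum {n = suc n}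
      (λ ℓ → expansionSeries n (toℕ ℓ) * (oddPart G ^ₛ toℕ ℓ) n)
  SH-expansion n = ≈-trans (SH-power n) (power-expansion {r = r} {G} (D-factorProduct {N = N} var)
      (factorProduct-zero {N = N} var) (σ-totalRate {N = N} var)
    n (expansionSeries n) ≈-refl (expansionSeries-one n) (expansionSeries-ode n) n)

-- Odd partitions

-- The list ends at 2n - 1 so that its multiplicity factorials are those of
-- `oddMultiplicityFactorials`.
oddNumbers : ℕ → List ℕ
oddNumbers n = map (λ i → suc (2 ℕ.* i)) (upTo n)

oddNumbers-unique : ∀ n → Unique (oddNumbers n)
oddNumbers-unique n = Unique.map⁺ (λ e → ℕ.*-cancelˡ-≡ _ _ 2 (ℕ.suc-injective e)) (Unique.upTo⁺ n)

odd-suc-double : ∀ i → Odd (suc (2 ℕ.* i))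
odd-suc-double i d = contradiction (∣1⇒≡1 (∣m+n∣m⇒∣n (≡.subst (2 ∣_) (ℕ.+-comm 1 (2 ℕ.* i)) d) (m∣m*n i))) λ ()

odd⇒suc-double : ∀ k → Odd k → ∃ λ i → k ≡ suc (2 ℕ.* i)
odd⇒suc-double zero          o = contradiction (divides 0 ≡.refl) o
odd⇒suc-double (suc zero)    o = 0 , ≡.refl
odd⇒suc-double (suc (suc k)) o with i , ≡.refl ← odd⇒suc-double k (λ e → o (∣m∣n⇒∣m+n {2} {2} ∣-refl e)) =
  suc i , ≡.cong (λ j → suc (suc j)) (≡.sym (ℕ.+-suc i (i ℕ.+ 0)))

∈-oddNumbers⁺ : ∀ {n k} → Odd k → k ≤ n → k ∈ oddNumbers n
∈-oddNumbers⁺ {n} {k} o k≤n with i , ≡.refl ← odd⇒suc-double k o =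
  ∈-map⁺ (λ i → suc (2 ℕ.* i)) (∈-upTo⁺ (ℕ.≤-trans (s≤s (ℕ.m≤m+n i (i ℕ.+ 0))) k≤n))

∈-oddNumbers⁻ : ∀ n {k} → k ∈ oddNumbers n → Odd k × 1 ≤ k
∈-oddNumbers⁻ n k∈ with i , _ , ≡.refl ← ∈-map⁻ (λ i → suc (2 ℕ.* i)) k∈ = odd-suc-double i , s≤s z≤n

∈-[1⋯]⁺ : ∀ {n k} → 1 ≤ k → k ≤ n → k ∈ [1⋯ n ]
∈-[1⋯]⁺ {k = suc k} _ k<n = ∈-map⁺ suc (∈-upTo⁺ k<n)

∈-[1⋯]⁻ : ∀ n {k} → k ∈ [1⋯ n ] → k ≤ n
∈-[1⋯]⁻ n k∈ with i , i∈ , ≡.refl ← ∈-map⁻ suc k∈ = ∈-upTo⁻ i∈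

All-≤-total : ∀ xs → All (_≤ total xs) xs
All-≤-total []       = []
All-≤-total (x ∷ xs) = ℕ.m≤m+n x (total xs) ∷ All.map (λ q → ℕ.≤-trans q (ℕ.m≤n+m (total xs) x)) (All-≤-total xs)

oddMultisets : ℕ → ℕ → List (List ℕ)
oddMultisets n ℓ = filter (λ xs → total xs ℕ.≟ n) (multisets (oddNumbers n) ℓ)

-- A part never exceeds the sum, so partitions cut out of words over 1, ..., n and multisets of odd
-- letters restricted to sum n have the same members; neither list repeats an entry. The second form
-- is the one the multinomial theorem produces.
oddPartitions-length : ∀ n ℓ → filter (all? odd?) (filter (isPartition? n) (wordLists [1⋯ n ] ℓ)) ↭ oddMultisets n ℓ
oddPartitions-length n ℓ = unique-⇔-↭
  (Unique.filter⁺ (all? odd?) (Unique.filter⁺ (isPartition? n)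
      (wordLists-unique (Unique.map⁺ ℕ.suc-injective (Unique.upTo⁺ n)) ℓ)))
  (Unique.filter⁺ (λ xs → total xs ℕ.≟ n) (multisets-unique (oddNumbers-unique n) ℓ))
  λ xs → mk⇔ to from
  where
  to : ∀ {xs} → xs ∈ filter (all? odd?) (filter (isPartition? n) (wordLists [1⋯ n ] ℓ)) → xs ∈ oddMultisets n ℓ
  to p with p , odd ← ∈-filter⁻ (all? odd?) {xs = filter (isPartition? n) (wordLists [1⋯ n ] ℓ)} p
    with p , s , _ , t ← ∈-filter⁻ (isPartition? n) {xs = wordLists [1⋯ n ] ℓ} p
    with a , len ← ∈-wordLists⁻ ℓ p =
    ∈-filter⁺ (λ xs → total xs ℕ.≟ n) (∈-multisets⁺ s (All.zipWith (λ (o , k∈) → ∈-oddNumbers⁺ o (∈-[1⋯]⁻ n k∈)) (odd , a)) len) t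
  from : ∀ {xs} → xs ∈ oddMultisets n ℓ → xs ∈ filter (all? odd?) (filter (isPartition? n) (wordLists [1⋯ n ] ℓ))
  from {xs} p with p , ≡.refl ← ∈-filter⁻ (λ xs → total xs ℕ.≟ n) {xs = multisets (oddNumbers n) ℓ} p
    with s , a , ≡.refl ← ∈-multisets⁻ ℓ p =
    ∈-filter⁺ (all? odd?) (∈-filter⁺ (isPartition? n)
      (∈-wordLists⁺ xs (All.zipWith (λ (k∈ , k≤) → ∈-[1⋯]⁺ (proj₂ (∈-oddNumbers⁻ n k∈)) k≤) (a , All-≤-total xs)))
      (s , All.map (λ k∈ → proj₂ (∈-oddNumbers⁻ n k∈)) a , ≡.refl)) (All.map (λ k∈ → proj₁ (∈-oddNumbers⁻ n k∈)) a)

module _ {X : Set} where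
  private module R = CommutativeRing (polyRing X)

  ∑-concatMap : ∀ {A B : Set} (h : A → List B) (xs : List A) (f : B → Poly X) →
                ∑[ b ∈ List.concatMap h xs ] f b ≈ ∑[ a ∈ xs ] (∑[ b ∈ h a ] f b)
  ∑-concatMap h []       f = ≈-refl
  ∑-concatMap h (x ∷ xs) f = ≈-trans (∑-++ (h x) (List.concatMap h xs) f) (+-congˡ (∑-concatMap h xs f))

  ∑-applyUpTo : ∀ {A : Set} (h : ℕ → A) n (f : A → Poly X) → ∑[ a ∈ List.applyUpTo h n ] f a ≡ sum {n = n} (λ i → f (h (toℕ i)))
  ∑-applyUpTo h zero    f = ≡.refl
  ∑-applyUpTo h (suc n) f = ≡.cong₂ _+_ ≡.refl (∑-applyUpTo (h ∘ suc) n f)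

  ∑-oddPartitions : ∀ n (f : List ℕ → Poly X) → ∑[ xs ∈ oddPartitions n ] f xs ≈ sum {n = suc n}
      (λ ℓ → ∑[ xs ∈ oddMultisets n (toℕ ℓ) ] f xs)
  ∑-oddPartitions n f = begin
    ∑[ xs ∈ oddPartitions n ] f xs                                ≈⟨ unfilter (List.concatMap W (upTo (suc n))) ⟩
    ∑[ xs ∈ List.concatMap W (upTo (suc n)) ] g xs                ≈⟨ ∑-concatMap W (upTo (suc n)) g ⟩
    ∑[ ℓ ∈ upTo (suc n) ] (∑[ xs ∈ W ℓ ] g xs)                    ≈⟨ ∑-cong (upTo (suc n))
        (λ ℓ → ≈-trans (≈-sym (unfilter (W ℓ))) (∑-↭ (oddPartitions-length n ℓ) f)) ⟩
    ∑[ ℓ ∈ upTo (suc n) ] (∑[ xs ∈ oddMultisets n ℓ ] f xs)       ≡⟨ ∑-applyUpTo id (suc n)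
        (λ ℓ → ∑[ xs ∈ oddMultisets n ℓ ] f xs) ⟩
    sum {n = suc n} (λ ℓ → ∑[ xs ∈ oddMultisets n (toℕ ℓ) ] f xs) ∎
    where
    open SetoidReasoning (setoid {X})
    W = wordLists [1⋯ n ]
    g : List ℕ → Poly X
    g xs = if does (isPartition? n xs) then (if does (all? odd? xs) then f xs else con 0ℚ) else con 0ℚ
    unfilter : ∀ xss → ∑[ xs ∈ filter (all? odd?) (filter (isPartition? n) xss) ] f xs ≈ ∑[ xs ∈ xss ] g xs
    unfilter xss = ≈-trans (∑-filter (all? odd?) (filter (isPartition? n) xss) f)
        (∑-filter (isPartition? n) xss (λ xs → if does (all? odd? xs) then f xs else con 0ℚ))

  -- The monomial c tᵏ. With such letters, a product over a multiset records its sum as the exponent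
  -- of t.
  term : ℕ → Poly X → Series {X}
  term k c n = if does (k ℕ.≟ n) then c else con 0ℚ

  term-⋆ : ∀ k c l d → term k c ⋆ term l d ≋ term (k ℕ.+ l) (c * d)
  term-⋆ zero c l d n = ≈-trans (⋆-cong {f = term 0 c} {c · 1ₛ} {term l d} constant (λ _ → ≈-refl) n)
    (≈-trans (·-⋆ c 1ₛ (term l d) n) (≈-trans (*-congˡ (1ₛ-⋆ (term l d) n)) (scale (does (l ℕ.≟ n)))))
    where
    constant : term 0 c ≋ c · 1ₛ
    constant zero    = ≈-sym (*-identityʳ c)
    constant (suc n) = ≈-sym (zeroʳ c)
    scale : ∀ b → c * (if b then d else con 0ℚ) ≈ (if b then c * d else con 0ℚ)
    scale true  = ≈-refl
    scale false = zeroʳ c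
  term-⋆ (suc k) c l d zero    = ≈-trans (+-identityʳ _) (zeroˡ _)
  term-⋆ (suc k) c l d (suc n) = ≈-trans (+-congʳ (zeroˡ _)) (≈-trans (+-identityˡ _) (term-⋆ k c l d n))

  ^ₛ-cong-≤ : ∀ {f g : Series {X}} ℓ n → (∀ k → k ≤ n → f k ≈ g k) → (f ^ₛ ℓ) n ≈ (g ^ₛ ℓ) n
  ^ₛ-cong-≤ zero    n e = ≈-refl
  ^ₛ-cong-≤ {f} {g} (suc ℓ) n e = ⋆-cong-≤ {f = f} {g} n e (λ k k≤n → ^ₛ-cong-≤ ℓ k (λ j j≤k → e j (ℕ.≤-trans j≤k k≤n)))

  ∏-constant : ∀ {A : Set} c (xs : List A) → ∏[ _ ∈ xs ] con {X} (fromℕ c) ≈ con (fromℕ (c ℕ.^ length xs))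
  ∏-constant c []       = ≈-refl
  ∏-constant c (x ∷ xs) = ≈-trans (*-congˡ (∏-constant c xs))
      (≈-trans (≈-sym (con-* _ _)) (R.reflexive (≡.cong con (≡.sym (fromℕ-* c (c ℕ.^ length xs))))))

coefficient-weight : ∀ n ℓ xs → length xs ≡ suc ℓ →
  fromℕ (suc n) ℚ.* coefficient n xs ≡ expansionCoefficient n (suc ℓ) ℚ.* fromℕ (suc ℓ !) ℚ.* weight (oddNumbers n) xs ℚ.* fromℕ
      (2 ℕ.^ length xs)
coefficient-weight n ℓ xs len with length xs | len
... | .(suc ℓ) | ≡.refl = begin
  M ℚ.* ((+ (2 ℕ.^ suc ℓ) ℚ./ (suc ℓ !)) {{suc ℓ !≢0}} ℚ.* (+ (suc ℓ !) ℚ./ oddMultiplicityFactorials n xs)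
      {{oddMultiplicityFactorials≢0 n xs}} ℚ.* s)
    ≡⟨ ≡.cong₂ (λ a b → M ℚ.* (a ℚ.* b ℚ.* s)) (/-fromℕ (2 ℕ.^ suc ℓ) (suc ℓ !) {{suc ℓ !≢0}})
        (/-fromℕ (suc ℓ !) (oddMultiplicityFactorials n xs) {{oddMultiplicityFactorials≢0 n xs}}) ⟩
  M ℚ.* (t ℚ.* f ℚ.* (g ℚ.* (+ 1 ℚ./ oddMultiplicityFactorials n xs) {{oddMultiplicityFactorials≢0 n xs}}) ℚ.* s)
    ≡⟨ ≡.cong (λ w → M ℚ.* (t ℚ.* f ℚ.* (g ℚ.* w) ℚ.* s)) (reciprocal (oddMultiplicityFactorials n xs)
        (multiplicityFactorials (oddNumbers n) xs)
         {{oddMultiplicityFactorials≢0 n xs}} {{multiplicityFactorials≢0 (oddNumbers n) xs}}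
             (≡.cong product (List.map-∘ (upTo n)))) ⟩
  M ℚ.* (t ℚ.* f ℚ.* (g ℚ.* w) ℚ.* s)
    ≡⟨ solve 6 (λ M t f g w s → M :* (t :* f :* (g :* w) :* s) := M :* s :* f :* g :* w :* t) ≡.refl M t f g w s ⟩
  M ℚ.* s ℚ.* f ℚ.* g ℚ.* w ℚ.* t ∎
  where
  open ≡.≡-Reasoning
  open ℚ-Solver.+-*-Solver using (solve; _:*_; _:=_)
  M = fromℕ (suc n)
  s = fromℤ (steppedProduct n (suc ℓ))
  f = 1/ suc ℓ !
  g = fromℕ (suc ℓ !)
  w = weight (oddNumbers n) xs
  t = fromℕ (2 ℕ.^ suc ℓ)
  reciprocal : ∀ q r .{{_ : NonZero q}} .{{_ : NonZero r}} → q ≡ r → + 1 ℚ./ q ≡ + 1 ℚ./ r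
  reciprocal q .q ≡.refl = ≡.refl

module _ (N n : ℕ) where
  private
    module R = CommutativeRing (polyRing (Fin N))
    module S = CommutativeRing (seriesRing {Fin N})
    module PS = Solver {Fin N}
    G = generatingFunction N
    W = oddPart G
    c : ℕ → Poly (Fin N)
    c k = con (fromℕ 2) * P N k
  open Multinomial (oddNumbers-unique n) (λ k → term k (c k))

  monomial-term : ∀ xs → monomial xs ≋ term (total xs) (∏[ k ∈ xs ] c k)
  monomial-term []       zero    = ≈-refl
  monomial-term []       (suc m) = ≈-refl
  monomial-term (k ∷ xs) = S.trans (S.*-congˡ {term k (c k)} (monomial-term xs)) (term-⋆ k (c k) (total xs) (∏[ k ∈ xs ] c k))

  -- Finitely many letters cannot reproduce all of `W`; agreement up to degree n is enough for the
  -- n-th coefficient of every power.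
  letterSum-oddPart : ∀ k → k ≤ n → W k ≈ letterSum k
  letterSum-oddPart k k≤n with 2 ∣? k
  ... | yes even = ≈-trans (oddPart-even G even) (≈-sym (∑-indicator-∉ c (oddNumbers n)
    (All.tabulate λ j∈ k≡j → proj₁ (∈-oddNumbers⁻ n j∈) (≡.subst (2 ∣_) k≡j even))))
  ... | no  odd  = ≈-trans (oddPart-odd G odd) (≈-trans
    (PS.solve 1 (λ g → g PS.:= PS.con (fromℕ 2) PS.:* (PS.con ½ PS.:* g)) ≈-refl (G k))
    (≈-sym (∑-indicator-∈ c (oddNumbers-unique n) (∈-oddNumbers⁺ odd k≤n))))

  oddPart-power : ∀ ℓ → (W ^ₛ ℓ) n ≈ con (fromℕ (ℓ !)) * (∑[ xs ∈ oddMultisets n ℓ ]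
      (con (weight (oddNumbers n) xs) * (∏[ k ∈ xs ] c k)))
  oddPart-power ℓ = begin
    (W ^ₛ ℓ) n                                ≈⟨ ^ₛ-cong-≤ ℓ n letterSum-oddPart ⟩
    (letterSum ^ₛ ℓ) n                        ≈⟨ multinomial ℓ n ⟩
    con (fromℕ (ℓ !)) * multisetSum ℓ n
      ≈⟨ *-congˡ (∑-cong (multisets (oddNumbers n) ℓ) λ xs → ≈-trans (*-congˡ (monomial-term xs n))
          (scale (does (total xs ℕ.≟ n)))) ⟩
    con (fromℕ (ℓ !)) * (∑[ xs ∈ multisets (oddNumbers n) ℓ ]
        (if does (total xs ℕ.≟ n) then con (weight (oddNumbers n) xs) * (∏[ k ∈ xs ] c k) else con 0ℚ))
      ≈⟨ *-congˡ (∑-filter (λ xs → total xs ℕ.≟ n) (multisets (oddNumbers n) ℓ)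
          (λ xs → con (weight (oddNumbers n) xs) * (∏[ k ∈ xs ] c k))) ⟨
    con (fromℕ (ℓ !)) * (∑[ xs ∈ oddMultisets n ℓ ] (con (weight (oddNumbers n) xs) * (∏[ k ∈ xs ] c k))) ∎
    where
    open SetoidReasoning (setoid {Fin N})
    scale : ∀ b {f g : Poly (Fin N)} → f * (if b then g else con 0ℚ) ≈ (if b then f * g else con 0ℚ)
    scale true  = ≈-refl
    scale false = zeroʳ _

  -- The power of 2 in `coefficient` collects the factor 2 of each `c k`, the multiplicity
  -- factorials come from `weight`, and the multinomial ℓ! meets the 1/ℓ! of the expansion
  -- coefficient.
  oddMultisets-sum : ∀ ℓ → con (fromℕ (suc n)) * (∑[ xs ∈ oddMultisets n (suc ℓ) ] (con (coefficient n xs) * V N xs)) ≈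
      expansionSeries n (suc ℓ) * (W ^ₛ suc ℓ) n
  oddMultisets-sum ℓ = begin
    con M * (∑[ xs ∈ L ] (con (coefficient n xs) * V N xs))
      ≈⟨ ∑-distribˡ (con M) L (λ xs → con (coefficient n xs) * V N xs) ⟩
    ∑[ xs ∈ L ] (con M * (con (coefficient n xs) * V N xs))
      ≈⟨ ∑-cong-∈ L (λ xs xs∈ → pointwise xs
          (proj₂ (proj₂ (∈-multisets⁻ {oddNumbers n} (suc ℓ)
          (proj₁ (∈-filter⁻ (λ xs → total xs ℕ.≟ n) {xs = multisets (oddNumbers n) (suc ℓ)} xs∈)))))) ⟩
    ∑[ xs ∈ L ] (con b * con f * (con (weight (oddNumbers n) xs) * (∏[ k ∈ xs ] c k)))
      ≈⟨ ∑-distribˡ (con b * con f) L (λ xs → con (weight (oddNumbers n) xs) * (∏[ k ∈ xs ] c k)) ⟨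
    con b * con f * (∑[ xs ∈ L ] (con (weight (oddNumbers n) xs) * (∏[ k ∈ xs ] c k)))
      ≈⟨ *-assoc _ _ _ ⟩
    con b * (con f * (∑[ xs ∈ L ] (con (weight (oddNumbers n) xs) * (∏[ k ∈ xs ] c k))))
      ≈⟨ *-congˡ (oddPart-power (suc ℓ)) ⟨
    con b * (W ^ₛ suc ℓ) n ∎
    where
    open SetoidReasoning (setoid {Fin N})
    L = oddMultisets n (suc ℓ)
    M = fromℕ (suc n)
    b = expansionCoefficient n (suc ℓ)
    f = fromℕ (suc ℓ !)
    pointwise : ∀ xs → length xs ≡ suc ℓ → con M * (con (coefficient n xs) * V N xs) ≈ con b * con f *
        (con (weight (oddNumbers n) xs) * (∏[ k ∈ xs ] c k))
    pointwise xs len = begin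
      con M * (con (coefficient n xs) * V N xs)
        ≈⟨ *-assoc _ _ _ ⟨
      con M * con (coefficient n xs) * V N xs
        ≈⟨ *-congʳ (≈-trans (≈-sym (con-* M (coefficient n xs))) (R.reflexive (≡.cong con (coefficient-weight n ℓ xs len)))) ⟩
      con (b ℚ.* f ℚ.* w ℚ.* t) * V N xs
        ≈⟨ *-congʳ (≈-trans (con-* (b ℚ.* f ℚ.* w) t) (*-congʳ (≈-trans (con-* (b ℚ.* f) w) (*-congʳ (con-* b f))))) ⟩
      con b * con f * con w * con t * V N xs
        ≈⟨ PS.solve 4 (λ q w t v → q PS.:* w PS.:* t PS.:* v PS.:= q PS.:* (w PS.:* (t PS.:* v))) ≈-refl (con b * con f) (con w)
            (con t) (V N xs) ⟩
      con b * con f * (con w * (con t * V N xs))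
        ≈⟨ *-congˡ (*-congˡ (≈-trans (∏-* xs (λ _ → con (fromℕ 2)) (P N)) (*-congʳ (∏-constant 2 xs)))) ⟨
      con b * con f * (con w * (∏[ k ∈ xs ] c k)) ∎
      where
      w = weight (oddNumbers n) xs
      t = fromℕ (2 ℕ.^ length xs)

-- Comparison of the two sides, length by length

theorem3p4 : (n : ℕ) → 1 ≤ n → (N : ℕ) →
    inVariables N (SH n) ≈ (∑[ λs ∈ oddPartitions n ] (con (coefficient n λs) * V N λs))
theorem3p4 n@(suc _) _ N = con-suc-cancel n (begin
  M * inVariables N (SH n)
    ≈⟨ SH-expansion N n ⟩
  sum {n = suc n} (λ ℓ → expansionSeries n (toℕ ℓ) * (W ^ₛ toℕ ℓ) n)
    ≈⟨ sum-cong {n = suc n} byLength ⟨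
  sum {n = suc n} (λ ℓ → M * (∑[ λs ∈ oddMultisets n (toℕ ℓ) ] (con (coefficient n λs) * V N λs)))
    ≈⟨ *-distribˡ-sum {suc n} M (λ ℓ → ∑[ λs ∈ oddMultisets n (toℕ ℓ) ] (con (coefficient n λs) * V N λs)) ⟨
  M * sum {n = suc n} (λ ℓ → ∑[ λs ∈ oddMultisets n (toℕ ℓ) ] (con (coefficient n λs) * V N λs))
    ≈⟨ *-congˡ (∑-oddPartitions n (λ λs → con (coefficient n λs) * V N λs)) ⟨
  M * (∑[ λs ∈ oddPartitions n ] (con (coefficient n λs) * V N λs)) ∎)
  where
  open SetoidReasoning (setoid {Fin N})
  open Sum (CommutativeRing.semiring (polyRing (Fin N))) using (*-distribˡ-sum)
  M : Poly (Fin N)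
  M = con (fromℕ (suc n))
  W = oddPart (generatingFunction N)
  byLength : ∀ (ℓ : Fin (suc n)) → M * (∑[ λs ∈ oddMultisets n (toℕ ℓ) ] (con (coefficient n λs) * V N λs)) ≈ expansionSeries n
      (toℕ ℓ) * (W ^ₛ toℕ ℓ) n
  -- Positivity of n enters here: the empty list does not have sum n, and the zeroth power of `W`
  -- has no coefficient in degree n.
  byLength Fin.zero    = ≈-trans (zeroʳ _) (≈-sym (zeroʳ _))
  byLength (Fin.suc ℓ) = oddMultisets-sum N n (toℕ ℓ)
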